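{- (1) For all integers $n\ge 3$, $\tau(n,0)=\max\{1,n-4\}$. (2) Up to isomorphism, the quasilinear betweenness structures (of order $n \ge 3$) are the following: - $\mathcal{R}_{n,i}^4$ for $n\ge 5$ and $i\in I_n^4$; - $\mathcal{S}_n^4$ for $n\ge 5$; - the betweenness structures $\mathcal{B}(G)$ where $G$ is one of the following eight graphs: the complete graph $K_3$; the star $K_{1,3}$; the weighted $4$-cycle whose edge weights in cyclic order are $1,1,2,2$; the complete bipartite graph $K_{2,3}$; the complete bipartite graph $K_{3,3}$; $K_{3,3}$ with one edge deleted; $K_{3,3}$ with two disjoint edges deleted; the cycle $C_6$ (all edge weights are $1$ except in the weighted $4$-cycle).
   Context: A betweenness structure is a pair $\mathcal{B}=(X,\beta)$ where $X$ is a nonempty finite set and $\beta\subseteq X^3$; write $(x\ y\ z)$ for $(x,y,z)\in\beta$. All betweenness structures are assumed to be almost-metrizable, i.e. for all $x,y,z,w\in X$: (P1) $(x\ x\ z)$; (P2) $(x\ y\ z)\Rightarrow(z\ y\ x)$; (P3) $(x\ y\ z)\wedge(y\ x\ z)\Rightarrow x=y$; (P4) $(x\ y\ z)\wedge(x\ w\ y)\Rightarrow(x\ w\ z)\wedge(w\ y\ z)$. The order of $\mathcal{B}$ is $|X|$. A set of three distinct points is collinear if some ordering of it is in $\beta$; otherwise it is a triangle. The co-size of $\mathcal{B}$ is its number of triangles. $B(n,m)$ is the set of betweenness structures of order $n$ and co-size $m$. Isomorphisms are bijections of ground sets preserving betweenness in both directions. $\tau(n,k)=\min\{m>k: B(n,m)\ne\emptyset\}$.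 A betweenness structure of order $n$ is quasilinear if its co-size equals $\tau(n,0)$, i.e. it has at least one triangle and has minimum co-size among the structures of order $n$ having a triangle. Graphs are connected with positive real edge weights (weight $1$ unless specified). For a graph $W$ with shortest-path metric $d_W$ (path length is the sum of edge weights), the betweenness structure $\mathcal{B}(W)$ induced by $W$ lives on the vertex set and has $(x\ y\ z)$ iff $d_W(x,z)=d_W(x,y)+d_W(y,z)$. Let $I_n^4=\{i\in\mathbb{N}:1\le i\le\lceil\frac{n-3}{2}\rceil\}$. The following graphs have vertex set $\{x_1,\dots,x_{n-2},y,z\}$ and are obtained from the path $P=x_1x_2\ldots x_{n-2}$: - $R_{n,i}^4$ ($n\ge5$, $i\in I_n^4$): delete edge $\{x_i,x_{i+1}\}$ from $P$ and add edges $\{y,x_i\},\{z,x_i\},\{y,x_{i+1}\},\{z,x_{i+1}\}$; - $S_n^4$ ($n\ge5$): add edges $\{x_1,y\}$, $\{x_{n-2},z\}$, and add edge $\{y,z\}$ of weight $n-3$. $\mathcal{R}_{n,i}^4$ and $\mathcal{S}_n^4$ are the betweenness structures induced by $R_{n,i}^4$ and $S_n^4$. -}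

module Defs where

open import Data.Fin.Base using (Fin; zero; suc; toℕ; fromℕ<; inject₁)
import Data.Fin.Base as Fin
import Data.Fin.Properties as Fin
open import Data.Fin.Induction using (<-weakInduction)
open import Data.List.Base using (List; []; _∷_; length; filter; allFin; cartesianProduct)
import Data.List.Membership.DecPropositional as DecMembership
open import Data.Nat.Base
open import Data.Nat.DivMod using (_%_)
open import Data.Nat.Properties
open import Data.Product.Base using (Σ; ∃; _×_; _,_; proj₁; proj₂)
open import Data.Product.Properties using (≡-dec)
open import Data.Sum.Base using (_⊎_; inj₁; inj₂)
open import Data.Vec.Base using (Vec; []; _∷_; lookup)
open import Function.Base using (_∘_)
open import Function.Bundles using (_↔_; _⇔_; mk↔ₛ′; module Inverse)
open import Function.Construct.Identity using (↔-id)
open import Function.Construct.Symmetry using (↔-sym)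
open import Relation.Binary.Definitions using (DecidableEquality)
open import Relation.Binary.PropositionalEquality
open import Relation.Nullary.Decidable
  using (Dec; yes; no; True; toWitness; map′; ¬?; _×-dec_; _⊎-dec_)
open import Relation.Nullary.Negation using (¬_; contradiction)

record Finite (X : Set) : Set where
  field
    size : ℕ
    enum : X ↔ Fin size

  index : X → Fin size
  index = Inverse.to enum

  element : Fin size → X
  element = Inverse.from enum

  element-index : ∀ x → element (index x) ≡ x
  element-index = Inverse.strictlyInverseʳ enum

  _≟ᶠ_ : DecidableEquality X
  x ≟ᶠ y = map′
    (λ e → trans (sym (element-index x)) (trans (cong element e) (element-index y)))
    (cong index)
    (index x Fin.≟ index y)

  any?ᶠ : ∀ {P : X → Set} → (∀ x → Dec (P x)) → Dec (∃ P)
  any?ᶠ {P} P? = map′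
    (λ (i , p) → element i , p)
    (λ (x , p) → index x , subst P (sym (element-index x)) p)
    (Fin.any? (P? ∘ element))

record BetweennessStructure : Set₁ where
  field
    Carrier  : Set
    finite   : Finite Carrier
    nonEmpty : NonZero (Finite.size finite)
    β        : Carrier → Carrier → Carrier → Set
    β?       : ∀ x y z → Dec (β x y z)
    P1       : ∀ x z → β x x z
    P2       : ∀ x y z → β x y z → β z y x
    P3       : ∀ x y z → β x y z → β y x z → x ≡ y
    P4       : ∀ x y z w → β x y z → β x w y → β x w z × β w y z

  open Finite finite using (element)

  order : ℕ
  order = Finite.size finite

  Collinear : Carrier → Carrier → Carrier → Set
  Collinear x y z =
    β x y z ⊎ β x z y ⊎ β y x z ⊎ β y z x ⊎ β z x y ⊎ β z y x

  collinear? : ∀ x y z → Dec (Collinear x y z)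
  collinear? x y z =
    β? x y z ⊎-dec β? x z y ⊎-dec β? y x z ⊎-dec
    β? y z x ⊎-dec β? z x y ⊎-dec β? z y x

  -- A 3-element subset of the ground set is represented by its unique
  -- listing in increasing order of the enumeration. The resulting co-size does
  -- not depend on the enumeration.
  Triangle : Fin order × Fin order × Fin order → Set
  Triangle (i , j , k) =
    i Fin.< j × j Fin.< k × ¬ Collinear (element i) (element j) (element k)

  triangle? : ∀ t → Dec (Triangle t)
  triangle? (i , j , k) =
    i Fin.<? j ×-dec j Fin.<? k ×-dec
    ¬? (collinear? (element i) (element j) (element k))

  coSize : ℕ
  coSize = length (filter triangle?
    (cartesianProduct (allFin order) (cartesianProduct (allFin order) (allFin order))))

open BetweennessStructure public using (order; coSize)

record _≅_ (A B : BetweennessStructure) : Set where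
  private
    module A = BetweennessStructure A
    module B = BetweennessStructure B
  field
    bijection : A.Carrier ↔ B.Carrier

  open Inverse bijection public using (to; from)

  field
    preserves : ∀ x y z → A.β x y z ⇔ B.β (to x) (to y) (to z)

B⟨_,_⟩ : ℕ → ℕ → Set₁
B⟨ n , m ⟩ = Σ BetweennessStructure λ B → order B ≡ n × coSize B ≡ m

-- τ is a partial function, since the minimum is over a possibly empty set,
-- so it is given by its graph.
τ⟨_,_⟩≡_ : ℕ → ℕ → ℕ → Set₁
τ⟨ n , k ⟩≡ m =
  (k < m × B⟨ n , m ⟩) × (∀ m′ → k < m′ → B⟨ n , m′ ⟩ → m ≤ m′)

Quasilinear : BetweennessStructure → Set₁
Quasilinear B = τ⟨ order B , 0 ⟩≡ coSize B

-- Weights are natural numbers, and weight u v ≡ 0 means that u and v are not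
-- joined by an edge; so the weight of an edge is positive.

module _ {V : Set} (weight : V → V → ℕ) where

  data Walk : V → V → ℕ → Set where
    nil  : ∀ {v} → Walk v v 0
    step : ∀ {u v t m} → weight u v ≢ 0 → Walk v t m → Walk u t (weight u v + m)

  Joined : V → V → Set
  Joined u v = ∃ (Walk u v)

  Connected : Set
  Connected = ∀ u v → Joined u v

record WeightedGraph : Set₁ where
  field
    Vertex    : Set
    finite    : Finite Vertex
    nonEmpty  : NonZero (Finite.size finite)
    weight    : Vertex → Vertex → ℕ
    symmetric : ∀ u v → weight u v ≡ weight v u
    loopless  : ∀ v → weight v v ≡ 0
    connected : Connected weight

module _ {V : Set} {weight : V → V → ℕ} where

  _++ʷ_ : ∀ {u v t l m} → Walk weight u v l → Walk weight v t m → Walk weight u t (l + m)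
  nil ++ʷ q = q
  _++ʷ_ {m = m} (step {u} {v} {m = k} e p) q =
    subst (Walk weight _ _) (sym (+-assoc (weight u v) k m)) (step e (p ++ʷ q))

  edgeʷ : ∀ {u v} → weight u v ≢ 0 → Walk weight u v (weight u v)
  edgeʷ e = subst (Walk weight _ _) (+-identityʳ _) (step e nil)

  reverseʷ : (∀ u v → weight u v ≡ weight v u) →
             ∀ {u v m} → Walk weight u v m → Walk weight v u m
  reverseʷ wsym nil = nil
  reverseʷ wsym (step {u} {v} {m = m} e p) =
    subst (Walk weight _ _)
      (trans (+-comm m _) (cong (_+ m) (wsym v u)))
      (reverseʷ wsym p ++ʷ edgeʷ (e ∘ trans (wsym u v)))

  walk-0⇒≡ : ∀ {u v m} → Walk weight u v m → m ≡ 0 → u ≡ v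
  walk-0⇒≡ nil _ = refl
  walk-0⇒≡ (step {u} {v} e p) eq = contradiction (m+n≡0⇒m≡0 (weight u v) eq) e

  module _ (fin : Finite V) where
    open Finite fin

    private
      Step : V → V → ℕ → V → Set
      Step u t m v = weight u v ≢ 0 × weight u v ≤ m × Walk weight v t (m ∸ weight u v)

      unstep : ∀ {u t m} → ∃ (Step u t m) → Walk weight u t m
      unstep (v , e , le , p) = subst (Walk weight _ _) (m+[n∸m]≡n le) (step e p)

      toStep : ∀ {u t n m} → Walk weight u t n → n ≡ suc m → ∃ (Step u t (suc m))
      toStep (step {u} {v} {m = k} e p) eq =
        v , e , subst (weight u v ≤_) eq (m≤m+n _ k) ,
        subst (Walk weight _ _)
          (trans (sym (m+n∸m≡n (weight u v) k)) (cong (_∸ weight u v) eq)) p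

      -- The first argument bounds the length of the walk.
      search : ∀ b u t m → m ≤ b → Dec (Walk weight u t m)
      search b u t zero _ =
        map′ (λ { refl → nil }) (λ p → walk-0⇒≡ p refl) (u ≟ᶠ t)
      search (suc b) u t (suc m) (s≤s m≤b) =
        map′ unstep (λ p → toStep p refl) (any?ᶠ next?)
        where
        next? : ∀ v → Dec (Step u t (suc m) v)
        next? v with weight u v
        ... | zero  = no λ (e , _) → e refl
        ... | suc w = map′ (λ (le , p) → (λ ()) , le , p) proj₂
                        (suc w ≤? suc m ×-dec
                         search b v t (m ∸ w) (≤-trans (m∸n≤m m w) m≤b))

    walk? : ∀ u v m → Dec (Walk weight u v m)
    walk? u v m = search m u v m ≤-refl

least : ∀ {P : ℕ → Set} → (∀ m → Dec (P m)) → ∀ m → P m →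
        ∃ λ k → P k × (∀ j → P j → k ≤ j)
least P? zero    p = zero , p , λ _ _ → z≤n
least P? (suc m) p with P? zero
... | yes p₀ = zero , p₀ , λ _ _ → z≤n
... | no ¬p₀ with least (P? ∘ suc) m p
...   | k , q , min = suc k , q , λ where
          zero    r → contradiction r ¬p₀
          (suc j) r → s≤s (min j r)

module _ (G : WeightedGraph) where
  open WeightedGraph G

  private
    shortest : ∀ u v → ∃ λ k → Walk weight u v k × (∀ m → Walk weight u v m → k ≤ m)
    shortest u v = least (walk? finite u v) (proj₁ (connected u v)) (proj₂ (connected u v))

  -- The least length of a walk. As edge weights are positive, it is attained
  -- by a path, so this is the shortest-path metric.
  dist : Vertex → Vertex → ℕ
  dist u v = proj₁ (shortest u v)

  dist-walk : ∀ u v → Walk weight u v (dist u v)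
  dist-walk u v = proj₁ (proj₂ (shortest u v))

  dist-minimal : ∀ {u v m} → Walk weight u v m → dist u v ≤ m
  dist-minimal {u} {v} = proj₂ (proj₂ (shortest u v)) _

  dist-refl : ∀ v → dist v v ≡ 0
  dist-refl v = n≤0⇒n≡0 (dist-minimal nil)

  dist-0⇒≡ : ∀ {u v} → dist u v ≡ 0 → u ≡ v
  dist-0⇒≡ = walk-0⇒≡ (dist-walk _ _)

  dist-sym : ∀ u v → dist u v ≡ dist v u
  dist-sym u v = ≤-antisym
    (dist-minimal (reverseʷ symmetric (dist-walk v u)))
    (dist-minimal (reverseʷ symmetric (dist-walk u v)))

  dist-triangle : ∀ u v t → dist u t ≤ dist u v + dist v t
  dist-triangle u v t = dist-minimal (dist-walk u v ++ʷ dist-walk v t)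

  Between : Vertex → Vertex → Vertex → Set
  Between x y z = dist x z ≡ dist x y + dist y z

  private
    between-sym : ∀ x y z → Between x y z → Between z y x
    between-sym x y z p = begin
      dist z x             ≡⟨ dist-sym z x ⟩
      dist x z             ≡⟨ p ⟩
      dist x y + dist y z  ≡⟨ +-comm (dist x y) (dist y z) ⟩
      dist y z + dist x y  ≡⟨ cong₂ _+_ (dist-sym y z) (dist-sym x y) ⟩
      dist z y + dist y x  ∎
      where open ≡-Reasoning

    between-antisym : ∀ x y z → Between x y z → Between y x z → x ≡ y
    between-antisym x y z p q = dist-0⇒≡ (m+n≡0⇒m≡0 (dist x y)
      (+-cancelʳ-≡ (dist y z) (dist x y + dist y x) 0 (begin
        dist x y + dist y x + dist y z    ≡⟨ cong (_+ dist y z) (+-comm (dist x y) (dist y x)) ⟩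
        dist y x + dist x y + dist y z    ≡⟨ +-assoc (dist y x) (dist x y) (dist y z) ⟩
        dist y x + (dist x y + dist y z)  ≡⟨ cong (dist y x +_) (sym p) ⟩
        dist y x + dist x z               ≡⟨ sym q ⟩
        dist y z                          ∎)))
      where open ≡-Reasoning

    between-trans : ∀ x y z w → Between x y z → Between x w y →
                    Between x w z × Between w y z
    between-trans x y z w p q = xwz , wyz
      where
      open ≤-Reasoning
      split : dist x z ≡ dist x w + (dist w y + dist y z)
      split = trans p (trans (cong (_+ dist y z) q) (+-assoc (dist x w) _ _))
      wyz : Between w y z
      wyz = ≤-antisym (dist-triangle w y z)
        (+-cancelˡ-≤ (dist x w) _ _ (begin
          dist x w + (dist w y + dist y z)  ≡⟨ split ⟨
          dist x z                          ≤⟨ dist-triangle x w z ⟩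
          dist x w + dist w z               ∎))
      xwz : Between x w z
      xwz = trans split (cong (dist x w +_) (sym wyz))

  induced : BetweennessStructure
  induced = record
    { Carrier  = Vertex
    ; finite   = finite
    ; nonEmpty = nonEmpty
    ; β        = Between
    ; β?       = λ x y z → dist x z ≟ dist x y + dist y z
    ; P1       = λ x z → cong (_+ dist x z) (sym (dist-refl x))
    ; P2       = between-sym
    ; P3       = between-antisym
    ; P4       = between-trans
    }

-- Each edge is described once, in one direction of choice.
symmetrize : {V : Set} → (V → V → ℕ) → V → V → ℕ
symmetrize arc u v = arc u v ⊔ arc v u

𝟙 : {P : Set} → Dec P → ℕ
𝟙 (yes _) = 1
𝟙 (no  _) = 0

𝟙≢0 : {P : Set} (P? : Dec P) → P → 𝟙 P? ≢ 0
𝟙≢0 (yes _) _ ()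
𝟙≢0 (no ¬p) p _ = ¬p p

𝟙≡0 : {P : Set} (P? : Dec P) → ¬ P → 𝟙 P? ≡ 0
𝟙≡0 (yes p) ¬p = contradiction p ¬p
𝟙≡0 (no _)  _  = refl

module _ {V : Set} (fin : Finite V) (arc : V → V → ℕ) where
  open Finite fin

  private
    Loopless : Set
    Loopless = ∀ i → arc (element i) (element i) ≡ 0

    loopless? : Dec Loopless
    loopless? = Fin.all? λ i → arc (element i) (element i) ≟ 0

    ShortWalks : Set
    ShortWalks = ∀ i j → ∃ λ (m : Fin 7) →
      Walk (symmetrize arc) (element i) (element j) (toℕ m)

    shortWalks? : Dec ShortWalks
    shortWalks? = Fin.all? λ i → Fin.all? λ j → Fin.any? λ m →
      walk? fin (element i) (element j) (toℕ m)

  -- For concrete graphs of small diameter the side conditions hold by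
  -- computation.
  smallGraph : {{_ : NonZero size}} {_ : True loopless?} {_ : True shortWalks?} →
               WeightedGraph
  smallGraph ⦃ nz ⦄ {l} {c} = record
    { Vertex    = V
    ; finite    = fin
    ; nonEmpty  = nz
    ; weight    = symmetrize arc
    ; symmetric = λ u v → ⊔-comm (arc u v) (arc v u)
    ; loopless  = λ v → trans (⊔-idem (arc v v))
        (subst (λ u → arc u u ≡ 0) (element-index v) (toWitness l (index v)))
    ; connected = λ u v →
        let m , p = toWitness c (index u) (index v)
        in toℕ m , subst₂ (λ a b → Walk (symmetrize arc) a b (toℕ m)) (element-index u) (element-index v) p
    }

finFinite : ∀ n → Finite (Fin n)
finFinite n = record { size = n ; enum = ↔-id (Fin n) }

⊎-finite : ∀ a b → Finite (Fin a ⊎ Fin b)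
⊎-finite a b = record { size = a + b ; enum = ↔-sym Fin.+↔⊎ }

completeArcs : ∀ n → Fin n → Fin n → ℕ
completeArcs n i j = 𝟙 (i Fin.<? j)

bipartiteArcs : ∀ a b → List (Fin a × Fin b) → Fin a ⊎ Fin b → Fin a ⊎ Fin b → ℕ
bipartiteArcs a b deleted (inj₁ i) (inj₂ j) = 𝟙 (¬? ((i , j) ∈? deleted))
  where open DecMembership (≡-dec (Fin._≟_ {a}) (Fin._≟_ {b})) using (_∈?_)
bipartiteArcs a b deleted _ _ = 0

cycleArcs : ∀ {n} .{{_ : NonZero n}} → Vec ℕ n → Fin n → Fin n → ℕ
cycleArcs {n} ws i j with toℕ j ≟ suc (toℕ i) % n
... | yes _ = lookup ws i
... | no  _ = 0

K₃ K₁₃ C₄-1122 K₂₃ K₃₃ K₃₃-e K₃₃-2e C₆ : WeightedGraph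
K₃      = smallGraph (finFinite 3) (completeArcs 3)
K₁₃     = smallGraph (⊎-finite 1 3) (bipartiteArcs 1 3 [])
C₄-1122 = smallGraph (finFinite 4) (cycleArcs (1 ∷ 1 ∷ 2 ∷ 2 ∷ []))
K₂₃     = smallGraph (⊎-finite 2 3) (bipartiteArcs 2 3 [])
K₃₃     = smallGraph (⊎-finite 3 3) (bipartiteArcs 3 3 [])
K₃₃-e   = smallGraph (⊎-finite 3 3) (bipartiteArcs 3 3 ((zero , zero) ∷ []))
K₃₃-2e  = smallGraph (⊎-finite 3 3)
  (bipartiteArcs 3 3 ((zero , zero) ∷ (suc zero , suc zero) ∷ []))
C₆      = smallGraph (finFinite 6) (cycleArcs (1 ∷ 1 ∷ 1 ∷ 1 ∷ 1 ∷ 1 ∷ []))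

data Point (m : ℕ) : Set where
  x   : Fin m → Point m
  y z : Point m

pointFinite : ∀ m → Finite (Point m)
pointFinite m = record { size = 2 + m ; enum = mk↔ₛ′ f g fg gf }
  where
  f : Point m → Fin (2 + m)
  f y     = zero
  f z     = suc zero
  f (x a) = suc (suc a)
  g : Fin (2 + m) → Point m
  g zero          = y
  g (suc zero)    = z
  g (suc (suc a)) = x a
  fg : ∀ i → f (g i) ≡ i
  fg zero          = refl
  fg (suc zero)    = refl
  fg (suc (suc a)) = refl
  gf : ∀ p → g (f p) ≡ p
  gf y     = refl
  gf z     = refl
  gf (x a) = refl

-- Path vertices are x₁, …, xₘ with m = n ∸ 2: x a is the vertex with
-- subscript sub a.
sub : ∀ {m} → Fin m → ℕ
sub a = suc (toℕ a)

_∈I⁴_ : ℕ → ℕ → Set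
i ∈I⁴ n = 1 ≤ i × i ≤ ⌈ n ∸ 3 /2⌉

R⁴-arcs : ∀ n → ℕ → Point (n ∸ 2) → Point (n ∸ 2) → ℕ
R⁴-arcs n i (x a) (x b) = 𝟙 (sub b ≟ suc (sub a) ×-dec ¬? (sub a ≟ i))
R⁴-arcs n i y     (x a) = 𝟙 (sub a ≟ i ⊎-dec sub a ≟ suc i)
R⁴-arcs n i z     (x a) = 𝟙 (sub a ≟ i ⊎-dec sub a ≟ suc i)
R⁴-arcs n i _     _     = 0

S⁴-arcs : ∀ n → Point (n ∸ 2) → Point (n ∸ 2) → ℕ
S⁴-arcs n (x a) (x b) = 𝟙 (sub b ≟ suc (sub a))
S⁴-arcs n y     (x a) = 𝟙 (sub a ≟ 1)
S⁴-arcs n z     (x a) = 𝟙 (sub a ≟ n ∸ 2)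
S⁴-arcs n y     z     = n ∸ 3
S⁴-arcs n _     _     = 0

module _ {V : Set} (arc : V → V → ℕ) where

  private
    _~_ : V → V → Set
    _~_ = Joined (symmetrize arc)

  symmetrize-sym : ∀ u v → symmetrize arc u v ≡ symmetrize arc v u
  symmetrize-sym u v = ⊔-comm (arc u v) (arc v u)

  ~-sym : ∀ {u v} → u ~ v → v ~ u
  ~-sym (_ , p) = _ , reverseʷ symmetrize-sym p

  ~-trans : ∀ {u v t} → u ~ v → v ~ t → u ~ t
  ~-trans (_ , p) (_ , q) = _ , p ++ʷ q

  arc⇒~ : ∀ {u v} → arc u v ≢ 0 → u ~ v
  arc⇒~ {u} {v} e = _ , edgeʷ λ eq →
    e (n≤0⇒n≡0 (subst (arc u v ≤_) eq (m≤m⊔n (arc u v) (arc v u))))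

  path-joined : ∀ {m} (f : Fin (suc m) → V) →
                (∀ a → f (inject₁ a) ~ f (suc a)) → ∀ a → f zero ~ f a
  path-joined f s = <-weakInduction (λ a → f zero ~ f a) (0 , nil)
    (λ a p → ~-trans p (s a))

  root⇒connected : ∀ r → (∀ v → r ~ v) → Connected (symmetrize arc)
  root⇒connected r j u v = ~-trans (~-sym (j u)) (j v)

private
  R⁴-loopless : ∀ n i p → R⁴-arcs n i p p ≡ 0
  R⁴-loopless n i (x a) = 𝟙≡0 _ λ (e , _) → 1+n≢n (sym e)
  R⁴-loopless n i y     = refl
  R⁴-loopless n i z     = refl

  S⁴-loopless : ∀ n p → S⁴-arcs n p p ≡ 0
  S⁴-loopless n (x a) = 𝟙≡0 _ λ e → 1+n≢n (sym e)
  S⁴-loopless n y     = refl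
  S⁴-loopless n z     = refl

  R⁴-connected : ∀ n i → 5 ≤ n → i ∈I⁴ n → Connected (symmetrize (R⁴-arcs n i))
  R⁴-connected n@(suc (suc (suc (suc (suc k))))) (suc i)
    (s≤s (s≤s (s≤s (s≤s (s≤s _))))) (s≤s _ , i≤) =
    root⇒connected arc (x zero) joined
    where
    arc = R⁴-arcs n (suc i)
    xᵢ : Fin (3 + k)
    xᵢ = fromℕ< {i} (≤-trans i≤ (≤-trans (⌈n/2⌉≤n (2 + k)) (n≤1+n _)))
    sub-xᵢ : sub xᵢ ≡ suc i
    sub-xᵢ = cong suc (Fin.toℕ-fromℕ< _)
    path : ∀ a → Joined (symmetrize arc) (x (inject₁ a)) (x (suc a))
    path a with sub a ≟ suc i
    ... | yes e = ~-trans arc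
      (~-sym arc (arc⇒~ arc {y} (𝟙≢0 _ (inj₁ (trans (cong suc (Fin.toℕ-inject₁ a)) e)))))
      (arc⇒~ arc {y} (𝟙≢0 _ (inj₂ (cong suc e))))
    ... | no ¬e = arc⇒~ arc (𝟙≢0 _
      ( cong (2 +_) (sym (Fin.toℕ-inject₁ a))
      , λ e → ¬e (trans (cong suc (sym (Fin.toℕ-inject₁ a))) e)))
    onPath : ∀ a → Joined (symmetrize arc) (x zero) (x a)
    onPath = path-joined arc x path
    joined : ∀ p → Joined (symmetrize arc) (x zero) p
    joined (x a) = onPath a
    joined y = ~-trans arc (onPath xᵢ) (~-sym arc (arc⇒~ arc {y} (𝟙≢0 _ (inj₁ sub-xᵢ))))
    joined z = ~-trans arc (onPath xᵢ) (~-sym arc (arc⇒~ arc {z} (𝟙≢0 _ (inj₁ sub-xᵢ))))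

  S⁴-connected : ∀ n → 5 ≤ n → Connected (symmetrize (S⁴-arcs n))
  S⁴-connected n@(suc (suc (suc (suc (suc k)))))
    (s≤s (s≤s (s≤s (s≤s (s≤s _))))) =
    root⇒connected arc (x zero) joined
    where
    arc = S⁴-arcs n
    x₁~y : Joined (symmetrize arc) (x zero) y
    x₁~y = ~-sym arc (arc⇒~ arc {y} {x zero} (𝟙≢0 (sub {3 + k} zero ≟ 1) refl))
    joined : ∀ p → Joined (symmetrize arc) (x zero) p
    joined (x a) = path-joined arc x
      (λ b → arc⇒~ arc (𝟙≢0 _ (cong (2 +_) (sym (Fin.toℕ-inject₁ b))))) a
    joined y = x₁~y
    joined z = ~-trans arc x₁~y (arc⇒~ arc {y} {z} λ ())

R⁴ : ∀ n i → 5 ≤ n → i ∈I⁴ n → WeightedGraph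
R⁴ n i 5≤n i∈I = record
  { Vertex    = Point (n ∸ 2)
  ; finite    = pointFinite (n ∸ 2)
  ; nonEmpty  = _
  ; weight    = symmetrize (R⁴-arcs n i)
  ; symmetric = symmetrize-sym (R⁴-arcs n i)
  ; loopless  = λ p → trans (⊔-idem _) (R⁴-loopless n i p)
  ; connected = R⁴-connected n i 5≤n i∈I
  }

S⁴ : ∀ n → 5 ≤ n → WeightedGraph
S⁴ n 5≤n = record
  { Vertex    = Point (n ∸ 2)
  ; finite    = pointFinite (n ∸ 2)
  ; nonEmpty  = _
  ; weight    = symmetrize (S⁴-arcs n)
  ; symmetric = symmetrize-sym (S⁴-arcs n)
  ; loopless  = λ p → trans (⊔-idem _) (S⁴-loopless n p)
  ; connected = S⁴-connected n 5≤n
  }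

data Listed : WeightedGraph → Set₁ where
  isR⁴      : ∀ n i (5≤n : 5 ≤ n) (i∈I : i ∈I⁴ n) → Listed (R⁴ n i 5≤n i∈I)
  isS⁴      : ∀ n (5≤n : 5 ≤ n) → Listed (S⁴ n 5≤n)
  isK₃      : Listed K₃
  isK₁₃     : Listed K₁₃
  isC₄-1122 : Listed C₄-1122
  isK₂₃     : Listed K₂₃
  isK₃₃     : Listed K₃₃
  isK₃₃-e   : Listed K₃₃-e
  isK₃₃-2e  : Listed K₃₃-2e
  isC₆      : Listed C₆

{-# OPTIONS --safe #-}
module Submission where

open import Defs
open import Data.Nat.Base using (ℕ; _≤_; _∸_; _⊔_)
open import Data.Product.Base using (_×_; ∃-syntax)
open import Function.Bundles using (_⇔_)
open import Algebra.Properties.CommutativeSemigroup using (x∙yz≈y∙xz; x∙yz≈yx∙z; interchange)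
open import Data.Bool.Base using (Bool; true; T; _∧_; _∨_; not; if_then_else_)
open import Data.Bool.ListAction using (all)
open import Data.Bool.Properties using (T-∧)
open import Data.Empty using (⊥-elim)
open import Data.Fin.Base using (Fin; zero; suc; toℕ)
import Data.Fin.Base as Fin
open import Data.Fin.Patterns using (0F; 1F; 2F; 3F)
open import Data.Fin.Permutation using (↔⇒≡)
import Data.Fin.Properties as Fin
open import Data.List.Base using (List; []; _∷_; length; concatMap; filter; cartesianProduct)
import Data.List.Base as List
import Data.List.Membership.DecPropositional as DecMembership
open import Data.List.Membership.Propositional using (_∈_; _∉_; lose)
open import Data.List.Membership.Propositional.Properties
  using (∈-∃++; ∈-allFin; ∈-concatMap⁺; ∈-map⁺; ∈-tabulate⁺; ∈-tabulate⁻)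
open import Data.List.Membership.Propositional.Properties.WithK using (unique∧set⇒bag)
open import Data.List.Properties using (filter-++; length-++; length-tabulate)
open import Data.List.Relation.Binary.BagAndSetEquality using (∼bag⇒↭)
open import Data.List.Relation.Binary.Permutation.Propositional
  using (_↭_; refl; prep; swap; trans; ↭-refl; ↭-reflexive; ↭-sym; ↭-trans; ↭-prep; ↭-swap; ↭⇒↭ₛ)
open import Data.List.Relation.Binary.Permutation.Propositional.Properties
  using (shift; ∈-resp-↭; ↭-length)
import Data.List.Relation.Binary.Permutation.Setoid.Properties as ↭ₛ
open import Data.List.Relation.Unary.All using (All; []; _∷_)
import Data.List.Relation.Unary.All as All
open import Data.List.Relation.Unary.All.Properties using (all⁺; all⁻)
open import Data.List.Relation.Unary.AllPairs using ([]; _∷_)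
import Data.List.Relation.Unary.AllPairs as AllPairs
open import Data.List.Relation.Unary.Any using (here; there)
import Data.List.Relation.Unary.Any as Any
open import Data.List.Relation.Unary.Unique.Propositional using (Unique)
import Data.List.Relation.Unary.Unique.Propositional.Properties as Unique
open import Data.Nat.Base hiding (_≤_; _∸_; _⊔_; ℕ)
open import Data.Nat.Properties
open import Data.Product.Base using (_,_; proj₁; proj₂; ∃)
open import Data.Sum.Base using (_⊎_; inj₁; inj₂)
import Data.Sum.Base as Sum
open import Data.Unit.Base using (⊤; tt)
open import Data.Vec.Base using (Vec; []; _∷_; lookup; map; insertAt; allFin; tabulate; toList)
open import Data.Vec.Membership.Propositional.Properties using (∈-lookup; ∈-toList⁺)
open import Data.Vec.Properties using (≡-dec; lookup-map; lookup∘tabulate; map-insertAt; map-lookup-allFin)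
open import Function.Base using (_∘_; id)
open import Function.Bundles using (_↔_; mk⇔; mk↔ₛ′; module Equivalence; module Inverse)
open import Function.Construct.Composition using (_↔-∘_)
open import Function.Construct.Symmetry using (↔-sym)
open import Relation.Binary.Definitions using (DecidableEquality; tri<; tri≈; tri>)
open import Relation.Binary.PropositionalEquality
  using (_≡_; _≢_; refl; sym; cong; cong₂; subst; subst₂; setoid; ≢-sym; module ≡-Reasoning)
  renaming (trans to ≡-trans)
open import Relation.Nullary.Decidable
  using (Dec; yes; no; does; dec-true; dec-false; decidable-stable; map′; ⌊_⌋; False;
         toWitness; toWitnessFalse; fromWitness; ¬?; _×-dec_; _⊎-dec_; _→-dec_)
open import Relation.Nullary.Negation using (¬_; contradiction)

-- Up to six points, the structures with the fewest triangles are found by extending the smaller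
-- ones by a point in all possible ways. This works because, unless there is a single triangle,
-- some point lies in some but not all triangles, and removing it leaves a smaller structure with
-- triangles. On seven points, the same search shows that all triangles share two points q and r;
-- for more points this persists, as the pair is already determined by two of the triangles. A
-- structure without triangles on at least five points is an ordering, so removing q or r leaves
-- an ordering: both are inserted into an ordering of the other points. If they are inserted at
-- the same place, P4 forces the structure to be that of R⁴, otherwise to be that of S⁴. On the
-- graph side, the points of both families lie on a line, apart from the distance of y and z.

-- The codes of betweenness structures

-- The minimum co-size stays 1 up to five points and then grows by 1 with each point. Deleting a
-- point that lies in some but not all triangles loses at least one of them, so the rest is again
-- minimal, and the deleted point lies in at most one triangle. Such budgets keep the search small.
-- Seven points are the right base of the induction. On six points, `K₃₃`, its two deletions and
-- `C₆` have two disjoint triangles, hence no common pair, and none of them extends within the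
-- budget. Seven is also the first order with three triangles, as the step requires: of three
-- triangles through q and r, one has its third corner outside the new triangle, and once that
-- corner is deleted two others are left to fix the pair. Orderings need five points because the
-- unweighted 4-cycle has no triangle either. The lower bound comes out of the classification
-- itself: a structure with at most the expected number of triangles is shown to have exactly that
-- number. The same bound yields the co-size of `R⁴` and `S⁴` from a mere upper estimate.

-- mᵢ: the i-th of three points lies between the other two; none: they form a triangle.
pattern m₁ = zero
pattern m₂ = suc zero
pattern m₃ = suc (suc zero)
pattern none = suc (suc (suc zero))

Mid : Set
Mid = Fin 4

swap₁₂ : Mid → Mid
swap₁₂ m₁ = m₂
swap₁₂ m₂ = m₁
swap₁₂ m₃ = m₃
swap₁₂ none = none

swap₂₃ : Mid → Mid
swap₂₃ m₁ = m₁
swap₂₃ m₂ = m₃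
swap₂₃ m₃ = m₂
swap₂₃ none = none

-- The row of a point p lists, for each pair q, r of the later points, the middle of p, q, r;
-- the code of a list of points consists of the rows of its points.
data Row : ℕ → Set where
  []  : Row 0
  _∷_ : ∀ {n} → Vec Mid n → Row n → Row (suc n)

data Code : ℕ → Set where
  []  : Code 0
  _∷_ : ∀ {n} → Row n → Code n → Code (suc n)

rowAt : ∀ {n} → Row n → Fin n → Fin n → Mid
rowAt (v ∷ r) zero    zero    = none
rowAt (v ∷ r) zero    (suc k) = lookup v k
rowAt (v ∷ r) (suc j) zero    = swap₂₃ (lookup v j)
rowAt (v ∷ r) (suc j) (suc k) = rowAt r j k

codeAt : ∀ {n} → Code n → Fin n → Fin n → Fin n → Mid
codeAt (r ∷ c) zero    (suc j) (suc k) = rowAt r j k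
codeAt (r ∷ c) (suc i) zero    (suc k) = swap₁₂ (rowAt r i k)
codeAt (r ∷ c) (suc i) (suc j) zero    = swap₂₃ (swap₁₂ (rowAt r i j))
codeAt (r ∷ c) (suc i) (suc j) (suc k) = codeAt c i j k
-- On repeated indices `none` is only a default and does not signal a triangle; statements about
-- `codeAt` are therefore made for distinct indices.
codeAt (r ∷ c) _       _       _       = none

rowBy : ∀ {A : Set} {n} → (A → A → Mid) → Vec A n → Row n
rowBy f []       = []
rowBy f (a ∷ as) = map (f a) as ∷ rowBy f as

codeBy : ∀ {A : Set} {n} → (A → A → A → Mid) → Vec A n → Code n
codeBy f []       = []
codeBy f (a ∷ as) = rowBy (f a) as ∷ codeBy f as

-- Insertion positions instead of images, so that every shuffle is a permutation.
data Shuffle : ℕ → Set where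
  []  : Shuffle 0
  _∷_ : ∀ {n} → Fin (suc n) → Shuffle n → Shuffle (suc n)

shuffle : ∀ {A : Set} {n} → Shuffle n → Vec A n → Vec A n
shuffle []      []       = []
shuffle (i ∷ l) (a ∷ as) = insertAt (shuffle l as) i a

shuffles : ∀ n → List (Shuffle n)
shuffles zero    = [] ∷ []
shuffles (suc n) = concatMap (λ l → List.map (_∷ l) (List.allFin (suc n))) (shuffles n)

permute : ∀ {n} → Shuffle n → Code n → Code n
permute l c = codeBy (codeAt c) (shuffle l (allFin _))

infix 4 _≟ʳ_ _≟ᶜ_

_≟ʳ_ : ∀ {n} → DecidableEquality (Row n)
[]      ≟ʳ []      = yes refl
(v ∷ r) ≟ʳ (w ∷ s) = map′ (λ (p , q) → cong₂ _∷_ p q) (λ { refl → refl , refl })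
  (≡-dec Fin._≟_ v w ×-dec r ≟ʳ s)

_≟ᶜ_ : ∀ {n} → DecidableEquality (Code n)
[]      ≟ᶜ []      = yes refl
(r ∷ c) ≟ᶜ (s ∷ d) = map′ (λ (p , q) → cong₂ _∷_ p q) (λ { refl → refl , refl })
  (r ≟ʳ s ×-dec c ≟ᶜ d)

Amid : ∀ {n} → Code n → Fin n → Fin n → Fin n → Set
Amid c i j k = codeAt c i j k ≡ m₂

Transitive : Code 4 → Vec (Fin 4) 4 → Set
Transitive c (p ∷ q ∷ r ∷ s ∷ []) =
  Amid c p q r × Amid c p s q → Amid c p s r × Amid c s q r

transitive? : ∀ c v → Dec (Transitive c v)
transitive? c (p ∷ q ∷ r ∷ s ∷ []) =
  (between? p q r ×-dec between? p s q) →-dec (between? p s r ×-dec between? s q r)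
  where
  between? : ∀ i j k → Dec (Amid c i j k)
  between? i j k = codeAt c i j k Fin.≟ m₂

fourCode : Mid → Mid → Mid → Mid → Code 4
fourCode a b c d =
  ((a ∷ b ∷ []) ∷ (c ∷ []) ∷ [] ∷ []) ∷ ((d ∷ []) ∷ [] ∷ []) ∷ ([] ∷ []) ∷ [] ∷ []

-- Condition P4 on four points.
obeys : Code 4 → Shuffle 4 → Bool
obeys c l = ⌊ transitive? c (shuffle l (allFin 4)) ⌋

fits : Mid → Mid → Mid → Mid → Bool
fits a b c d = all (obeys (fourCode a b c d)) (shuffles 4)

Table : Set
Table = Vec (Vec (Vec (Vec Bool 4) 4) 4) 4

tabulate₄ : (Mid → Mid → Mid → Mid → Bool) → Table
tabulate₄ f = tabulate λ a → tabulate λ b → tabulate λ c → tabulate λ d → f a b c d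

entry : Table → Mid → Mid → Mid → Mid → Bool
entry t a b c d = lookup (lookup (lookup (lookup t a) b) c) d

entry-tabulate₄ : ∀ f a b c d → entry (tabulate₄ f) a b c d ≡ f a b c d
entry-tabulate₄ f a b c d
  rewrite lookup∘tabulate (λ a → tabulate λ b → tabulate λ c → tabulate λ d → f a b c d) a
        | lookup∘tabulate (λ b → tabulate λ c → tabulate λ d → f a b c d) b
        | lookup∘tabulate (λ c → tabulate λ d → f a b c d) c
        | lookup∘tabulate (λ d → f a b c d) d = refl

-- Reduction shares the arguments of a function but not the constants it calls, so the
-- search receives the values of fits as a table.
table : Table
table = tabulate₄ fits

-- With `m` the middle of p, q, r, the three vectors list the middles of p q s, of p r s and of q r
-- s for the points s after r.
compatible : ∀ {n} → Table → Mid → Vec Mid n → Vec Mid n → Vec Mid n → Bool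
compatible t m []      []      []      = true
compatible t m (a ∷ u) (b ∷ v) (c ∷ w) = entry t m a b c ∧ compatible t m u v w

cost : Mid → ℕ
cost none = 1
cost _    = 0

spend : Mid → ℕ → (ℕ → Bool) → Bool
-- The search verifies a property of all rows within the budget, so a branch that exceeds it
-- succeeds vacuously.
spend none zero    k = true
spend none (suc b) k = k b
spend _    b       k = k b

-- The row of a new point is filled in from the last pair of old points backwards: each entry
-- completes some 4-sets, on which P4 is checked at once. The number bounds the new triangles.
extendVec : ∀ {n} → Table → Row n → Row n → ℕ → (Vec Mid n → ℕ → Bool) → Bool
extendVec t []      []      b k = k [] b
extendVec t (w ∷ s) (v ∷ r) b k = extendVec t s r b λ u b →
  all (λ m → spend m b λ b → not (compatible t m u v w) ∨ k (m ∷ u) b) (List.allFin 4)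

extendRow : ∀ {n} → Table → Code n → ℕ → (Row n → ℕ → Bool) → Bool
extendRow t []      b k = k [] b
extendRow t (s ∷ c) b k = extendRow t c b λ r b → extendVec t s r b λ v → k (v ∷ r)

extensions : ∀ {n} → Table → List (Code n) → ℕ → (Code (suc n) → Bool) → Bool
extensions t cs b ok = all (λ c → extendRow t c b λ r _ → ok (r ∷ c)) cs

nonesᵛ : ∀ {n} → Vec Mid n → ℕ
nonesᵛ []      = 0
nonesᵛ (m ∷ v) = cost m + nonesᵛ v

nonesʳ : ∀ {n} → Row n → ℕ
nonesʳ []      = 0
nonesʳ (v ∷ r) = nonesᵛ v + nonesʳ r

nones : ∀ {n} → Code n → ℕ
nones []      = 0
nones (r ∷ c) = nonesʳ r + nones c

FitsVec : ∀ {n} → Vec Mid n → Row n → Row n → Set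
FitsVec []      []      []      = ⊤
FitsVec (m ∷ u) (v ∷ r) (w ∷ s) = T (compatible table m u v w) × FitsVec u r s

FitsRow : ∀ {n} → Row n → Code n → Set
FitsRow []      []      = ⊤
FitsRow (v ∷ r) (s ∷ c) = FitsVec v r s × FitsRow r c

spend-sound : ∀ m {b k} → T (spend m b k) → ∀ b′ → cost m + b′ ≡ b → T (k b′)
spend-sound none t b′ refl = t
spend-sound m₁   t b′ refl = t
spend-sound m₂   t b′ refl = t
spend-sound m₃   t b′ refl = t

implied : ∀ {a c} → T (not a ∨ c) → T a → T c
implied {true} t _ = t

-- The continuation receives the budget left over, `b′`. The tail is filled in before the entry `m`,
-- so it is treated with `cost m + b′` left, from which `spend` then takes the cost of `m`.
extendVec-sound : ∀ {n} (s r : Row n) {b k} → T (extendVec table s r b k) →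
                  ∀ u b′ → FitsVec u r s → nonesᵛ u + b′ ≡ b → T (k u b′)
extendVec-sound []      []      t []      b′ _         refl = t
extendVec-sound (w ∷ s) (v ∷ r) {b} {k} t (m ∷ u) b′ (ok , fit) eq =
  implied (spend-sound m
    (All.lookup {xs = List.allFin 4} (all⁺ try (List.allFin 4) tried) (∈-allFin m)) b′ refl) ok
  where
  try : Mid → Bool
  try m′ = spend m′ (cost m + b′) λ b → not (compatible table m′ u v w) ∨ k (m′ ∷ u) b
  tried : T (all try (List.allFin 4))
  tried = extendVec-sound s r t u (cost m + b′) fit
    (≡-trans (x∙yz≈yx∙z +-commutativeSemigroup (nonesᵛ u) (cost m) b′) eq)

extendRow-sound : ∀ {n} (c : Code n) {b k} → T (extendRow table c b k) →
                  ∀ r b′ → FitsRow r c → nonesʳ r + b′ ≡ b → T (k r b′)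
extendRow-sound []      t []      b′ _ refl = t
extendRow-sound (s ∷ c) t (v ∷ r) b′ (fit , fits) eq =
  extendVec-sound s r
    (extendRow-sound c t r (nonesᵛ v + b′) fits
      (≡-trans (x∙yz≈yx∙z +-commutativeSemigroup (nonesʳ r) (nonesᵛ v) b′) eq))
    v b′ fit refl

record Extends {n} (cs : List (Code n)) (b : ℕ) (P : Code (suc n) → Set) : Set where
  constructor extending
  field
    extend : ∀ {c} → c ∈ cs → ∀ r → FitsRow r c → nonesʳ r ≤ b → P (r ∷ c)

-- The last argument is a Boolean evaluated by the type checker: where the search succeeds, its type
-- reduces to the unit type and `tt` is the whole proof.
extends : ∀ {n} (cs : List (Code n)) b {P : Code (suc n) → Set} (P? : ∀ c → Dec (P c)) →
          T (extensions table cs b (λ c → ⌊ P? c ⌋)) → Extends cs b P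
extends cs b P? t = extending λ c∈cs r fit r≤b → toWitness
  (extendRow-sound _ (All.lookup (all⁺ _ cs t) c∈cs) r _ fit (m+[n∸m]≡n r≤b))

insertAt-↭ : ∀ {A : Set} {n} (v : Vec A n) i a → toList (insertAt v i a) ↭ a ∷ toList v
insertAt-↭ v       zero    a = ↭-refl
insertAt-↭ (b ∷ v) (suc i) a = ↭-trans (↭-prep b (insertAt-↭ v i a)) (↭-swap b a ↭-refl)

∈-shuffles : ∀ {n} (l : Shuffle n) → l ∈ shuffles n
∈-shuffles []      = here refl
∈-shuffles (i ∷ l) = ∈-concatMap⁺ _ (lose (∈-shuffles l) (∈-map⁺ (_∷ l) (∈-allFin i)))

shuffle-↭ : ∀ {A : Set} {n} (l : Shuffle n) (v : Vec A n) → toList (shuffle l v) ↭ toList v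
shuffle-↭ []      []       = ↭-refl
shuffle-↭ (i ∷ l) (a ∷ as) = ↭-trans (insertAt-↭ (shuffle l as) i a) (↭-prep a (shuffle-↭ l as))

map-shuffle : ∀ {A B : Set} {n} (f : A → B) (l : Shuffle n) v →
              map f (shuffle l v) ≡ shuffle l (map f v)
map-shuffle f []      []       = refl
map-shuffle f (i ∷ l) (a ∷ as) =
  ≡-trans (map-insertAt f a (shuffle l as) i) (cong (λ w → insertAt w i (f a)) (map-shuffle f l as))

lookup-shuffle : ∀ {A : Set} {n} (l : Shuffle n) (v : Vec A n) i →
                 lookup (shuffle l v) i ≡ lookup v (lookup (shuffle l (allFin n)) i)
lookup-shuffle {n = n} l v i = begin
  lookup (shuffle l v) i                                ≡⟨ cong (λ w → lookup (shuffle l w) i) (map-lookup-allFin v) ⟨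
  lookup (shuffle l (map (lookup v) (allFin n))) i      ≡⟨ cong (λ w → lookup w i) (map-shuffle (lookup v) l (allFin n)) ⟨
  lookup (map (lookup v) (shuffle l (allFin n))) i      ≡⟨ lookup-map i (lookup v) (shuffle l (allFin n)) ⟩
  lookup v (lookup (shuffle l (allFin n)) i)            ∎
  where open ≡-Reasoning

Injective : ∀ {A : Set} {n} → Vec A n → Set
Injective v = ∀ i j → lookup v i ≡ lookup v j → i ≡ j

lookup∈toList : ∀ {A : Set} {n} (v : Vec A n) i → lookup v i ∈ toList v
lookup∈toList v i = ∈-toList⁺ (∈-lookup i v)

unique⇒injective : ∀ {A : Set} {n} (v : Vec A n) → Unique (toList v) → Injective v
unique⇒injective (a ∷ v) (a∉ ∷ u) zero    zero    _  = refl
unique⇒injective (a ∷ v) (a∉ ∷ u) zero    (suc j) eq = ⊥-elim (All.lookup a∉ (lookup∈toList v j) eq)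
unique⇒injective (a ∷ v) (a∉ ∷ u) (suc i) zero    eq = ⊥-elim (All.lookup a∉ (lookup∈toList v i) (sym eq))
unique⇒injective (a ∷ v) (a∉ ∷ u) (suc i) (suc j) eq = cong suc (unique⇒injective v u i j eq)

toList-tabulate : ∀ {A : Set} {n} (f : Fin n → A) → toList (tabulate f) ≡ List.tabulate f
toList-tabulate {n = zero}  f = refl
toList-tabulate {n = suc n} f = cong (f zero ∷_) (toList-tabulate (f ∘ suc))

unique-toList-allFin : ∀ n → Unique (toList (allFin n))
unique-toList-allFin n = subst Unique (sym (toList-tabulate id)) (Unique.allFin⁺ n)

unique-resp-↭ : ∀ {A : Set} {as bs : List A} → as ↭ bs → Unique as → Unique bs
unique-resp-↭ p = ↭ₛ.Unique-resp-↭ (setoid _) (↭⇒↭ₛ p)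

shuffle-injective : ∀ {n} (l : Shuffle n) → Injective (shuffle l (allFin n))
shuffle-injective {n} l = unique⇒injective _
  (unique-resp-↭ (↭-sym (shuffle-↭ l (allFin n))) (unique-toList-allFin n))

rowBy-cong : ∀ {A B : Set} {n} {f : A → A → Mid} {g : B → B → Mid} (v : Vec A n) (w : Vec B n) →
             (∀ i j → i Fin.< j → f (lookup v i) (lookup v j) ≡ g (lookup w i) (lookup w j)) →
             rowBy f v ≡ rowBy g w
rowBy-cong []      []      eq = refl
rowBy-cong {f = f} {g} (a ∷ v) (b ∷ w) eq = cong₂ _∷_
  (map-cong₂ v w λ i → eq zero (suc i) z<s)
  (rowBy-cong v w λ i j i<j → eq (suc i) (suc j) (s<s i<j))
  where
  map-cong₂ : ∀ {n} (v : Vec _ n) (w : Vec _ n) →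
              (∀ i → f a (lookup v i) ≡ g b (lookup w i)) → map (f a) v ≡ map (g b) w
  map-cong₂ []      []      eq = refl
  map-cong₂ (_ ∷ v) (_ ∷ w) eq = cong₂ _∷_ (eq zero) (map-cong₂ v w (eq ∘ suc))

codeBy-cong : ∀ {A B : Set} {n} {f : A → A → A → Mid} {g : B → B → B → Mid}
              (v : Vec A n) (w : Vec B n) →
              (∀ i j k → i Fin.< j → j Fin.< k →
                f (lookup v i) (lookup v j) (lookup v k) ≡ g (lookup w i) (lookup w j) (lookup w k)) →
              codeBy f v ≡ codeBy g w
codeBy-cong []      []      eq = refl
codeBy-cong (a ∷ v) (b ∷ w) eq = cong₂ _∷_
  (rowBy-cong v w λ i j i<j → eq zero (suc i) (suc j) z<s (s<s i<j))
  (codeBy-cong v w λ i j k i<j j<k → eq (suc i) (suc j) (suc k) (s<s i<j) (s<s j<k))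

-- Equality up to relabelling, decidable by running through all shuffles.
record OneOf {n} (cs : List (Code n)) (c : Code n) : Set where
  constructor oneOf
  field
    shuffling : Shuffle n
    permuted  : permute shuffling c ∈ cs

oneOf? : ∀ {n} (cs : List (Code n)) c → Dec (OneOf cs c)
oneOf? cs c = map′ (λ any → let l , c∈ = Any.satisfied any in oneOf l c∈)
  (λ (oneOf l c∈) → lose (∈-shuffles l) c∈)
  (Any.any? (λ l → permute l c ∈? cs) (shuffles _))
  where open DecMembership _≟ᶜ_ using (_∈?_)

MeetsTriangles : ∀ {n} → Code n → Fin n → Set
MeetsTriangles c p = ∀ i j k → i ≢ j → i ≢ k → j ≢ k → codeAt c i j k ≡ none →
                     p ≡ i ⊎ p ≡ j ⊎ p ≡ k

meetsTriangles? : ∀ {n} (c : Code n) p → Dec (MeetsTriangles c p)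
meetsTriangles? c p = Fin.all? λ i → Fin.all? λ j → Fin.all? λ k →
  ¬? (i Fin.≟ j) →-dec ¬? (i Fin.≟ k) →-dec ¬? (j Fin.≟ k) →-dec
  (codeAt c i j k Fin.≟ none) →-dec (p Fin.≟ i ⊎-dec p Fin.≟ j ⊎-dec p Fin.≟ k)

record Paired {n} (b : ℕ) (c : Code n) : Set where
  constructor paired
  field
    nones≡ : nones c ≡ b
    pair   : ∃ λ p → MeetsTriangles c p × ∃ λ q → p ≢ q × MeetsTriangles c q

paired? : ∀ {n} b (c : Code n) → Dec (Paired b c)
paired? b c = map′ (λ (eq , p) → paired eq p) (λ (paired eq p) → eq , p)
  (nones c ≟ b ×-dec Fin.any? λ p → meetsTriangles? c p ×-dec
    Fin.any? λ q → ¬? (p Fin.≟ q) ×-dec meetsTriangles? c q)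

-- Betweenness structures and their codes

module Betweenness (B : BetweennessStructure) where
  open BetweennessStructure B hiding (order; coSize) public

  -- On distinct points P3 lets at most one of the tests succeed, so their order matters for
  -- repeated points only.
  mid : Carrier → Carrier → Carrier → Mid
  mid p q r with β? q p r
  ... | yes _ = m₁
  ... | no _ with β? p q r
  ...   | yes _ = m₂
  ...   | no _ with β? p r q
  ...     | yes _ = m₃
  ...     | no _ = none

  data IsMid (p q r : Carrier) : Mid → Set where
    is₁ : β q p r → IsMid p q r m₁
    is₂ : β p q r → IsMid p q r m₂
    is₃ : β p r q → IsMid p q r m₃
    isₙ : ¬ Collinear p q r → IsMid p q r none

  col₁ : ∀ {p q r} → β q p r → Collinear p q r
  col₁ = inj₂ ∘ inj₂ ∘ inj₁
  col₂ : ∀ {p q r} → β p q r → Collinear p q r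
  col₂ = inj₁
  col₃ : ∀ {p q r} → β p r q → Collinear p q r
  col₃ = inj₂ ∘ inj₁

  data Middle (p q r : Carrier) : Set where
    mid₁ : β q p r → Middle p q r
    mid₂ : β p q r → Middle p q r
    mid₃ : β p r q → Middle p q r

  middle : ∀ {p q r} → Collinear p q r → Middle p q r
  middle (inj₁ b)                                    = mid₂ b
  middle (inj₂ (inj₁ b))                             = mid₃ b
  middle (inj₂ (inj₂ (inj₁ b)))                      = mid₁ b
  middle (inj₂ (inj₂ (inj₂ (inj₁ b))))               = mid₃ (P2 _ _ _ b)
  middle (inj₂ (inj₂ (inj₂ (inj₂ (inj₁ b)))))        = mid₁ (P2 _ _ _ b)
  middle (inj₂ (inj₂ (inj₂ (inj₂ (inj₂ b)))))        = mid₂ (P2 _ _ _ b)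

  collinear-swap₁₂ : ∀ {p q r} → Collinear p q r → Collinear q p r
  collinear-swap₁₂ c with middle c
  ... | mid₁ b = col₂ b
  ... | mid₂ b = col₁ b
  ... | mid₃ b = col₃ (P2 _ _ _ b)

  collinear-swap₂₃ : ∀ {p q r} → Collinear p q r → Collinear p r q
  collinear-swap₂₃ c with middle c
  ... | mid₁ b = col₁ (P2 _ _ _ b)
  ... | mid₂ b = col₃ b
  ... | mid₃ b = col₂ b

  isMid : ∀ p q r → IsMid p q r (mid p q r)
  isMid p q r with β? q p r
  ... | yes b = is₁ b
  ... | no ¬b₁ with β? p q r
  ...   | yes b = is₂ b
  ...   | no ¬b₂ with β? p r q
  ...     | yes b = is₃ b
  ...     | no ¬b₃ = isₙ λ c → case (middle c)
    where
    case : ¬ Middle p q r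
    case (mid₁ b) = ¬b₁ b
    case (mid₂ b) = ¬b₂ b
    case (mid₃ b) = ¬b₃ b

  Distinct : Carrier → Carrier → Carrier → Set
  Distinct p q r = p ≢ q × p ≢ r × q ≢ r

  isMid-unique : ∀ {p q r m n} → Distinct p q r → IsMid p q r m → IsMid p q r n → m ≡ n
  isMid-unique _ (is₁ _) (is₁ _) = refl
  isMid-unique _ (is₂ _) (is₂ _) = refl
  isMid-unique _ (is₃ _) (is₃ _) = refl
  isMid-unique _ (isₙ _) (isₙ _) = refl
  isMid-unique (p≢q , _) (is₁ a) (is₂ b) = contradiction (P3 _ _ _ b a) p≢q
  isMid-unique (p≢q , _) (is₂ a) (is₁ b) = contradiction (P3 _ _ _ a b) p≢q
  isMid-unique (_ , p≢r , _) (is₁ a) (is₃ b) = contradiction (P3 _ _ _ b (P2 _ _ _ a)) p≢r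
  isMid-unique (_ , p≢r , _) (is₃ a) (is₁ b) = contradiction (P3 _ _ _ a (P2 _ _ _ b)) p≢r
  isMid-unique (_ , _ , q≢r) (is₂ a) (is₃ b) = contradiction (P3 _ _ _ (P2 _ _ _ b) (P2 _ _ _ a)) q≢r
  isMid-unique (_ , _ , q≢r) (is₃ a) (is₂ b) = contradiction (P3 _ _ _ (P2 _ _ _ a) (P2 _ _ _ b)) q≢r
  isMid-unique _ (is₁ b) (isₙ ¬c) = contradiction (col₁ b) ¬c
  isMid-unique _ (is₂ b) (isₙ ¬c) = contradiction (col₂ b) ¬c
  isMid-unique _ (is₃ b) (isₙ ¬c) = contradiction (col₃ b) ¬c
  isMid-unique _ (isₙ ¬c) (is₁ b) = contradiction (col₁ b) ¬c
  isMid-unique _ (isₙ ¬c) (is₂ b) = contradiction (col₂ b) ¬c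
  isMid-unique _ (isₙ ¬c) (is₃ b) = contradiction (col₃ b) ¬c

  mid≡ : ∀ {p q r m} → Distinct p q r → IsMid p q r m → mid p q r ≡ m
  mid≡ d = isMid-unique d (isMid _ _ _)

  isMid-swap₁₂ : ∀ {p q r m} → IsMid p q r m → IsMid q p r (swap₁₂ m)
  isMid-swap₁₂ (is₁ b)  = is₂ b
  isMid-swap₁₂ (is₂ b)  = is₁ b
  isMid-swap₁₂ (is₃ b)  = is₃ (P2 _ _ _ b)
  isMid-swap₁₂ (isₙ ¬c) = isₙ (¬c ∘ collinear-swap₁₂)

  isMid-swap₂₃ : ∀ {p q r m} → IsMid p q r m → IsMid p r q (swap₂₃ m)
  isMid-swap₂₃ (is₁ b)  = is₁ (P2 _ _ _ b)
  isMid-swap₂₃ (is₂ b)  = is₃ b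
  isMid-swap₂₃ (is₃ b)  = is₂ b
  isMid-swap₂₃ (isₙ ¬c) = isₙ (¬c ∘ collinear-swap₂₃)

  mid-swap₁₂ : ∀ {p q r} → Distinct p q r → mid q p r ≡ swap₁₂ (mid p q r)
  mid-swap₁₂ {p} {q} {r} (p≢q , p≢r , q≢r) =
    mid≡ (≢-sym p≢q , q≢r , p≢r) (isMid-swap₁₂ (isMid p q r))

  mid-swap₂₃ : ∀ {p q r} → Distinct p q r → mid p r q ≡ swap₂₃ (mid p q r)
  mid-swap₂₃ {p} {q} {r} (p≢q , p≢r , q≢r) =
    mid≡ (p≢r , p≢q , ≢-sym q≢r) (isMid-swap₂₃ (isMid p q r))

  β⇒mid≡m₂ : ∀ {p q r} → Distinct p q r → β p q r → mid p q r ≡ m₂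
  β⇒mid≡m₂ d b = mid≡ d (is₂ b)

  mid≡m₂⇒β : ∀ {p q r} → mid p q r ≡ m₂ → β p q r
  mid≡m₂⇒β {p} {q} {r} eq with subst (IsMid p q r) eq (isMid p q r)
  ... | is₂ b = b

  code : ∀ {n} → Vec Carrier n → Code n
  code = codeBy mid

  distinct : ∀ {n} {v : Vec Carrier n} → Unique (toList v) → ∀ {i j k} → i ≢ j → i ≢ k → j ≢ k →
             Distinct (lookup v i) (lookup v j) (lookup v k)
  distinct {v = v} u i≢j i≢k j≢k = i≢j ∘ inj _ _ , i≢k ∘ inj _ _ , j≢k ∘ inj _ _
    where inj = unique⇒injective v u

  drop₂ : ∀ {p q : Carrier} {l} → Unique (p ∷ q ∷ l) → Unique (p ∷ l)
  drop₂ ((_ ∷ p∉) ∷ _ ∷ u) = p∉ ∷ u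

  drop₃ : ∀ {p q r : Carrier} {l} → Unique (p ∷ q ∷ r ∷ l) → Unique (p ∷ q ∷ l)
  drop₃ ((pq ∷ _ ∷ p∉) ∷ (_ ∷ q∉) ∷ _ ∷ u) = (pq ∷ p∉) ∷ q∉ ∷ u

  rowAt-mid : ∀ {n p} {v : Vec Carrier n} → Unique (p ∷ toList v) → ∀ {i j} → i ≢ j →
              rowAt (rowBy (mid p) v) i j ≡ mid p (lookup v i) (lookup v j)
  rowAt-mid {v = q ∷ v} u {zero}  {zero}  i≢j = contradiction refl i≢j
  rowAt-mid {v = q ∷ v} u {zero}  {suc j} i≢j = lookup-map j _ v
  rowAt-mid {v = q ∷ v} u {suc i} {zero}  i≢j = ≡-trans (cong swap₂₃ (lookup-map i _ v))
    (sym (mid-swap₂₃ (distinct u {zero} {suc zero} {suc (suc i)} (λ ()) (λ ()) (λ ()))))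
  rowAt-mid {v = q ∷ v} u {suc i} {suc j} i≢j = rowAt-mid (drop₂ u) (i≢j ∘ cong suc)

  codeAt-code : ∀ {n} {v : Vec Carrier n} → Unique (toList v) →
                ∀ {i j k} → i ≢ j → i ≢ k → j ≢ k →
                codeAt (code v) i j k ≡ mid (lookup v i) (lookup v j) (lookup v k)
  codeAt-code {v = p ∷ v} u {zero}  {zero}  {k}     i≢j i≢k j≢k = contradiction refl i≢j
  codeAt-code {v = p ∷ v} u {zero}  {suc j} {zero}  i≢j i≢k j≢k = contradiction refl i≢k
  codeAt-code {v = p ∷ v} u {suc i} {zero}  {zero}  i≢j i≢k j≢k = contradiction refl j≢k
  codeAt-code {v = p ∷ v} u {zero}  {suc j} {suc k} i≢j i≢k j≢k = rowAt-mid u (j≢k ∘ cong suc)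
  codeAt-code {v = p ∷ v} u {suc i} {zero}  {suc k} i≢j i≢k j≢k = ≡-trans
    (cong swap₁₂ (rowAt-mid u (i≢k ∘ cong suc)))
    (sym (mid-swap₁₂ (distinct u {zero} {suc i} {suc k} (λ ()) (λ ()) i≢k)))
  codeAt-code {v = p ∷ v} u {suc i} {suc j} {zero}  i≢j i≢k j≢k = ≡-trans
    (cong (swap₂₃ ∘ swap₁₂) (rowAt-mid u (i≢j ∘ cong suc))) (≡-trans
    (cong swap₂₃ (sym (mid-swap₁₂ (distinct u {zero} {suc i} {suc j} (λ ()) (λ ()) i≢j))))
    (sym (mid-swap₂₃ (distinct u {suc i} {zero} {suc j} (λ ()) i≢j (λ ())))))
  codeAt-code {v = p ∷ v} (_ ∷ u) {suc i} {suc j} {suc k} i≢j i≢k j≢k =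
    codeAt-code u (i≢j ∘ cong suc) (i≢k ∘ cong suc) (j≢k ∘ cong suc)

  code-transitive : (v : Vec Carrier 4) → Unique (toList v) → (w : Vec (Fin 4) 4) → Injective w →
                    Transitive (code v) w
  code-transitive v u w@(p ∷ q ∷ r ∷ s ∷ []) winj (pqr , psq) =
    between (P4′ .proj₁) (w≢ 0F 3F) (w≢ 0F 2F) (w≢ 3F 2F) ,
    between (P4′ .proj₂) (w≢ 3F 1F) (w≢ 3F 2F) (w≢ 1F 2F)
    where
    w≢ : ∀ i j {_ : False (i Fin.≟ j)} → lookup w i ≢ lookup w j
    w≢ i j {i≢j} eq = toWitnessFalse i≢j (winj i j eq)
    β′ : ∀ {i j k} → Amid (code v) i j k → i ≢ j → i ≢ k → j ≢ k →
         β (lookup v i) (lookup v j) (lookup v k)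
    β′ b ij ik jk = mid≡m₂⇒β (≡-trans (sym (codeAt-code u ij ik jk)) b)
    between : ∀ {i j k} → β (lookup v i) (lookup v j) (lookup v k) →
              i ≢ j → i ≢ k → j ≢ k → Amid (code v) i j k
    between b ij ik jk = ≡-trans (codeAt-code u ij ik jk) (β⇒mid≡m₂ (distinct u ij ik jk) b)
    P4′ = P4 _ _ _ _ (β′ pqr (w≢ 0F 1F) (w≢ 0F 2F) (w≢ 1F 2F))
                     (β′ psq (w≢ 0F 3F) (w≢ 0F 1F) (w≢ 3F 1F))

  fits-mid : ∀ {p q r s} → Unique (p ∷ q ∷ r ∷ s ∷ []) →
             T (fits (mid p q r) (mid p q s) (mid p r s) (mid q r s))
  fits-mid {p} {q} {r} {s} u = all⁻ (obeys c) (All.tabulate {xs = shuffles 4} λ {l} _ → obeyed l)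
    where
    v = p ∷ q ∷ r ∷ s ∷ []
    c = fourCode (mid p q r) (mid p q s) (mid p r s) (mid q r s)
    obeyed : ∀ l → T (obeys c l)
    obeyed l = fromWitness {a? = transitive? c (shuffle l (allFin 4))}
      (code-transitive v u (shuffle l (allFin 4)) (shuffle-injective l))

  compatible-mid : ∀ {n p q r} (v : Vec Carrier n) → Unique (p ∷ q ∷ r ∷ toList v) →
    T (compatible table (mid p q r) (map (mid p q) v) (map (mid p r) v) (map (mid q r) v))
  compatible-mid []      u = tt
  compatible-mid {p = p} {q} {r} (s ∷ v) u@((pq ∷ pr ∷ ps ∷ p∉) ∷ (qr ∷ qs ∷ q∉) ∷ (rs ∷ r∉) ∷ _ ∷ u′) =
    Equivalence.from T-∧
      ( subst T (sym (entry-tabulate₄ fits (mid p q r) (mid p q s) (mid p r s) (mid q r s)))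
          (fits-mid ((pq ∷ pr ∷ ps ∷ []) ∷ (qr ∷ qs ∷ []) ∷ (rs ∷ []) ∷ [] ∷ []))
      , compatible-mid v ((pq ∷ pr ∷ p∉) ∷ (qr ∷ q∉) ∷ r∉ ∷ u′))

  fitsVec-mid : ∀ {n p q} (v : Vec Carrier n) → Unique (p ∷ q ∷ toList v) →
                FitsVec (map (mid p q) v) (rowBy (mid p) v) (rowBy (mid q) v)
  fitsVec-mid []      u = tt
  fitsVec-mid (r ∷ v) u = compatible-mid v u , fitsVec-mid v (drop₃ u)

  -- This is the link to the search: a row that comes from a structure passes every test on four
  -- points, so the verified property applies to it.
  fitsRow-mid : ∀ {n p} (v : Vec Carrier n) → Unique (p ∷ toList v) →
                FitsRow (rowBy (mid p) v) (code v)
  fitsRow-mid []      u = tt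
  fitsRow-mid (q ∷ v) u = fitsVec-mid v u , fitsRow-mid v (drop₂ u)

  permute-code : ∀ {n} (l : Shuffle n) {v : Vec Carrier n} → Unique (toList v) →
                 permute l (code v) ≡ code (shuffle l v)
  permute-code {n} l {v} u = codeBy-cong (shuffle l (allFin n)) (shuffle l v) λ i j k i<j j<k →
    ≡-trans
      (codeAt-code u (Fin.<⇒≢ i<j ∘ inj i j) (Fin.<⇒≢ (Fin.<-trans i<j j<k) ∘ inj i k)
        (Fin.<⇒≢ j<k ∘ inj j k))
      (sym (mid-cong (lookup-shuffle l v i) (lookup-shuffle l v j) (lookup-shuffle l v k)))
    where
    inj = shuffle-injective l
    mid-cong : ∀ {p q r p′ q′ r′} → p ≡ p′ → q ≡ q′ → r ≡ r′ → mid p q r ≡ mid p′ q′ r′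
    mid-cong refl refl refl = refl

-- Counting triangles

module Triangles (B : BetweennessStructure) where
  open Betweenness B public

  t : Carrier → Carrier → Carrier → ℕ
  t p q r = 𝟙 (¬? (collinear? p q r))

  -- Triangles are counted along lists, through two given points, through one, or through none. A
  -- permutation can then bring any point to the front, where its triangles split off as a summand
  -- `tri₂`.
  tri₁ : Carrier → Carrier → List Carrier → ℕ
  tri₁ p q []       = 0
  tri₁ p q (r ∷ rs) = t p q r + tri₁ p q rs

  tri₂ : Carrier → List Carrier → ℕ
  tri₂ p []       = 0
  tri₂ p (q ∷ qs) = tri₁ p q qs + tri₂ p qs

  tri : List Carrier → ℕ
  tri []       = 0
  tri (p ∷ ps) = tri₂ p ps + tri ps

  t≡1 : ∀ {p q r} → ¬ Collinear p q r → t p q r ≡ 1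
  t≡1 {p} {q} {r} ¬c with collinear? p q r
  ... | yes c = contradiction c ¬c
  ... | no _  = refl

  t≡0 : ∀ {p q r} → Collinear p q r → t p q r ≡ 0
  t≡0 {p} {q} {r} c = 𝟙≡0 (¬? (collinear? p q r)) λ ¬c → ¬c c

  t-cong : ∀ {p q r p′ q′ r′} → (Collinear p q r → Collinear p′ q′ r′) →
           (Collinear p′ q′ r′ → Collinear p q r) → t p q r ≡ t p′ q′ r′
  t-cong {p} {q} {r} f g with collinear? p q r
  ... | yes c = sym (t≡0 (f c))
  ... | no ¬c = sym (t≡1 (¬c ∘ g))

  t-swap₁₂ : ∀ p q r → t p q r ≡ t q p r
  t-swap₁₂ p q r = t-cong {p} {q} {r} collinear-swap₁₂ collinear-swap₁₂

  t-swap₂₃ : ∀ p q r → t p q r ≡ t p r q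
  t-swap₂₃ p q r = t-cong {p} {q} {r} collinear-swap₂₃ collinear-swap₂₃

  tri₁-swap : ∀ p q rs → tri₁ p q rs ≡ tri₁ q p rs
  tri₁-swap p q []       = refl
  tri₁-swap p q (r ∷ rs) = cong₂ _+_ (t-swap₁₂ p q r) (tri₁-swap p q rs)

  tri₁-↭ : ∀ {p q rs rs′} → rs ↭ rs′ → tri₁ p q rs ≡ tri₁ p q rs′
  tri₁-↭ refl                  = refl
  tri₁-↭ {p} {q} (prep r π)    = cong (t p q r +_) (tri₁-↭ π)
  tri₁-↭ {p} {q} (swap r s π)  = ≡-trans (x∙yz≈y∙xz +-commutativeSemigroup (t p q r) (t p q s) _)
    (cong (λ k → t p q s + (t p q r + k)) (tri₁-↭ π))
  tri₁-↭ (trans π ρ)           = ≡-trans (tri₁-↭ π) (tri₁-↭ ρ)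

  tri₂-↭ : ∀ {p qs qs′} → qs ↭ qs′ → tri₂ p qs ≡ tri₂ p qs′
  tri₂-↭ refl                = refl
  tri₂-↭ {p} (prep q π)      = cong₂ _+_ (tri₁-↭ π) (tri₂-↭ π)
  tri₂-↭ {p} (swap {xs = qs} {ys = qs′} q r π) = begin
    (t p q r + tri₁ p q qs) + (tri₁ p r qs + tri₂ p qs)     ≡⟨ interchange +-commutativeSemigroup (t p q r) _ _ _ ⟩
    (t p q r + tri₁ p r qs) + (tri₁ p q qs + tri₂ p qs)     ≡⟨ cong₂ _+_
      (cong₂ _+_ (t-swap₂₃ p q r) (tri₁-↭ π)) (cong₂ _+_ (tri₁-↭ π) (tri₂-↭ π)) ⟩
    (t p r q + tri₁ p r qs′) + (tri₁ p q qs′ + tri₂ p qs′)  ∎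
    where open ≡-Reasoning
  tri₂-↭ (trans π ρ)         = ≡-trans (tri₂-↭ π) (tri₂-↭ ρ)

  tri-↭ : ∀ {ps ps′} → ps ↭ ps′ → tri ps ≡ tri ps′
  tri-↭ refl           = refl
  tri-↭ (prep p π)     = cong₂ _+_ (tri₂-↭ π) (tri-↭ π)
  tri-↭ (swap {xs = ps} {ys = ps′} p q π) = begin
    (tri₁ p q ps + tri₂ p ps) + (tri₂ q ps + tri ps)      ≡⟨ interchange +-commutativeSemigroup (tri₁ p q ps) _ _ _ ⟩
    (tri₁ p q ps + tri₂ q ps) + (tri₂ p ps + tri ps)      ≡⟨ cong₂ _+_
      (cong₂ _+_ (≡-trans (tri₁-swap p q ps) (tri₁-↭ π)) (tri₂-↭ π))
      (cong₂ _+_ (tri₂-↭ π) (tri-↭ π)) ⟩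
    (tri₁ q p ps′ + tri₂ q ps′) + (tri₂ p ps′ + tri ps′)  ∎
    where open ≡-Reasoning
  tri-↭ (trans π ρ)    = ≡-trans (tri-↭ π) (tri-↭ ρ)

  cost-mid : ∀ p q r → cost (mid p q r) ≡ t p q r
  cost-mid p q r with mid p q r | isMid p q r
  ... | .m₁   | is₁ b  = sym (t≡0 (col₁ b))
  ... | .m₂   | is₂ b  = sym (t≡0 (col₂ b))
  ... | .m₃   | is₃ b  = sym (t≡0 (col₃ b))
  ... | .none | isₙ ¬c = sym (t≡1 ¬c)

  nonesᵛ-mid : ∀ {n} p q (v : Vec Carrier n) → nonesᵛ (map (mid p q) v) ≡ tri₁ p q (toList v)
  nonesᵛ-mid p q []      = refl
  nonesᵛ-mid p q (r ∷ v) = cong₂ _+_ (cost-mid p q r) (nonesᵛ-mid p q v)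

  nonesʳ-mid : ∀ {n} p (v : Vec Carrier n) → nonesʳ (rowBy (mid p) v) ≡ tri₂ p (toList v)
  nonesʳ-mid p []      = refl
  nonesʳ-mid p (q ∷ v) = cong₂ _+_ (nonesᵛ-mid p q v) (nonesʳ-mid p v)

  nones-code : ∀ {n} (v : Vec Carrier n) → nones (code v) ≡ tri (toList v)
  nones-code []      = refl
  nones-code (p ∷ v) = cong₂ _+_ (nonesʳ-mid p v) (nones-code v)

  Linear : List Carrier → Set
  Linear ps = ∀ {p q r} → p ∈ ps → q ∈ ps → r ∈ ps → Collinear p q r

  collinear-refl₁₂ : ∀ {p r} → Collinear p p r
  collinear-refl₁₂ = col₂ (P1 _ _)

  collinear-refl₂₃ : ∀ {p r} → Collinear p r r
  collinear-refl₂₃ = collinear-swap₁₂ (collinear-swap₂₃ collinear-refl₁₂)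

  collinear-refl₁₃ : ∀ {p r} → Collinear p r p
  collinear-refl₁₃ = collinear-swap₂₃ collinear-refl₁₂

  pull : ∀ {p : Carrier} {ps} → p ∈ ps → ∃ λ qs → ps ↭ p ∷ qs
  pull p∈ with as , bs , refl ← ∈-∃++ p∈ = _ , shift _ as bs

  pull-other : ∀ {p q : Carrier} {ps qs} → ps ↭ p ∷ qs → q ≢ p → q ∈ ps → q ∈ qs
  pull-other π q≢p q∈ with ∈-resp-↭ π q∈
  ... | here q≡p  = contradiction q≡p q≢p
  ... | there q∈′ = q∈′

  pull₃ : ∀ {p q r ps} → ¬ Collinear p q r → p ∈ ps → q ∈ ps → r ∈ ps →
          ∃ λ rs → ps ↭ p ∷ q ∷ r ∷ rs
  pull₃ {p} {q} {r} ¬c p∈ q∈ r∈ =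
    let _ , π = pull p∈
        _ , ρ = pull (pull-other π q≢p q∈)
        _ , σ = pull (pull-other ρ r≢q (pull-other π r≢p r∈))
    in _ , ↭-trans π (↭-prep p (↭-trans ρ (↭-prep q σ)))
    where
    q≢p : q ≢ p
    q≢p refl = ¬c collinear-refl₁₂
    r≢p : r ≢ p
    r≢p refl = ¬c collinear-refl₁₃
    r≢q : r ≢ q
    r≢q refl = ¬c collinear-refl₂₃

  tri₁>0⇒ : ∀ {p q} rs → 0 < tri₁ p q rs → ∃ λ r → ∃ λ rs′ → rs ↭ r ∷ rs′ × ¬ Collinear p q r
  tri₁>0⇒ {p} {q} (r ∷ rs) 0< with collinear? p q r
  ... | no ¬c = r , rs , ↭-refl , ¬c
  ... | yes _ with s , rs′ , π , ¬c ← tri₁>0⇒ rs 0< =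
    s , r ∷ rs′ , ↭-trans (↭-prep r π) (↭-swap r s ↭-refl) , ¬c

  tri₂>0⇒ : ∀ {p} qs → 0 < tri₂ p qs →
            ∃ λ q → ∃ λ r → ∃ λ rs → qs ↭ q ∷ r ∷ rs × ¬ Collinear p q r
  tri₂>0⇒ {p} (q ∷ qs) 0< with tri₁ p q qs in eq
  ... | suc _ with r , rs , π , ¬c ← tri₁>0⇒ qs (subst (0 <_) (sym eq) z<s) =
    q , r , rs , ↭-prep q π , ¬c
  ... | zero with r , s , rs , π , ¬c ← tri₂>0⇒ qs 0< =
    r , s , q ∷ rs ,
    ↭-trans (↭-prep q π) (↭-trans (↭-swap q r ↭-refl) (↭-prep r (↭-swap q s ↭-refl))) , ¬c

  tri>0⇒ : ∀ ps → 0 < tri ps →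
           ∃ λ p → ∃ λ q → ∃ λ r → ∃ λ rs → ps ↭ p ∷ q ∷ r ∷ rs × ¬ Collinear p q r
  tri>0⇒ (p ∷ ps) 0< with tri₂ p ps in eq
  ... | suc _ with q , r , rs , π , ¬c ← tri₂>0⇒ ps (subst (0 <_) (sym eq) z<s) =
    p , q , r , rs , ↭-prep p π , ¬c
  ... | zero with q , r , s , rs , π , ¬c ← tri>0⇒ ps 0< =
    q , r , s , p ∷ rs ,
    ↭-trans (↭-prep p π) (↭-trans (↭-swap p q ↭-refl) (↭-prep q
      (↭-trans (↭-swap p r ↭-refl) (↭-prep r (↭-swap p s ↭-refl))))) , ¬c

  t≤tri₂ : ∀ {p q r rs} → t p q r ≤ tri₂ p (q ∷ r ∷ rs)
  t≤tri₂ {p} {q} {r} {rs} = ≤-trans (m≤m+n _ (tri₁ p q rs)) (m≤m+n _ _)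

  ¬collinear⇒tri>0 : ∀ {p q r ps} → ¬ Collinear p q r → p ∈ ps → q ∈ ps → r ∈ ps → 0 < tri ps
  ¬collinear⇒tri>0 {p} {q} {r} {ps} ¬c p∈ q∈ r∈ with rs , π ← pull₃ ¬c p∈ q∈ r∈ = begin-strict
    0                        <⟨ z<s ⟩
    1                        ≡⟨ t≡1 ¬c ⟨
    t p q r                  ≤⟨ t≤tri₂ {p} {q} {r} {rs} ⟩
    tri₂ p (q ∷ r ∷ rs)      ≤⟨ m≤m+n _ _ ⟩
    tri (p ∷ q ∷ r ∷ rs)     ≡⟨ tri-↭ π ⟨
    tri ps                   ∎
    where open ≤-Reasoning

  linear⇒tri≡0 : ∀ {ps} → Linear ps → tri ps ≡ 0
  linear⇒tri≡0 {ps} lin with tri ps in eq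
  ... | zero  = refl
  ... | suc _ with p , q , r , rs , π , ¬c ← tri>0⇒ ps (subst (0 <_) (sym eq) z<s) =
    contradiction
      (lin (∈-resp-↭ (↭-sym π) (here refl)) (∈-resp-↭ (↭-sym π) (there (here refl)))
           (∈-resp-↭ (↭-sym π) (there (there (here refl))))) ¬c

  tri-linear : ∀ {q r rs} → Linear (q ∷ rs) → Linear (r ∷ rs) → tri (q ∷ r ∷ rs) ≡ tri₁ q r rs
  tri-linear {q} {r} {rs} lq lr = ≡-trans
    (cong₂ _+_ (cong (tri₁ q r rs +_) (m+n≡0⇒m≡0 (tri₂ q rs) (linear⇒tri≡0 lq))) (linear⇒tri≡0 lr))
    (≡-trans (+-identityʳ _) (+-identityʳ _))

  -- Only the corners of one triangle have to be tried. If deleting any of the three leaves no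
  -- triangle, every triangle contains all three corners, so there is just one; a fourth point is
  -- then deleted instead.
  pick : ∀ ps → 4 ≤ length ps → 0 < tri ps → ∃ λ p → ∃ λ qs →
         ps ↭ p ∷ qs × 0 < tri qs × (tri ps ≡ 1 ⊎ 0 < tri₂ p qs)
  pick ps 4≤ 0< with p , q , r , rs , π , ¬c ← tri>0⇒ ps 0< = go (tri qs) (tri ps′) (tri ps″) refl refl refl
    where
    qs ps′ ps″ : List Carrier
    qs  = q ∷ r ∷ rs
    ps′ = p ∷ r ∷ rs
    ps″ = p ∷ q ∷ rs
    0<t : ∀ {p q r} → ¬ Collinear p q r → 0 < tri₂ p (q ∷ r ∷ rs)
    0<t {p} {q} {r} ¬c = subst (_≤ tri₂ p (q ∷ r ∷ rs)) (t≡1 ¬c) (t≤tri₂ {p} {q} {r} {rs})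
    go : ∀ a b c → tri qs ≡ a → tri ps′ ≡ b → tri ps″ ≡ c → ∃ λ p → ∃ λ qs →
         ps ↭ p ∷ qs × 0 < tri qs × (tri ps ≡ 1 ⊎ 0 < tri₂ p qs)
    go (suc a) _ _ eq _ _ = p , qs , π , subst (0 <_) (sym eq) z<s , inj₂ (0<t ¬c)
    go _ (suc b) _ _ eq _ = q , ps′ , ↭-trans π (↭-swap p q ↭-refl) ,
      subst (0 <_) (sym eq) z<s , inj₂ (0<t (¬c ∘ collinear-swap₁₂))
    go _ _ (suc c) _ _ eq = r , ps″ ,
      ↭-trans π (↭-trans (↭-prep p (↭-swap q r ↭-refl)) (↭-swap p r ↭-refl)) ,
      subst (0 <_) (sym eq) z<s , inj₂ (0<t (¬c ∘ collinear-swap₂₃ ∘ collinear-swap₁₂))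
    go zero zero zero eqq eqp eqr = rest rs (≤-trans 4≤ (≤-reflexive (↭-length π))) π
      where
      tri≡1 : tri ps ≡ 1
      tri≡1 = ≡-trans (tri-↭ π) (cong₂ _+_ (cong₂ _+_ (cong₂ _+_ (t≡1 ¬c)
        (m+n≡0⇒m≡0 (tri₁ p q rs) (m+n≡0⇒m≡0 (tri₂ p (q ∷ rs)) eqr)))
        (m+n≡0⇒m≡0 (tri₂ p (r ∷ rs)) eqp)) eqq)
      rest : ∀ rs → 4 ≤ length (p ∷ q ∷ r ∷ rs) → ps ↭ p ∷ q ∷ r ∷ rs → ∃ λ p → ∃ λ qs →
             ps ↭ p ∷ qs × 0 < tri qs × (tri ps ≡ 1 ⊎ 0 < tri₂ p qs)
      rest []       (s≤s (s≤s (s≤s ())))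
      rest (s ∷ rs) _ π = s , p ∷ q ∷ r ∷ rs , ↭-trans π (shift s (p ∷ q ∷ r ∷ []) rs) ,
        ¬collinear⇒tri>0 {ps = p ∷ q ∷ r ∷ rs} ¬c (here refl) (there (here refl)) (there (there (here refl))) , inj₁ tri≡1

-- Structures with at most seven points

-- The codes of the listed graphs, with the vertices in the order of their enumeration.
k₃ : Code 3
k₃ =
    ((none ∷ []) ∷ [] ∷ []) ∷ ([] ∷ []) ∷ [] ∷ []

k₁₃ c₄-1122 : Code 4
k₁₃ =
    ((m₁ ∷ m₁ ∷ []) ∷ (m₁ ∷ []) ∷ [] ∷ [])
  ∷ ((none ∷ []) ∷ [] ∷ []) ∷ ([] ∷ []) ∷ [] ∷ []
c₄-1122 =
    ((m₂ ∷ m₁ ∷ []) ∷ (none ∷ []) ∷ [] ∷ [])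
  ∷ ((m₂ ∷ []) ∷ [] ∷ []) ∷ ([] ∷ []) ∷ [] ∷ []

k₂₃ r₅₁ s₅ : Code 5
k₂₃ =
    ((m₃ ∷ m₃ ∷ m₃ ∷ []) ∷ (m₁ ∷ m₁ ∷ []) ∷ (m₁ ∷ []) ∷ [] ∷ [])
  ∷ ((m₁ ∷ m₁ ∷ []) ∷ (m₁ ∷ []) ∷ [] ∷ [])
  ∷ ((none ∷ []) ∷ [] ∷ []) ∷ ([] ∷ []) ∷ [] ∷ []
r₅₁ =
    ((m₃ ∷ m₃ ∷ none ∷ []) ∷ (m₁ ∷ m₁ ∷ []) ∷ (m₂ ∷ []) ∷ [] ∷ [])
  ∷ ((m₁ ∷ m₁ ∷ []) ∷ (m₂ ∷ []) ∷ [] ∷ [])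
  ∷ ((m₂ ∷ []) ∷ [] ∷ []) ∷ ([] ∷ []) ∷ [] ∷ []
s₅ =
    ((m₁ ∷ none ∷ m₂ ∷ []) ∷ (m₂ ∷ m₂ ∷ []) ∷ (m₂ ∷ []) ∷ [] ∷ [])
  ∷ ((m₃ ∷ m₃ ∷ []) ∷ (m₃ ∷ []) ∷ [] ∷ [])
  ∷ ((m₂ ∷ []) ∷ [] ∷ []) ∷ ([] ∷ []) ∷ [] ∷ []

k₃₃ k₃₃-e k₃₃-2e c₆ r₆₁ r₆₂ s₆ : Code 6
k₃₃ =
    ((none ∷ m₃ ∷ m₃ ∷ m₃ ∷ []) ∷ (m₃ ∷ m₃ ∷ m₃ ∷ []) ∷ (m₁ ∷ m₁ ∷ []) ∷ (m₁ ∷ []) ∷ [] ∷ [])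
  ∷ ((m₃ ∷ m₃ ∷ m₃ ∷ []) ∷ (m₁ ∷ m₁ ∷ []) ∷ (m₁ ∷ []) ∷ [] ∷ [])
  ∷ ((m₁ ∷ m₁ ∷ []) ∷ (m₁ ∷ []) ∷ [] ∷ [])
  ∷ ((none ∷ []) ∷ [] ∷ []) ∷ ([] ∷ []) ∷ [] ∷ []
k₃₃-e =
    ((none ∷ m₂ ∷ m₃ ∷ m₃ ∷ []) ∷ (m₂ ∷ m₃ ∷ m₃ ∷ []) ∷ (m₃ ∷ m₃ ∷ []) ∷ (m₁ ∷ []) ∷ [] ∷ [])
  ∷ ((m₃ ∷ m₃ ∷ m₃ ∷ []) ∷ (m₁ ∷ m₁ ∷ []) ∷ (m₁ ∷ []) ∷ [] ∷ [])
  ∷ ((m₁ ∷ m₁ ∷ []) ∷ (m₁ ∷ []) ∷ [] ∷ [])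
  ∷ ((none ∷ []) ∷ [] ∷ []) ∷ ([] ∷ []) ∷ [] ∷ []
k₃₃-2e =
    ((none ∷ m₂ ∷ m₁ ∷ m₃ ∷ []) ∷ (m₂ ∷ m₃ ∷ m₃ ∷ []) ∷ (m₃ ∷ m₃ ∷ []) ∷ (m₁ ∷ []) ∷ [] ∷ [])
  ∷ ((m₃ ∷ m₂ ∷ m₃ ∷ []) ∷ (m₂ ∷ m₁ ∷ []) ∷ (m₃ ∷ []) ∷ [] ∷ [])
  ∷ ((m₁ ∷ m₁ ∷ []) ∷ (m₁ ∷ []) ∷ [] ∷ [])
  ∷ ((none ∷ []) ∷ [] ∷ []) ∷ ([] ∷ []) ∷ [] ∷ []
c₆ =
    ((m₂ ∷ m₂ ∷ m₁ ∷ m₁ ∷ []) ∷ (m₂ ∷ none ∷ m₁ ∷ []) ∷ (m₃ ∷ m₃ ∷ []) ∷ (m₃ ∷ []) ∷ [] ∷ [])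
  ∷ ((m₂ ∷ m₂ ∷ m₁ ∷ []) ∷ (m₂ ∷ none ∷ []) ∷ (m₃ ∷ []) ∷ [] ∷ [])
  ∷ ((m₂ ∷ m₂ ∷ []) ∷ (m₂ ∷ []) ∷ [] ∷ [])
  ∷ ((m₂ ∷ []) ∷ [] ∷ []) ∷ ([] ∷ []) ∷ [] ∷ []
r₆₁ =
    ((m₃ ∷ m₃ ∷ none ∷ none ∷ []) ∷ (m₁ ∷ m₁ ∷ m₁ ∷ []) ∷ (m₂ ∷ m₂ ∷ []) ∷ (m₂ ∷ []) ∷ [] ∷ [])
  ∷ ((m₁ ∷ m₁ ∷ m₁ ∷ []) ∷ (m₂ ∷ m₂ ∷ []) ∷ (m₂ ∷ []) ∷ [] ∷ [])
  ∷ ((m₂ ∷ m₂ ∷ []) ∷ (m₂ ∷ []) ∷ [] ∷ [])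
  ∷ ((m₂ ∷ []) ∷ [] ∷ []) ∷ ([] ∷ []) ∷ [] ∷ []
r₆₂ =
    ((none ∷ m₃ ∷ m₃ ∷ none ∷ []) ∷ (m₃ ∷ m₁ ∷ m₁ ∷ []) ∷ (m₁ ∷ m₁ ∷ []) ∷ (m₂ ∷ []) ∷ [] ∷ [])
  ∷ ((m₃ ∷ m₁ ∷ m₁ ∷ []) ∷ (m₁ ∷ m₁ ∷ []) ∷ (m₂ ∷ []) ∷ [] ∷ [])
  ∷ ((m₂ ∷ m₂ ∷ []) ∷ (m₂ ∷ []) ∷ [] ∷ [])
  ∷ ((m₂ ∷ []) ∷ [] ∷ []) ∷ ([] ∷ []) ∷ [] ∷ []
s₆ =
    ((m₁ ∷ none ∷ none ∷ m₂ ∷ []) ∷ (m₂ ∷ m₂ ∷ m₂ ∷ []) ∷ (m₂ ∷ m₂ ∷ []) ∷ (m₂ ∷ []) ∷ [] ∷ [])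
  ∷ ((m₃ ∷ m₃ ∷ m₃ ∷ []) ∷ (m₃ ∷ m₃ ∷ []) ∷ (m₃ ∷ []) ∷ [] ∷ [])
  ∷ ((m₂ ∷ m₂ ∷ []) ∷ (m₂ ∷ []) ∷ [] ∷ [])
  ∷ ((m₂ ∷ []) ∷ [] ∷ []) ∷ ([] ∷ []) ∷ [] ∷ []

-- The 4-cycle with unit weights, the only structure on four points that has no triangle and is not
-- an ordering.
c₄ : Code 4
c₄ =
    ((m₂ ∷ m₁ ∷ []) ∷ (m₃ ∷ []) ∷ [] ∷ [])
  ∷ ((m₂ ∷ []) ∷ [] ∷ []) ∷ ([] ∷ []) ∷ [] ∷ []

path : ∀ n → Code n
path n = codeBy (λ _ _ _ → m₂) (allFin n)

codes₃ : List (Code 3)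
codes₃ = k₃ ∷ []

codes₄ : List (Code 4)
codes₄ = k₁₃ ∷ c₄-1122 ∷ []

codes₅ : List (Code 5)
codes₅ = k₂₃ ∷ r₅₁ ∷ s₅ ∷ []

codes₆ : List (Code 6)
codes₆ = k₃₃ ∷ k₃₃-e ∷ k₃₃-2e ∷ c₆ ∷ r₆₁ ∷ r₆₂ ∷ s₆ ∷ []

-- The budget is the increase of the minimum co-size: 0 up to five points and 1 afterwards.
codes₄-extend : Extends codes₃ 0 (OneOf codes₄)
codes₄-extend = extends codes₃ 0 (oneOf? codes₄) tt

codes₅-extend : Extends codes₄ 0 (OneOf codes₅)
codes₅-extend = extends codes₄ 0 (oneOf? codes₅) tt

codes₆-extend : Extends codes₅ 1 (OneOf codes₆)
codes₆-extend = extends codes₅ 1 (oneOf? codes₆) tt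

-- Here the outcome is recorded in the form that the induction can carry on. An extension of `k₃₃`,
-- `k₃₃-e`, `k₃₃-2e` or `c₆` would keep their two disjoint triangles and could not be `Paired`; that
-- the check succeeds means that they have no extension within the budget.
codes₆-paired : Extends codes₆ 1 (Paired 3)
codes₆-paired = extends codes₆ 1 (paired? 3) tt

paths-extend₄ : Extends (path 3 ∷ []) 0 (OneOf (path 4 ∷ c₄ ∷ []))
paths-extend₄ = extends (path 3 ∷ []) 0 (oneOf? (path 4 ∷ c₄ ∷ [])) tt

paths-extend₅ : Extends (path 4 ∷ c₄ ∷ []) 0 (OneOf (path 5 ∷ []))
paths-extend₅ = extends (path 4 ∷ c₄ ∷ []) 0 (oneOf? (path 5 ∷ [])) tt

module Classification (B : BetweennessStructure) where
  open Triangles B public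

  Arranged : ∀ {n} → List Carrier → (Code n → Set) → Set
  Arranged {n} ps P = ∃ λ (v : Vec Carrier n) → toList v ↭ ps × P (code v)

  arranged-oneOf : ∀ {n} {cs : List (Code n)} (v : Vec Carrier n) → Unique (toList v) →
                   OneOf cs (code v) → Arranged (toList v) (_∈ cs)
  arranged-oneOf {cs = cs} v u (oneOf l c∈) =
    shuffle l v , shuffle-↭ l v , subst (_∈ cs) (permute-code l u) c∈

  arranged-resp-↭ : ∀ {n} {P : Code n → Set} {ps qs} → qs ↭ ps → Arranged qs P → Arranged ps P
  arranged-resp-↭ π (v , ρ , c) = v , ↭-trans ρ π , c

  Classified : ∀ {n} → ℕ → List (Code n) → Set
  Classified {n} b cs = ∀ {ps} → Unique ps → length ps ≡ n → 0 < tri ps → tri ps ≤ b →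
                        Arranged ps (_∈ cs)

  -- A deleted point that lies in a triangle leaves at most `a + b - 1`, hence at most `a`
  -- triangles; in the case of a single triangle the bound `1 ≤ a` suffices. So the classification
  -- applies to the rest.
  extendClassified : ∀ {n a b} {cs : List (Code n)} P → 3 ≤ n → 1 ≤ a → b ≤ 1 →
    All (λ c → nones c ≡ a) cs → Extends cs b P → Classified a cs →
    ∀ {ps} → Unique ps → length ps ≡ suc n → 0 < tri ps → tri ps ≤ a + b →
    Arranged ps P
  extendClassified {a = a} {b} {cs} P 3≤n 1≤a b≤1 nones≡a ext IH {ps} u len 0< tri≤
    with p , qs , π , 0<qs , alt ← pick ps (subst (4 ≤_) (sym len) (s≤s 3≤n)) 0< =
    p ∷ v , ρ , Extends.extend ext (proj₂ (proj₂ rec)) (rowBy (mid p) v)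
      (fitsRow-mid v (unique-resp-↭ (↭-sym ρ) u)) (≤-trans (≤-reflexive (nonesʳ-mid p v)) tri₂≤b)
    where
    open ≤-Reasoning
    total : tri ps ≡ tri₂ p qs + tri qs
    total = tri-↭ π
    tri-qs≤ : tri ps ≡ 1 ⊎ 0 < tri₂ p qs → tri qs ≤ a
    tri-qs≤ (inj₁ one) = begin
      tri qs              ≤⟨ m≤n+m _ _ ⟩
      tri₂ p qs + tri qs  ≡⟨ total ⟨
      tri ps              ≡⟨ one ⟩
      1                   ≤⟨ 1≤a ⟩
      a                   ∎
    tri-qs≤ (inj₂ 0<₂) = s≤s⁻¹ (begin
      suc (tri qs)        ≤⟨ +-monoˡ-≤ (tri qs) 0<₂ ⟩
      tri₂ p qs + tri qs  ≡⟨ total ⟨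
      tri ps              ≤⟨ tri≤ ⟩
      a + b               ≤⟨ +-monoʳ-≤ a b≤1 ⟩
      a + 1               ≡⟨ +-comm a 1 ⟩
      suc a               ∎)
    rec : Arranged qs (_∈ cs)
    rec with _ ∷ uq ← unique-resp-↭ π u =
      IH uq (suc-injective (≡-trans (sym (↭-length π)) len)) 0<qs (tri-qs≤ alt)
    v = proj₁ rec
    ρ : p ∷ toList v ↭ ps
    ρ = ↭-trans (↭-prep p (proj₁ (proj₂ rec))) (↭-sym π)
    -- The listed codes have exactly `a` triangles, not just at most `a`, and this caps the
    -- triangles of the new row at `b`.
    tri-v≡a : tri (toList v) ≡ a
    tri-v≡a = ≡-trans (sym (nones-code v)) (All.lookup nones≡a (proj₂ (proj₂ rec)))
    tri₂≤b : tri₂ p (toList v) ≤ b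
    tri₂≤b = +-cancelˡ-≤ a _ _ (begin
      a + tri₂ p (toList v)                ≡⟨ cong (_+ tri₂ p (toList v)) tri-v≡a ⟨
      tri (toList v) + tri₂ p (toList v)   ≡⟨ +-comm (tri (toList v)) _ ⟩
      tri (p ∷ toList v)                   ≡⟨ tri-↭ ρ ⟩
      tri ps                               ≤⟨ tri≤ ⟩
      a + b                                ∎)

  fromOneOf : ∀ {n} {cs : List (Code n)} {ps} → Unique ps → Arranged ps (OneOf cs) →
              Arranged ps (_∈ cs)
  fromOneOf {cs = cs} u (v , π , one) =
    arranged-resp-↭ {P = _∈ cs} π (arranged-oneOf v (unique-resp-↭ (↭-sym π) u) one)

  classified₃ : Classified 1 codes₃
  classified₃ {p ∷ q ∷ r ∷ []} _ refl 0< _ = p ∷ q ∷ r ∷ [] , ↭-refl , here eq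
    where
    none-if : ∀ m → 0 < cost m → m ≡ none
    none-if none _ = refl
    none-if m₁ ()
    none-if m₂ ()
    none-if m₃ ()
    tri≡cost : tri (p ∷ q ∷ r ∷ []) ≡ cost (mid p q r)
    tri≡cost = begin
      tri (p ∷ q ∷ r ∷ [])                     ≡⟨ nones-code (p ∷ q ∷ r ∷ []) ⟨
      nones (code (p ∷ q ∷ r ∷ []))            ≡⟨⟩
      ((cost (mid p q r) + 0) + 0) + 0         ≡⟨ ≡-trans (+-identityʳ _) (≡-trans (+-identityʳ _) (+-identityʳ _)) ⟩
      cost (mid p q r)                         ∎
      where open ≡-Reasoning
    eq : code (p ∷ q ∷ r ∷ []) ≡ k₃
    eq = cong (λ m → ((m ∷ []) ∷ [] ∷ []) ∷ ([] ∷ []) ∷ [] ∷ []) (none-if _ (subst (0 <_) tri≡cost 0<))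

  classified₄ : Classified 1 codes₄
  classified₄ u len 0< ≤1 = fromOneOf u
    (extendClassified {a = 1} {b = 0} (OneOf codes₄) ≤-refl ≤-refl z≤n (refl ∷ []) codes₄-extend classified₃ u len 0< ≤1)

  classified₅ : Classified 1 codes₅
  classified₅ u len 0< ≤1 = fromOneOf u
    (extendClassified {a = 1} {b = 0} (OneOf codes₅) (m≤m+n 3 1) ≤-refl z≤n (refl ∷ refl ∷ []) codes₅-extend classified₄ u len 0< ≤1)

  classified₆ : Classified 2 codes₆
  classified₆ u len 0< ≤2 = fromOneOf u
    (extendClassified {a = 1} {b = 1} (OneOf codes₆) (m≤m+n 3 2) ≤-refl ≤-refl (refl ∷ refl ∷ refl ∷ []) codes₆-extend classified₅ u len 0< ≤2)

  codes₆-nones : All (λ c → nones c ≡ 2) codes₆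
  codes₆-nones = refl ∷ refl ∷ refl ∷ refl ∷ refl ∷ refl ∷ refl ∷ []

  Pair : List Carrier → Carrier → Carrier → Set
  Pair ps q r = q ≢ r × q ∈ ps × r ∈ ps ×
    (∀ {a b c} → a ∈ ps → b ∈ ps → c ∈ ps → ¬ Collinear a b c →
      q ∈ a ∷ b ∷ c ∷ [] × r ∈ a ∷ b ∷ c ∷ [])

  ∈⇒lookup : ∀ {n} {v : Vec Carrier n} {p} → p ∈ toList v → ∃ λ i → lookup v i ≡ p
  ∈⇒lookup {v = _ ∷ _} (here refl) = zero , refl
  ∈⇒lookup {v = _ ∷ v} (there p∈) with i , eq ← ∈⇒lookup {v = v} p∈ = suc i , eq

  meets : ∀ {n} (v : Vec Carrier n) → Unique (toList v) → ∀ {i} → MeetsTriangles (code v) i →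
          ∀ {a b c} → a ∈ toList v → b ∈ toList v → c ∈ toList v → ¬ Collinear a b c →
          lookup v i ∈ a ∷ b ∷ c ∷ []
  meets v u {i} m a∈ b∈ c∈ ¬c
    with j , refl ← ∈⇒lookup {v = v} a∈
       | k , refl ← ∈⇒lookup {v = v} b∈
       | l , refl ← ∈⇒lookup {v = v} c∈ = go (m j k l j≢k j≢l k≢l none≡)
    where
    j≢k : j ≢ k
    j≢k refl = ¬c collinear-refl₁₂
    j≢l : j ≢ l
    j≢l refl = ¬c collinear-refl₁₃
    k≢l : k ≢ l
    k≢l refl = ¬c collinear-refl₂₃
    none≡ : codeAt (code v) j k l ≡ none
    none≡ = ≡-trans (codeAt-code u j≢k j≢l k≢l) (mid≡ (distinct u j≢k j≢l k≢l) (isₙ ¬c))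
    go : i ≡ j ⊎ i ≡ k ⊎ i ≡ l → lookup v i ∈ lookup v j ∷ lookup v k ∷ lookup v l ∷ []
    go (inj₁ refl)        = here refl
    go (inj₂ (inj₁ refl)) = there (here refl)
    go (inj₂ (inj₂ refl)) = there (there (here refl))

  pair-intro : ∀ {n b} (v : Vec Carrier n) → Unique (toList v) → Paired b (code v) →
               ∃ λ q → ∃ λ r → Pair (toList v) q r
  pair-intro v u (paired _ (i , mi , j , i≢j , mj)) =
    lookup v i , lookup v j , i≢j ∘ unique⇒injective v u i j ,
    lookup∈toList v i , lookup∈toList v j ,
    λ a∈ b∈ c∈ ¬c → meets v u mi a∈ b∈ c∈ ¬c , meets v u mj a∈ b∈ c∈ ¬c

  pair-resp-↭ : ∀ {ps qs q r} → ps ↭ qs → Pair ps q r → Pair qs q r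
  pair-resp-↭ π (q≢r , q∈ , r∈ , meets) = q≢r , ∈-resp-↭ π q∈ , ∈-resp-↭ π r∈ ,
    λ a∈ b∈ c∈ → meets (∈-resp-↭ (↭-sym π) a∈) (∈-resp-↭ (↭-sym π) b∈) (∈-resp-↭ (↭-sym π) c∈)

  -- The upper bound is turned into an equality, so that the induction proves the lower bound on the
  -- co-size along with the pair.
  HasPair : ℕ → Set
  HasPair n = ∀ {ps} → Unique ps → length ps ≡ n → 0 < tri ps → tri ps ≤ n ∸ 4 →
              tri ps ≡ n ∸ 4 × ∃ λ q → ∃ λ r → Pair ps q r

  hasPair₇ : HasPair 7
  hasPair₇ {ps} u len 0< ≤3 = fromArranged
    (extendClassified {a = 2} {b = 1} (Paired 3) (m≤m+n 3 3) (m≤m+n 1 1) ≤-refl codes₆-nones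
      codes₆-paired classified₆ u len 0< ≤3)
    where
    fromArranged : Arranged ps (Paired 3) → tri ps ≡ 3 × ∃ λ q → ∃ λ r → Pair ps q r
    fromArranged (v , π , pr) =
      let q , r , pair = pair-intro v (unique-resp-↭ (↭-sym π) u) pr
      in ≡-trans (sym (tri-↭ π)) (≡-trans (sym (nones-code v)) (Paired.nones≡ pr)) ,
         q , r , pair-resp-↭ π pair

-- All triangles share two points

module TrianglePairs (B : BetweennessStructure) where
  open Classification B public
  open Finite finite using (_≟ᶠ_)
  open DecMembership _≟ᶠ_ using (_∈?_)

  triangle-≢₁₃ : ∀ {p q r} → ¬ Collinear p q r → p ≢ r
  triangle-≢₁₃ ¬c refl = ¬c collinear-refl₁₃

  triangle-≢₂₃ : ∀ {p q r} → ¬ Collinear p q r → q ≢ r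
  triangle-≢₂₃ ¬c refl = ¬c collinear-refl₂₃

  tri₁>0 : ∀ {p q r rs} → ¬ Collinear p q r → r ∈ rs → 0 < tri₁ p q rs
  tri₁>0 {p} {q} ¬c r∈ with rs′ , π ← pull r∈ =
    subst (0 <_) (sym (≡-trans (tri₁-↭ π) (cong (_+ tri₁ p q rs′) (t≡1 ¬c)))) z<s

  tri₂>0 : ∀ {p q r qs} → ¬ Collinear p q r → q ∈ qs → r ∈ qs → 0 < tri₂ p qs
  tri₂>0 {p} {q} {r} ¬c q∈ r∈ with qs′ , π ← pull q∈ =
    subst (0 <_) (sym (tri₂-↭ π))
      (≤-trans (tri₁>0 ¬c (pull-other π r≢q r∈)) (m≤m+n _ (tri₂ p qs′)))
    where
    r≢q : r ≢ q
    r≢q refl = ¬c collinear-refl₂₃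

  -- If `u` were neither `a` nor `b`, then p u v would be counted in `tri₁ p u` and p a b in the
  -- remaining summand, two triangles at `p`.
  only-triangle : ∀ {p u v a b qs} → tri₂ p qs ≡ 1 → ¬ Collinear p u v → u ∈ qs → v ∈ qs →
                  ¬ Collinear p a b → a ∈ qs → b ∈ qs → u ∈ a ∷ b ∷ []
  only-triangle {p} {u} {v} {a} {b} {qs} one ¬puv u∈ v∈ ¬pab a∈ b∈ with u ∈? a ∷ b ∷ []
  ... | yes u∈ab = u∈ab
  ... | no u∉ab with qs′ , π ← pull u∈ = contradiction one (>⇒≢ (begin-strict
    1                         <⟨ +-mono-≤ (tri₁>0 ¬puv (pull-other π v≢u v∈))
                                  (tri₂>0 ¬pab (pull-other π (u∉ab ∘ here ∘ sym) a∈)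
                                               (pull-other π (u∉ab ∘ there ∘ here ∘ sym) b∈)) ⟩
    tri₁ p u qs′ + tri₂ p qs′ ≡⟨ tri₂-↭ π ⟨
    tri₂ p qs                 ∎))
    where
    open ≤-Reasoning
    v≢u : v ≢ u
    v≢u refl = ¬puv collinear-refl₂₃

  tri₁-suc : ∀ {p q k} rs → tri₁ p q rs ≡ suc k →
             ∃ λ r → ∃ λ rs′ → rs ↭ r ∷ rs′ × ¬ Collinear p q r × tri₁ p q rs′ ≡ k
  tri₁-suc {p} {q} rs eq with r , rs′ , π , ¬c ← tri₁>0⇒ rs (subst (0 <_) (sym eq) z<s) =
    r , rs′ , π , ¬c ,
    suc-injective (≡-trans (cong (_+ tri₁ p q rs′) (sym (t≡1 ¬c))) (≡-trans (sym (tri₁-↭ π)) eq))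

  among : ∀ {s a b c : Carrier} {L} → a ∈ L → b ∈ L → c ∈ L → s ∈ a ∷ b ∷ c ∷ [] → s ∈ L
  among a∈ b∈ c∈ (here refl)                 = a∈
  among a∈ b∈ c∈ (there (here refl))         = b∈
  among a∈ b∈ c∈ (there (there (here refl))) = c∈

  linear-if : ∀ {ps s L} → (∀ {a b c} → a ∈ ps → b ∈ ps → c ∈ ps → ¬ Collinear a b c → s ∈ a ∷ b ∷ c ∷ []) →
              (∀ {a} → a ∈ L → a ∈ ps) → All (s ≢_) L → Linear L
  linear-if meets ⊆ps s∉ {a} {b} {c} a∈ b∈ c∈ = decidable-stable (collinear? a b c) λ ¬c →
    All.lookup s∉ (among a∈ b∈ c∈ (meets (⊆ps a∈) (⊆ps b∈) (⊆ps c∈) ¬c)) refl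

  -- A triangle among `q ∷ rs` would miss `r`, one among `r ∷ rs` would miss `q`.
  pair-linear : ∀ {ps q r rs} → Unique ps → Pair ps q r → ps ↭ q ∷ r ∷ rs →
                Linear (q ∷ rs) × Linear (r ∷ rs)
  pair-linear {ps} {q} {r} {rs} u (q≢r , _ , _ , meets) π
    with (_ ∷ q∉) ∷ r∉ ∷ _ ← unique-resp-↭ π u =
    linear-if (λ a∈ b∈ c∈ ¬c → proj₂ (meets a∈ b∈ c∈ ¬c))
      (λ { (here eq) → ∈-resp-↭ (↭-sym π) (here eq) ; (there a∈) → ∈-resp-↭ (↭-sym π) (there (there a∈)) })
      ((q≢r ∘ sym) ∷ r∉) ,
    linear-if (λ a∈ b∈ c∈ ¬c → proj₁ (meets a∈ b∈ c∈ ¬c))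
      (λ a∈ → ∈-resp-↭ (↭-sym π) (there a∈)) (q≢r ∷ q∉)

  pair-remove : ∀ {ps q r} → Pair ps q r → ∃ λ rs → ps ↭ q ∷ r ∷ rs
  pair-remove (q≢r , q∈ , r∈ , _) =
    let _ , π = pull q∈
        _ , ρ = pull (pull-other π (q≢r ∘ sym) r∈)
    in _ , ↭-trans π (↭-prep _ ρ)

  -- Once the point is removed, the triangles of q and r with w₁ and w₂ determine the pair of the rest.
  record Removable (qs : List Carrier) (q r u v : Carrier) : Set where
    field
      {point w₁ w₂} : Carrier
      {rest}        : List Carrier
      removal       : qs ↭ point ∷ rest
      point∉        : point ≢ u × point ≢ v
      triangle      : ¬ Collinear q r point
      w₁∈           : w₁ ∈ rest
      w₂∈           : w₂ ∈ rest
      w₁≢w₂         : w₁ ≢ w₂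
      triangle₁     : ¬ Collinear q r w₁
      triangle₂     : ¬ Collinear q r w₂

  -- This is where three triangles are required: all of them contain `q` and `r`, so they have three
  -- different third corners, and `u` and `v` cover at most two of these. The remaining one can be
  -- deleted, and the other two serve as `w₁` and `w₂`.
  removable : ∀ {qs q r k} u v → Unique qs → Pair qs q r → tri qs ≡ 3 + k → Removable qs q r u v
  removable {qs} {q} {r} u v uq pair eq
    with rs , π ← pair-remove pair
    with lq , lr ← pair-linear uq pair π
    with a , as , ρ , ¬a , eqa ← tri₁-suc rs (≡-trans (sym (tri-linear lq lr)) (≡-trans (sym (tri-↭ π)) eq))
    with b , bs , σ , ¬b , eqb ← tri₁-suc as eqa
    with c , cs , τ , ¬c , _ ← tri₁-suc bs eqb
    with _ ∷ _ ∷ ((a≢b ∷ a≢c ∷ _) ∷ (b≢c ∷ _) ∷ _) ← unique-resp-↭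
      (↭-trans π (↭-prep q (↭-prep r (↭-trans ρ (↭-prep a (↭-trans σ (↭-prep b τ))))))) uq
    = choose (a ∈? u ∷ v ∷ []) (b ∈? u ∷ v ∷ []) (c ∈? u ∷ v ∷ [])
    where
    whole : qs ↭ q ∷ r ∷ a ∷ b ∷ c ∷ cs
    whole = ↭-trans π (↭-prep q (↭-prep r (↭-trans ρ (↭-prep a (↭-trans σ (↭-prep b τ))))))
    take : ∀ {w w₁ w₂ ws} → q ∷ r ∷ a ∷ b ∷ c ∷ cs ↭ q ∷ r ∷ w ∷ w₁ ∷ w₂ ∷ ws → ¬ (w ∈ u ∷ v ∷ []) →
           w₁ ≢ w₂ → ¬ Collinear q r w → ¬ Collinear q r w₁ → ¬ Collinear q r w₂ → Removable qs q r u v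
    take {w} {w₁} {w₂} ω w∉ w₁≢w₂ ¬w ¬w₁ ¬w₂ = record
      { removal   = ↭-trans whole (↭-trans ω (shift w (q ∷ r ∷ []) _))
      ; point∉    = w∉ ∘ here , w∉ ∘ there ∘ here
      ; triangle  = ¬w
      ; w₁∈       = there (there (here refl))
      ; w₂∈       = there (there (there (here refl)))
      ; w₁≢w₂     = w₁≢w₂
      ; triangle₁ = ¬w₁
      ; triangle₂ = ¬w₂
      }
    no-room : ∀ {a b c : Carrier} → a ≢ b → a ≢ c → b ≢ c → a ∈ u ∷ v ∷ [] → b ∈ u ∷ v ∷ [] → ¬ (c ∈ u ∷ v ∷ [])
    no-room a≢b a≢c b≢c (here refl) (here refl) _                          = a≢b refl
    no-room a≢b a≢c b≢c (here refl) (there (here refl)) (here refl)         = a≢c refl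
    no-room a≢b a≢c b≢c (here refl) (there (here refl)) (there (here refl)) = b≢c refl
    no-room a≢b a≢c b≢c (there (here refl)) (there (here refl)) _           = a≢b refl
    no-room a≢b a≢c b≢c (there (here refl)) (here refl) (here refl)         = b≢c refl
    no-room a≢b a≢c b≢c (there (here refl)) (here refl) (there (here refl)) = a≢c refl
    choose : Dec (a ∈ u ∷ v ∷ []) → Dec (b ∈ u ∷ v ∷ []) → Dec (c ∈ u ∷ v ∷ []) → Removable qs q r u v
    choose (no a∉) _ _ = take ↭-refl a∉ b≢c ¬a ¬b ¬c
    choose _ (no b∉) _ = take (↭-prep q (↭-prep r (↭-swap a b ↭-refl))) b∉ a≢c ¬b ¬a ¬c
    choose _ _ (no c∉) = take (↭-prep q (↭-prep r (↭-trans (↭-prep a (↭-swap b c ↭-refl)) (↭-swap a c ↭-refl))))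
      c∉ a≢b ¬c ¬a ¬b
    choose (yes a∈) (yes b∈) (yes c∈) = contradiction c∈ (no-room a≢b a≢c b≢c a∈ b∈)

  common-to-both : ∀ {s q r w₁ w₂ : Carrier} → w₁ ≢ w₂ → s ∈ q ∷ r ∷ w₁ ∷ [] → s ∈ q ∷ r ∷ w₂ ∷ [] →
                   s ≡ q ⊎ s ≡ r
  common-to-both w≢ (here eq) _ = inj₁ eq
  common-to-both w≢ (there (here eq)) _ = inj₂ eq
  common-to-both w≢ _ (here eq) = inj₁ eq
  common-to-both w≢ _ (there (here eq)) = inj₂ eq
  common-to-both w≢ (there (there (here refl))) (there (there (here refl))) = contradiction refl w≢

  -- By `only-triangle` every triangle at `p` has the corners `p`, `u`, `v`, and two of these are
  -- `q` and `r`.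
  pair-extend : ∀ {p q r u v ps qs} → Unique ps → ps ↭ p ∷ qs → Pair qs q r → tri₂ p qs ≡ 1 →
                ¬ Collinear p u v → u ∈ qs → v ∈ qs → q ∈ u ∷ v ∷ [] → r ∈ u ∷ v ∷ [] → Pair ps q r
  pair-extend {p} {q} {r} {u} {v} {ps} {qs} up π (q≢r , q∈ , r∈ , meets) one ¬puv u∈ v∈ q∈uv r∈uv =
    q≢r , ∈-resp-↭ (↭-sym π) (there q∈) , ∈-resp-↭ (↭-sym π) (there r∈) ,
    λ a∈ b∈ c∈ → go (∈-resp-↭ π a∈) (∈-resp-↭ π b∈) (∈-resp-↭ π c∈)
    where
    transfer : ∀ {s b c} → ¬ Collinear p b c → b ∈ qs → c ∈ qs → s ∈ u ∷ v ∷ [] → s ∈ b ∷ c ∷ []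
    transfer ¬pbc b∈ c∈ (here refl) = only-triangle one ¬puv u∈ v∈ ¬pbc b∈ c∈
    transfer ¬pbc b∈ c∈ (there (here refl)) =
      only-triangle one (¬puv ∘ collinear-swap₂₃) v∈ u∈ ¬pbc b∈ c∈
    both : ∀ {b c} → ¬ Collinear p b c → b ∈ qs → c ∈ qs → q ∈ b ∷ c ∷ [] × r ∈ b ∷ c ∷ []
    both ¬pbc b∈ c∈ = transfer ¬pbc b∈ c∈ q∈uv , transfer ¬pbc b∈ c∈ r∈uv
    weaken : ∀ {s o b c : Carrier} → s ∈ b ∷ c ∷ [] → s ∈ b ∷ o ∷ c ∷ []
    weaken (here eq)          = here eq
    weaken (there (here eq))  = there (there (here eq))
    weaken₃ : ∀ {s o b c : Carrier} → s ∈ b ∷ c ∷ [] → s ∈ b ∷ c ∷ o ∷ []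
    weaken₃ (here eq)          = here eq
    weaken₃ (there (here eq))  = there (here eq)
    go : ∀ {a b c} → a ∈ p ∷ qs → b ∈ p ∷ qs → c ∈ p ∷ qs → ¬ Collinear a b c →
         q ∈ a ∷ b ∷ c ∷ [] × r ∈ a ∷ b ∷ c ∷ []
    go (there a∈) (there b∈) (there c∈) ¬c = meets a∈ b∈ c∈ ¬c
    go (here refl) (there b∈) (there c∈) ¬c = let q∈′ , r∈′ = both ¬c b∈ c∈ in there q∈′ , there r∈′
    go (there a∈) (here refl) (there c∈) ¬c =
      let q∈′ , r∈′ = both (¬c ∘ collinear-swap₁₂) a∈ c∈ in weaken q∈′ , weaken r∈′
    go (there a∈) (there b∈) (here refl) ¬c =
      let q∈′ , r∈′ = both (¬c ∘ collinear-swap₂₃ ∘ collinear-swap₁₂) a∈ b∈ in weaken₃ q∈′ , weaken₃ r∈′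
    go (here refl) (here refl) _ ¬c = contradiction collinear-refl₁₂ ¬c
    go (here refl) _ (here refl) ¬c = contradiction collinear-refl₁₃ ¬c
    go _ (here refl) (here refl) ¬c = contradiction collinear-refl₂₃ ¬c

  exchange : ∀ {a b c d : Carrier} → a ≢ b → a ≡ c ⊎ a ≡ d → b ≡ c ⊎ b ≡ d →
             (c ≡ a ⊎ c ≡ b) × (d ≡ a ⊎ d ≡ b)
  exchange a≢b (inj₁ refl) (inj₁ refl) = contradiction refl a≢b
  exchange a≢b (inj₁ refl) (inj₂ refl) = inj₁ refl , inj₂ refl
  exchange a≢b (inj₂ refl) (inj₁ refl) = inj₂ refl , inj₁ refl
  exchange a≢b (inj₂ refl) (inj₂ refl) = contradiction refl a≢b

  -- The pair of the structure without the removable point is forced to be q and r by two old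
  -- triangles, and it lies in the new triangle.
  same-pair : ∀ {p q r u v qs} (R : Removable qs q r u v) {q′ r′} →
              p ∉ qs → q ∈ qs → r ∈ qs → u ∈ qs → v ∈ qs → ¬ Collinear p u v →
              Pair (p ∷ Removable.rest R) q′ r′ → q ∈ u ∷ v ∷ [] × r ∈ u ∷ v ∷ []
  same-pair {p} {q} {r} {u} {v} {qs} R {q′} {r′} p∉ q∈qs r∈qs u∈ v∈ ¬puv (q′≢r′ , _ , _ , meetsL) =
    old q∈qs (inside (proj₁ exchanged)) , old r∈qs (inside (proj₂ exchanged))
    where
    open Removable R
    q∈ : q ∈ rest
    q∈ = pull-other removal (triangle-≢₁₃ triangle) q∈qs
    r∈ : r ∈ rest
    r∈ = pull-other removal (triangle-≢₂₃ triangle) r∈qs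
    meet₁ = meetsL (there q∈) (there r∈) (there w₁∈) triangle₁
    meet₂ = meetsL (there q∈) (there r∈) (there w₂∈) triangle₂
    meetₚ = meetsL (here refl) (there (pull-other removal (proj₁ point∉ ∘ sym) u∈))
      (there (pull-other removal (proj₂ point∉ ∘ sym) v∈)) ¬puv
    old : ∀ {s} → s ∈ qs → s ∈ p ∷ u ∷ v ∷ [] → s ∈ u ∷ v ∷ []
    old s∈ (there s∈uv) = s∈uv
    old s∈ (here refl)  = contradiction s∈ p∉
    inside : ∀ {s} → s ≡ q′ ⊎ s ≡ r′ → s ∈ p ∷ u ∷ v ∷ []
    inside (inj₁ refl) = proj₁ meetₚ
    inside (inj₂ refl) = proj₂ meetₚ
    exchanged = exchange q′≢r′ (common-to-both w₁≢w₂ (proj₁ meet₁) (proj₁ meet₂))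
                               (common-to-both w₁≢w₂ (proj₂ meet₁) (proj₂ meet₂))

  -- The hypothesis is used a second time, now for the list that contains `p` but lacks `point`. It
  -- still holds p u v and the triangles of `q` and `r` with `w₁` and `w₂`.
  pair-step : ∀ {d p q r u v qs} → HasPair (7 + d) → Unique (p ∷ qs) → length qs ≡ 7 + d →
              tri (p ∷ qs) ≤ 4 + d → tri₂ p qs ≡ 1 → Pair qs q r → ¬ Collinear p u v → u ∈ qs → v ∈ qs →
              Removable qs q r u v → Pair (p ∷ qs) q r
  pair-step {d} {p} {q} {r} {u} {v} {qs} IH up@(p≢ ∷ _) len ≤4+d one pair@(_ , q∈ , r∈ , _) ¬puv u∈ v∈ R =
    fromIH (IH uL (suc-injective (≡-trans (sym (↭-length ρ)) (cong suc len)))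
      (¬collinear⇒tri>0 triangle₁ (there q∈′) (there r∈′) (there w₁∈)) L≤)
    where
    open ≤-Reasoning
    open Removable R
    q∈′ : q ∈ rest
    q∈′ = pull-other removal (triangle-≢₁₃ triangle) q∈
    r∈′ : r ∈ rest
    r∈′ = pull-other removal (triangle-≢₂₃ triangle) r∈
    L : List Carrier
    L = p ∷ rest
    ρ : p ∷ qs ↭ point ∷ L
    ρ = ↭-trans (↭-prep p removal) (↭-swap p point ↭-refl)
    uL : Unique L
    uL with _ ∷ u ← unique-resp-↭ ρ up = u
    -- `point` forms a triangle with `q` and `r`, so its deletion loses at least one.
    L≤ : tri L ≤ 3 + d
    L≤ = s≤s⁻¹ (begin
      suc (tri L)             ≤⟨ +-monoˡ-≤ (tri L) (tri₂>0
                                   (triangle ∘ collinear-swap₂₃ ∘ collinear-swap₁₂) (there q∈′) (there r∈′)) ⟩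
      tri₂ point L + tri L    ≡⟨ tri-↭ ρ ⟨
      tri (p ∷ qs)            ≤⟨ ≤4+d ⟩
      4 + d                   ∎)
    p∉ : p ∉ qs
    p∉ p∈ = All.lookup p≢ p∈ refl
    fromIH : tri L ≡ 3 + d × (∃ λ q′ → ∃ λ r′ → Pair L q′ r′) → Pair (p ∷ qs) q r
    fromIH (_ , _ , _ , pairL) =
      let q∈uv , r∈uv = same-pair R p∉ q∈ r∈ u∈ v∈ ¬puv pairL
      in pair-extend up ↭-refl pair one ¬puv u∈ v∈ q∈uv r∈uv

  hasPair-∷ : ∀ {d p qs} → HasPair (7 + d) → Unique (p ∷ qs) → length qs ≡ 7 + d →
              0 < tri qs → tri (p ∷ qs) ≤ 4 + d → tri (p ∷ qs) ≡ 1 ⊎ 0 < tri₂ p qs →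
              tri (p ∷ qs) ≡ 4 + d × ∃ λ q → ∃ λ r → Pair (p ∷ qs) q r
  hasPair-∷ {d} {p} {qs} IH up@(_ ∷ uq) len 0<qs ≤4+d alt =
    fromIH (IH uq len 0<qs (qs≤ alt))
    where
    open ≤-Reasoning
    qs≤ : tri (p ∷ qs) ≡ 1 ⊎ 0 < tri₂ p qs → tri qs ≤ 3 + d
    qs≤ (inj₁ eq) = ≤-trans (m≤n+m _ (tri₂ p qs)) (≤-trans (≤-reflexive eq) (m≤m+n 1 (2 + d)))
    qs≤ (inj₂ 0<) = s≤s⁻¹ (≤-trans (+-monoˡ-≤ (tri qs) 0<) ≤4+d)
    fromIH : tri qs ≡ 3 + d × (∃ λ q → ∃ λ r → Pair qs q r) →
             tri (p ∷ qs) ≡ 4 + d × ∃ λ q → ∃ λ r → Pair (p ∷ qs) q r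
    fromIH (eq , q , r , pair) = cong₂ _+_ one eq , q , r , newPair (tri₂>0⇒ qs (0<tri₂ alt))
      where
      0<tri₂ : tri (p ∷ qs) ≡ 1 ⊎ 0 < tri₂ p qs → 0 < tri₂ p qs
      0<tri₂ (inj₂ 0<) = 0<
      -- A single triangle is impossible, as already `qs` has at least three.
      0<tri₂ (inj₁ eq₁) = contradiction
        (begin
          3                      ≤⟨ m≤m+n 3 d ⟩
          3 + d                  ≡⟨ eq ⟨
          tri qs                 ≤⟨ m≤n+m _ (tri₂ p qs) ⟩
          tri (p ∷ qs)           ≡⟨ eq₁ ⟩
          1                      ∎)
        λ { (s≤s ()) }
      one : tri₂ p qs ≡ 1
      one = ≤-antisym
        (+-cancelʳ-≤ (3 + d) _ 1 (begin
          tri₂ p qs + (3 + d)  ≡⟨ cong (tri₂ p qs +_) eq ⟨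
          tri (p ∷ qs)         ≤⟨ ≤4+d ⟩
          4 + d                ∎))
        (0<tri₂ alt)
      newPair : (∃ λ u → ∃ λ v → ∃ λ rs → qs ↭ u ∷ v ∷ rs × ¬ Collinear p u v) → Pair (p ∷ qs) q r
      newPair (u , v , rs , σ , ¬puv) = pair-step IH up len ≤4+d one pair ¬puv
        (∈-resp-↭ (↭-sym σ) (here refl)) (∈-resp-↭ (↭-sym σ) (there (here refl)))
        (removable u v uq pair eq)

  hasPair : ∀ d → HasPair (7 + d)
  hasPair zero = hasPair₇
  hasPair (suc d) {ps} up len 0<ps ps≤ =
    go (pick ps (subst (4 ≤_) (sym len) (m≤m+n 4 (4 + d))) 0<ps)
    where
    go : (∃ λ p → ∃ λ qs → ps ↭ p ∷ qs × 0 < tri qs × (tri ps ≡ 1 ⊎ 0 < tri₂ p qs)) →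
         tri ps ≡ 4 + d × ∃ λ q → ∃ λ r → Pair ps q r
    go (p , qs , π , 0<qs , alt) = restore (hasPair-∷ (hasPair d) (unique-resp-↭ π up)
      (suc-injective (≡-trans (sym (↭-length π)) len)) 0<qs
      (≤-trans (≤-reflexive (sym (tri-↭ π))) ps≤)
      (Sum.map₁ (≡-trans (sym (tri-↭ π))) alt))
      where
      restore : tri (p ∷ qs) ≡ 4 + d × (∃ λ q → ∃ λ r → Pair (p ∷ qs) q r) →
                tri ps ≡ 4 + d × ∃ λ q → ∃ λ r → Pair ps q r
      restore (eq , q , r , pair) = ≡-trans (tri-↭ π) eq , q , r , pair-resp-↭ (↭-sym π) pair

-- Co-size and isomorphisms

Σᶠ : ∀ {n} → (Fin n → ℕ) → ℕ
Σᶠ {zero}  f = 0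
Σᶠ {suc n} f = f zero + Σᶠ (f ∘ suc)

Σᶠ-cong : ∀ {n} {f g : Fin n → ℕ} → (∀ i → f i ≡ g i) → Σᶠ f ≡ Σᶠ g
Σᶠ-cong {zero}  eq = refl
Σᶠ-cong {suc n} eq = cong₂ _+_ (eq zero) (Σᶠ-cong (eq ∘ suc))

Σᶠ-zero : ∀ {n} {f : Fin n → ℕ} → (∀ i → f i ≡ 0) → Σᶠ f ≡ 0
Σᶠ-zero {zero}  eq = refl
Σᶠ-zero {suc n} eq = cong₂ _+_ (eq zero) (Σᶠ-zero (eq ∘ suc))

𝟙-cong : ∀ {P Q : Set} (P? : Dec P) (Q? : Dec Q) → (P → Q) → (Q → P) → 𝟙 P? ≡ 𝟙 Q?
𝟙-cong (yes _) (yes _) _ _ = refl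
𝟙-cong (no _)  (no _)  _ _ = refl
𝟙-cong (yes p) (no ¬q) f _ = contradiction (f p) ¬q
𝟙-cong (no ¬p) (yes q) _ g = contradiction (g q) ¬p

length-filter-tabulate : ∀ {A : Set} {P : A → Set} (P? : ∀ a → Dec (P a)) {n} (f : Fin n → A) →
                         length (filter P? (List.tabulate f)) ≡ Σᶠ (λ i → 𝟙 (P? (f i)))
length-filter-tabulate P? {zero}  f = refl
length-filter-tabulate P? {suc n} f with P? (f zero)
... | yes _ = cong suc (length-filter-tabulate P? (f ∘ suc))
... | no _  = length-filter-tabulate P? (f ∘ suc)

length-filter-map : ∀ {A A′ : Set} {P : A → Set} (P? : ∀ a → Dec (P a)) (f : A′ → A) as →
                    length (filter P? (List.map f as)) ≡ length (filter (λ a → P? (f a)) as)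
length-filter-map P? f []       = refl
length-filter-map P? f (a ∷ as) with P? (f a)
... | yes _ = cong suc (length-filter-map P? f as)
... | no _  = length-filter-map P? f as

length-filter-product : ∀ {A A′ : Set} {P : A × A′ → Set} (P? : ∀ a → Dec (P a)) {n} (f : Fin n → A) as →
  length (filter P? (cartesianProduct (List.tabulate f) as)) ≡
  Σᶠ (λ i → length (filter (λ a → P? (f i , a)) as))
length-filter-product P? {zero}  f as = refl
length-filter-product P? {suc n} f as = begin
  length (filter P? (List.map (f zero ,_) as List.++ rest))
    ≡⟨ cong length (filter-++ P? (List.map (f zero ,_) as) rest) ⟩
  length (filter P? (List.map (f zero ,_) as) List.++ filter P? rest)
    ≡⟨ length-++ (filter P? (List.map (f zero ,_) as)) ⟩
  length (filter P? (List.map (f zero ,_) as)) + length (filter P? rest)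
    ≡⟨ cong₂ _+_ (length-filter-map P? (f zero ,_) as) (length-filter-product P? (f ∘ suc) as) ⟩
  length (filter (λ a → P? (f zero , a)) as) + Σᶠ (λ i → length (filter (λ a → P? (f (suc i) , a)) as)) ∎
  where
  open ≡-Reasoning
  rest = cartesianProduct (List.tabulate (f ∘ suc)) as

module Counting (B : BetweennessStructure) where
  open Triangles B
  open Finite finite

  elements : List Carrier
  elements = List.tabulate element

  element-injective : ∀ {i j} → element i ≡ element j → i ≡ j
  element-injective {i} {j} eq = ≡-trans (sym (Inverse.strictlyInverseˡ enum i))
    (≡-trans (cong index eq) (Inverse.strictlyInverseˡ enum j))

  elements-unique : Unique elements
  elements-unique = Unique.tabulate⁺ element-injective

  ∈-elements : ∀ p → p ∈ elements
  ∈-elements p = subst (_∈ elements) (element-index p) (∈-tabulate⁺ (index p))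

  Σᶠ≡tri₁ : ∀ {n p q} (e : Fin n → Carrier) → Σᶠ (λ k → t p q (e k)) ≡ tri₁ p q (List.tabulate e)
  Σᶠ≡tri₁ {zero}          e = refl
  Σᶠ≡tri₁ {suc n} {p} {q} e = cong (t p q (e zero) +_) (Σᶠ≡tri₁ (e ∘ suc))

  -- The predicate is abstract and described by two implications, because each induction step
  -- restricts it to successor indices, where the order conditions become equivalent but not
  -- identical types.
  Σᶠ≡tri₂ : ∀ {n p} (e : Fin n → Carrier) {P : Fin n → Fin n → Set} (P? : ∀ j k → Dec (P j k)) →
            (∀ j k → P j k → j Fin.< k × ¬ Collinear p (e j) (e k)) →
            (∀ j k → j Fin.< k → ¬ Collinear p (e j) (e k) → P j k) →
            Σᶠ (λ j → Σᶠ (λ k → 𝟙 (P? j k))) ≡ tri₂ p (List.tabulate e)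
  Σᶠ≡tri₂ {zero}      e P? f g = refl
  Σᶠ≡tri₂ {suc n} {p} e P? f g = cong₂ _+_
    (cong₂ _+_
      (𝟙≡0 (P? zero zero) (λ h → n≮0 (proj₁ (f zero zero h))))
      (≡-trans
        (Σᶠ-cong λ k → 𝟙-cong (P? zero (suc k)) (¬? (collinear? p (e zero) (e (suc k))))
          (λ h → proj₂ (f zero (suc k) h)) (g zero (suc k) z<s))
        (Σᶠ≡tri₁ (e ∘ suc))))
    (≡-trans
      (Σᶠ-cong λ j → cong (_+ Σᶠ (λ k → 𝟙 (P? (suc j) (suc k))))
        (𝟙≡0 (P? (suc j) zero) λ h → n≮0 (proj₁ (f (suc j) zero h))))
      (Σᶠ≡tri₂ (e ∘ suc) (λ j k → P? (suc j) (suc k))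
        (λ j k h → let j<k , ¬c = f (suc j) (suc k) h in s<s⁻¹ j<k , ¬c)
        (λ j k j<k → g (suc j) (suc k) (s<s j<k))))

  Σᶠ≡tri : ∀ {n} (e : Fin n → Carrier) {P : Fin n → Fin n → Fin n → Set} (P? : ∀ i j k → Dec (P i j k)) →
           (∀ i j k → P i j k → i Fin.< j × j Fin.< k × ¬ Collinear (e i) (e j) (e k)) →
           (∀ i j k → i Fin.< j → j Fin.< k → ¬ Collinear (e i) (e j) (e k) → P i j k) →
           Σᶠ (λ i → Σᶠ (λ j → Σᶠ (λ k → 𝟙 (P? i j k)))) ≡ tri (List.tabulate e)
  Σᶠ≡tri {zero}  e P? f g = refl
  Σᶠ≡tri {suc n} e P? f g = cong₂ _+_
    (cong₂ _+_
      (Σᶠ-zero {suc n} λ k → 𝟙≡0 (P? zero zero k) (λ h → n≮0 (proj₁ (f zero zero k h))))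
      (≡-trans
        (Σᶠ-cong λ j → cong (_+ Σᶠ (λ k → 𝟙 (P? zero (suc j) (suc k))))
          (𝟙≡0 (P? zero (suc j) zero) λ h → n≮0 (proj₁ (proj₂ (f zero (suc j) zero h)))))
        (Σᶠ≡tri₂ (e ∘ suc) (λ j k → P? zero (suc j) (suc k))
          (λ j k h → let _ , j<k , ¬c = f zero (suc j) (suc k) h in s<s⁻¹ j<k , ¬c)
          (λ j k j<k → g zero (suc j) (suc k) z<s (s<s j<k)))))
    (≡-trans
      (Σᶠ-cong λ i → cong₂ _+_
        (Σᶠ-zero {suc n} λ k → 𝟙≡0 (P? (suc i) zero k) λ h → n≮0 (proj₁ (f (suc i) zero k h)))
        (Σᶠ-cong λ j → cong (_+ Σᶠ (λ k → 𝟙 (P? (suc i) (suc j) (suc k))))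
          (𝟙≡0 (P? (suc i) (suc j) zero) λ h → n≮0 (proj₁ (proj₂ (f (suc i) (suc j) zero h))))))
      (Σᶠ≡tri (e ∘ suc) (λ i j k → P? (suc i) (suc j) (suc k))
        (λ i j k h → let i<j , j<k , ¬c = f (suc i) (suc j) (suc k) h in s<s⁻¹ i<j , s<s⁻¹ j<k , ¬c)
        (λ i j k i<j j<k → g (suc i) (suc j) (suc k) (s<s i<j) (s<s j<k))))

  coSize≡tri : coSize B ≡ tri elements
  coSize≡tri = begin
    coSize B
      ≡⟨ length-filter-product triangle? id (cartesianProduct (List.allFin (order B)) (List.allFin (order B))) ⟩
    Σᶠ (λ i → length (filter (λ jk → triangle? (i , jk))
      (cartesianProduct (List.allFin (order B)) (List.allFin (order B)))))
      ≡⟨ (Σᶠ-cong λ i → length-filter-product (λ jk → triangle? (i , jk)) id (List.allFin (order B))) ⟩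
    Σᶠ (λ i → Σᶠ (λ j → length (filter (λ k → triangle? (i , j , k)) (List.allFin (order B)))))
      ≡⟨ (Σᶠ-cong λ i → Σᶠ-cong λ j → length-filter-tabulate (λ k → triangle? (i , j , k)) id) ⟩
    Σᶠ (λ i → Σᶠ (λ j → Σᶠ (λ k → 𝟙 (triangle? (i , j , k)))))
      ≡⟨ Σᶠ≡tri element (λ i j k → triangle? (i , j , k)) (λ _ _ _ h → h) (λ _ _ _ i<j j<k ¬c → i<j , j<k , ¬c) ⟩
    tri elements ∎
    where open ≡-Reasoning

  Complete : ∀ {n} → Vec Carrier n → Set
  Complete v = toList v ↭ elements

  position : ∀ {n} {v : Vec Carrier n} → Complete v → ∀ p → ∃ λ i → lookup v i ≡ p
  position {v = v} π p = go v (∈-resp-↭ (↭-sym π) (∈-elements p))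
    where
    go : ∀ {n} (v : Vec Carrier n) → p ∈ toList v → ∃ λ i → lookup v i ≡ p
    go (_ ∷ v) (here refl) = zero , refl
    go (_ ∷ v) (there p∈) with i , eq ← go v p∈ = suc i , eq

  complete-unique : ∀ {n} {v : Vec Carrier n} → Complete v → Unique (toList v)
  complete-unique π = unique-resp-↭ (↭-sym π) elements-unique

  -- Codes say nothing about repeated points, where betweenness is forced by the axioms.
  data βAt {n} (c : Code n) (i j k : Fin n) : Set where
    left     : i ≡ j → βAt c i j k
    right    : j ≡ k → βAt c i j k
    apart    : i ≢ j → i ≢ k → j ≢ k → codeAt c i j k ≡ m₂ → βAt c i j k

  β⇒βAt : ∀ {n} {v : Vec Carrier n} → Unique (toList v) → ∀ i j k →
          β (lookup v i) (lookup v j) (lookup v k) → βAt (code v) i j k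
  β⇒βAt {v = v} u i j k b with i Fin.≟ j | j Fin.≟ k | i Fin.≟ k
  ... | yes i≡j | _       | _        = left i≡j
  ... | no _    | yes j≡k | _        = right j≡k
  ... | no i≢j  | no _    | yes refl =
    contradiction (unique⇒injective v u i j (P3 _ _ _ b (P2 _ _ _ (P1 _ _)))) i≢j
  ... | no i≢j  | no j≢k  | no i≢k   = apart i≢j i≢k j≢k
    (≡-trans (codeAt-code u i≢j i≢k j≢k) (β⇒mid≡m₂ (distinct u i≢j i≢k j≢k) b))

  βAt⇒β : ∀ {n} {v : Vec Carrier n} → Unique (toList v) → ∀ i j k → βAt (code v) i j k →
          β (lookup v i) (lookup v j) (lookup v k)
  βAt⇒β u i j k (left refl)  = P1 _ _
  βAt⇒β u i j k (right refl) = P2 _ _ _ (P1 _ _)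
  βAt⇒β u i j k (apart i≢j i≢k j≢k eq) =
    mid≡m₂⇒β (≡-trans (sym (codeAt-code u i≢j i≢k j≢k)) eq)

  locate : ∀ {n} {v : Vec Carrier n} → Complete v → Carrier ↔ Fin n
  locate {v = v} π = mk↔ₛ′ (λ p → proj₁ (position {v = v} π p)) (lookup v)
    (λ i → unique⇒injective v (complete-unique {v = v} π) _ i (proj₂ (position {v = v} π (lookup v i))))
    (λ p → proj₂ (position {v = v} π p))

same-code⇒≅ : ∀ A B {n} (v : Vec (BetweennessStructure.Carrier A) n) (w : Vec (BetweennessStructure.Carrier B) n) →
              Counting.Complete A v → Counting.Complete B w →
              Betweenness.code A v ≡ Betweenness.code B w → A ≅ B
same-code⇒≅ A B {n} v w π ρ eq = record
  { bijection = ↔-sym (B.locate {v = w} ρ) ↔-∘ A.locate {v = v} π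
  ; preserves = λ p q r → mk⇔
      (λ b → B.βAt⇒β uw (at p) (at q) (at r) (convert (A.β⇒βAt uv (at p) (at q) (at r)
        (subst₃ A′.β (sym (at-≡ p)) (sym (at-≡ q)) (sym (at-≡ r)) b))))
      (λ b → subst₃ A′.β (at-≡ p) (at-≡ q) (at-≡ r)
        (A.βAt⇒β uv (at p) (at q) (at r) (convert⁻ (B.β⇒βAt uw (at p) (at q) (at r) b))))
  }
  where
  module A = Counting A
  module B = Counting B
  module A′ = BetweennessStructure A
  uv = A.complete-unique {v = v} π
  uw = B.complete-unique {v = w} ρ
  at : A′.Carrier → Fin n
  at p = proj₁ (A.position {v = v} π p)
  at-≡ : ∀ p → lookup v (at p) ≡ p
  at-≡ p = proj₂ (A.position {v = v} π p)
  subst₃ : ∀ (R : A′.Carrier → A′.Carrier → A′.Carrier → Set) {p q r p′ q′ r′} →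
           p ≡ p′ → q ≡ q′ → r ≡ r′ → R p q r → R p′ q′ r′
  subst₃ R refl refl refl h = h
  convert : ∀ {i j k} → A.βAt (Betweenness.code A v) i j k → B.βAt (Betweenness.code B w) i j k
  convert (A.left p)           = B.left p
  convert (A.right p)          = B.right p
  convert (A.apart p q r s) = B.apart p q r (subst (λ c → codeAt c _ _ _ ≡ m₂) eq s)
  convert⁻ : ∀ {i j k} → B.βAt (Betweenness.code B w) i j k → A.βAt (Betweenness.code A v) i j k
  convert⁻ (B.left p)           = A.left p
  convert⁻ (B.right p)          = A.right p
  convert⁻ (B.apart p q r s) = A.apart p q r (subst (λ c → codeAt c _ _ _ ≡ m₂) (sym eq) s)

≅⇒order≡ : ∀ {A B} → A ≅ B → order A ≡ order B
≅⇒order≡ {A} {B} iso = ↔⇒≡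
  (Finite.enum (BetweennessStructure.finite B) ↔-∘ (_≅_.bijection iso ↔-∘
   ↔-sym (Finite.enum (BetweennessStructure.finite A))))

-- The image of one enumeration and the other enumeration are lists without repetition of the same
-- points, so they are permutations of each other, under which `tri` is invariant.
≅⇒coSize≡ : ∀ {A B} → A ≅ B → coSize A ≡ coSize B
≅⇒coSize≡ {A} {B} iso = begin
  coSize A                        ≡⟨ CA.coSize≡tri ⟩
  A.tri CA.elements               ≡⟨ tri-map CA.elements ⟩
  B.tri (List.map to CA.elements) ≡⟨ B.tri-↭ (∼bag⇒↭ (unique∧set⇒bag
                                       (Unique.map⁺ to-injective CA.elements-unique) CB.elements-unique
                                       (λ {q} → mk⇔ (λ _ → CB.∈-elements q) (λ _ → subst (_∈ List.map to CA.elements)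
                                         (strictlyInverseˡ q) (∈-map⁺ to (CA.∈-elements (from q))))))) ⟩
  B.tri CB.elements               ≡⟨ CB.coSize≡tri ⟨
  coSize B                        ∎
  where
  open ≡-Reasoning
  module CA = Counting A
  module CB = Counting B
  module A = Triangles A
  module B = Triangles B
  open _≅_ iso
  open Inverse bijection using (strictlyInverseˡ; strictlyInverseʳ)
  to-injective : ∀ {p q} → to p ≡ to q → p ≡ q
  to-injective {p} {q} eq = ≡-trans (sym (strictlyInverseʳ p)) (≡-trans (cong from eq) (strictlyInverseʳ q))
  forth : ∀ {p q r} → A.Collinear p q r → B.Collinear (to p) (to q) (to r)
  forth c with A.middle c
  ... | A.mid₁ b = B.col₁ (Equivalence.to (preserves _ _ _) b)
  ... | A.mid₂ b = B.col₂ (Equivalence.to (preserves _ _ _) b)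
  ... | A.mid₃ b = B.col₃ (Equivalence.to (preserves _ _ _) b)
  back : ∀ {p q r} → B.Collinear (to p) (to q) (to r) → A.Collinear p q r
  back c with B.middle c
  ... | B.mid₁ b = A.col₁ (Equivalence.from (preserves _ _ _) b)
  ... | B.mid₂ b = A.col₂ (Equivalence.from (preserves _ _ _) b)
  ... | B.mid₃ b = A.col₃ (Equivalence.from (preserves _ _ _) b)
  t-map : ∀ p q r → A.t p q r ≡ B.t (to p) (to q) (to r)
  t-map p q r = 𝟙-cong (¬? (A.collinear? p q r)) (¬? (B.collinear? (to p) (to q) (to r))) (_∘ back) (_∘ forth)
  tri₁-map : ∀ p q rs → A.tri₁ p q rs ≡ B.tri₁ (to p) (to q) (List.map to rs)
  tri₁-map p q []       = refl
  tri₁-map p q (r ∷ rs) = cong₂ _+_ (t-map p q r) (tri₁-map p q rs)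
  tri₂-map : ∀ p qs → A.tri₂ p qs ≡ B.tri₂ (to p) (List.map to qs)
  tri₂-map p []       = refl
  tri₂-map p (q ∷ qs) = cong₂ _+_ (tri₁-map p q qs) (tri₂-map p qs)
  tri-map : ∀ ps → A.tri ps ≡ B.tri (List.map to ps)
  tri-map []       = refl
  tri-map (p ∷ ps) = cong₂ _+_ (tri₂-map p ps) (tri-map ps)

-- Orderings and the place of a further point

-- The middle of p, vᵢ, vⱼ for i < j when p is inserted into the ordered v at position a.
slotMid : ∀ {n} → Fin (suc n) → Fin n → Fin n → Mid
slotMid a i j = if does (toℕ j <? toℕ a) then m₃ else if does (toℕ a ≤? toℕ i) then m₂ else m₁

slotMid-before : ∀ {n} {a : Fin (suc n)} {i j} → toℕ j < toℕ a → slotMid a i j ≡ m₃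
slotMid-before {a = a} {i} {j} j<a rewrite dec-true (toℕ j <? toℕ a) j<a = refl

slotMid-after : ∀ {n} {a : Fin (suc n)} {i j} → toℕ a ≤ toℕ i → i Fin.< j → slotMid a i j ≡ m₂
slotMid-after {a = a} {i} {j} a≤i i<j
  rewrite dec-false (toℕ j <? toℕ a) (≤⇒≯ (≤-trans a≤i (<⇒≤ i<j)))
        | dec-true (toℕ a ≤? toℕ i) a≤i = refl

slotMid-across : ∀ {n} {a : Fin (suc n)} {i j} → toℕ i < toℕ a → toℕ a ≤ toℕ j → slotMid a i j ≡ m₁
slotMid-across {a = a} {i} {j} i<a a≤j
  rewrite dec-false (toℕ j <? toℕ a) (≤⇒≯ a≤j)
        | dec-false (toℕ a ≤? toℕ i) (<⇒≱ i<a) = refl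

codeAt-codeBy : ∀ {A : Set} {n} {f : A → A → A → Mid} (v : Vec A n) {i j k} → i Fin.< j → j Fin.< k →
                codeAt (codeBy f v) i j k ≡ f (lookup v i) (lookup v j) (lookup v k)
codeAt-codeBy {f = f} (p ∷ v) {zero} {suc j} {suc k} _ j<k = rowAt-rowBy v (s<s⁻¹ j<k)
  where
  rowAt-rowBy : ∀ {n} (v : Vec _ n) {j k} → j Fin.< k →
                rowAt (rowBy (f p) v) j k ≡ f p (lookup v j) (lookup v k)
  rowAt-rowBy (q ∷ v) {zero}  {suc k} _   = lookup-map k (f p q) v
  rowAt-rowBy (q ∷ v) {suc j} {suc k} j<k = rowAt-rowBy v (s<s⁻¹ j<k)
codeAt-codeBy (p ∷ v) {suc i} {suc j} {suc k} i<j j<k = codeAt-codeBy v (s<s⁻¹ i<j) (s<s⁻¹ j<k)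

record Inserted {n} (c : Code (suc n)) : Set where
  constructor inserted
  field
    place : Fin (suc n)
    mids  : ∀ i j → i Fin.< j → codeAt c zero (suc i) (suc j) ≡ slotMid place i j

inserted? : ∀ {n} (c : Code (suc n)) → Dec (Inserted c)
inserted? c = map′ (λ (a , f) → inserted a f) (λ (inserted a f) → a , f)
  (Fin.any? λ a → Fin.all? λ i → Fin.all? λ j →
    i Fin.<? j →-dec (codeAt c zero (suc i) (suc j) Fin.≟ slotMid a i j))

-- The base for placing a point into an ordering. Three ordered points would not do, since a fourth
-- may close them to a 4-cycle.
path₄-inserted : Extends (path 4 ∷ []) 0 Inserted
path₄-inserted = extends (path 4 ∷ []) 0 inserted? tt

module Orders (B : BetweennessStructure) where
  open Classification B public

  β-antisym : ∀ {p q r} → p ≢ q → β p q r → ¬ β q p r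
  β-antisym p≢q b b′ = p≢q (P3 _ _ _ b b′)

  Ordered : ∀ {n} → Vec Carrier n → Set
  Ordered v = ∀ i j k → i Fin.< j → j Fin.< k → β (lookup v i) (lookup v j) (lookup v k)

  record Slot {n} (v : Vec Carrier n) (p : Carrier) (a : Fin (suc n)) : Set where
    field
      before : ∀ i j → i Fin.< j → toℕ j < toℕ a → β (lookup v i) (lookup v j) p
      across : ∀ i j → toℕ i < toℕ a → toℕ a ≤ toℕ j → β (lookup v i) p (lookup v j)
      after  : ∀ i j → toℕ a ≤ toℕ i → i Fin.< j → β p (lookup v i) (lookup v j)
  open Slot

  isMid≡ : ∀ {p q r m} → mid p q r ≡ m → IsMid p q r m
  isMid≡ {p} {q} {r} refl = isMid p q r

  slot-intro : ∀ {n} {v : Vec Carrier n} {p a} →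
               (∀ i j → i Fin.< j → mid p (lookup v i) (lookup v j) ≡ slotMid a i j) → Slot v p a
  slot-intro eq .before i j i<j j<a
    with is₃ b ← isMid≡ (≡-trans (eq i j i<j) (slotMid-before j<a)) = P2 _ _ _ b
  slot-intro eq .across i j i<a a≤j
    with is₁ b ← isMid≡ (≡-trans (eq i j (<-≤-trans i<a a≤j)) (slotMid-across i<a a≤j)) = b
  slot-intro eq .after i j a≤i i<j
    with is₂ b ← isMid≡ (≡-trans (eq i j i<j) (slotMid-after a≤i i<j)) = b

  slot-mid : ∀ {n} {v : Vec Carrier n} {p a} → Slot v p a →
             ∀ i j → i Fin.< j → IsMid p (lookup v i) (lookup v j) (slotMid a i j)
  slot-mid {a = a} s i j i<j with toℕ j <? toℕ a | toℕ a ≤? toℕ i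
  ... | yes j<a | _       =
    subst (IsMid _ _ _) (sym (slotMid-before j<a)) (is₃ (P2 _ _ _ (s .before i j i<j j<a)))
  ... | no _    | yes a≤i = subst (IsMid _ _ _) (sym (slotMid-after a≤i i<j)) (is₂ (s .after i j a≤i i<j))
  ... | no j≮a  | no a≰i  = subst (IsMid _ _ _) (sym (slotMid-across (≰⇒> a≰i) (≮⇒≥ j≮a)))
    (is₁ (s .across i j (≰⇒> a≰i) (≮⇒≥ j≮a)))

  ordered-tail : ∀ {n q} {v : Vec Carrier n} → Ordered (q ∷ v) → Ordered v
  ordered-tail o i j k i<j j<k = o (suc i) (suc j) (suc k) (s<s i<j) (s<s j<k)

  slot-tail : ∀ {n q p a} {v : Vec Carrier n} → Slot (q ∷ v) p (suc a) → Slot v p a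
  slot-tail s .before i j i<j j<a = s .before (suc i) (suc j) (s<s i<j) (s<s j<a)
  slot-tail s .across i j i<a a≤j = s .across (suc i) (suc j) (s<s i<a) (s≤s a≤j)
  slot-tail s .after i j a≤i i<j  = s .after (suc i) (suc j) (s≤s a≤i) (s<s i<j)

  lookup-insertAt : ∀ {n} {P : Carrier → Set} (v : Vec Carrier n) a {p} → P p →
                    (∀ i → P (lookup v i)) → ∀ i → P (lookup (insertAt v a p) i)
  lookup-insertAt v       zero    Pp Pv zero    = Pp
  lookup-insertAt v       zero    Pp Pv (suc i) = Pv i
  lookup-insertAt (q ∷ v) (suc a) Pp Pv zero    = Pv zero
  lookup-insertAt {P = P} (q ∷ v) (suc a) Pp Pv (suc i) = lookup-insertAt {P = P} v a Pp (Pv ∘ suc) i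

  pairs-insertAt : ∀ {n} {R : Carrier → Carrier → Set} (v : Vec Carrier n) a {p} →
                   (∀ i j → i Fin.< j → R (lookup v i) (lookup v j)) →
                   (∀ i → toℕ i < toℕ a → R (lookup v i) p) →
                   (∀ i → toℕ a ≤ toℕ i → R p (lookup v i)) →
                   ∀ i j → i Fin.< j → R (lookup (insertAt v a p) i) (lookup (insertAt v a p) j)
  pairs-insertAt v zero Rv Rvp Rpv zero    (suc j) _   = Rpv j z≤n
  pairs-insertAt v zero Rv Rvp Rpv (suc i) (suc j) i<j = Rv i j (s<s⁻¹ i<j)
  pairs-insertAt {R = R} (q ∷ v) (suc a) Rv Rvp Rpv zero (suc j) _ =
    lookup-insertAt {P = R q} v a (Rvp zero z<s) (λ i → Rv zero (suc i) z<s) j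
  pairs-insertAt {R = R} (q ∷ v) (suc a) Rv Rvp Rpv (suc i) (suc j) i<j =
    pairs-insertAt {R = R} v a (λ i j i<j → Rv (suc i) (suc j) (s<s i<j)) (λ i i<a → Rvp (suc i) (s<s i<a))
      (λ i a≤i → Rpv (suc i) (s≤s a≤i)) i j (s<s⁻¹ i<j)

  ordered-insertAt : ∀ {n} (v : Vec Carrier n) a {p} → Ordered v → Slot v p a → Ordered (insertAt v a p)
  ordered-insertAt v zero o s zero (suc j) (suc k) _ j<k = s .after j k z≤n (s<s⁻¹ j<k)
  ordered-insertAt v zero o s (suc i) (suc j) (suc k) i<j j<k = o i j k (s<s⁻¹ i<j) (s<s⁻¹ j<k)
  ordered-insertAt (q ∷ v) (suc a) o s zero (suc j) (suc k) _ j<k =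
    pairs-insertAt {R = β q} v a (λ i j i<j → o zero (suc i) (suc j) z<s (s<s i<j))
      (λ i i<a → s .before zero (suc i) z<s (s<s i<a)) (λ i a≤i → s .across zero (suc i) z<s (s≤s a≤i))
      j k (s<s⁻¹ j<k)
  ordered-insertAt (q ∷ v) (suc a) o s (suc i) (suc j) (suc k) i<j j<k =
    ordered-insertAt v a (ordered-tail {q = q} {v} o) (slot-tail s) i j k (s<s⁻¹ i<j) (s<s⁻¹ j<k)

  ordered⇒path : ∀ {n} {v : Vec Carrier n} → Unique (toList v) → Ordered v → code v ≡ path n
  ordered⇒path {n} {v} u o = codeBy-cong v (allFin n) λ i j k i<j j<k →
    β⇒mid≡m₂ (distinct u (Fin.<⇒≢ i<j) (Fin.<⇒≢ (Fin.<-trans i<j j<k)) (Fin.<⇒≢ j<k)) (o i j k i<j j<k)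

  path⇒ordered : ∀ {n} {v : Vec Carrier n} → code v ≡ path n → Ordered v
  path⇒ordered {n} {v} eq i j k i<j j<k = mid≡m₂⇒β (begin
    mid (lookup v i) (lookup v j) (lookup v k)  ≡⟨ codeAt-codeBy {f = mid} v i<j j<k ⟨
    codeAt (code v) i j k                       ≡⟨ cong (λ c → codeAt c i j k) eq ⟩
    codeAt (path n) i j k                       ≡⟨ codeAt-codeBy (allFin n) i<j j<k ⟩
    m₂                                          ∎)
    where open ≡-Reasoning

  extendLinear : ∀ {n p} {v : Vec Carrier n} {cs : List (Code n)} {P} → Extends cs 0 P →
                 Unique (p ∷ toList v) → Linear (p ∷ toList v) → code v ∈ cs → P (code (p ∷ v))
  extendLinear {p = p} {v} ext u lin v∈ = Extends.extend ext v∈ (rowBy (mid p) v) (fitsRow-mid v u)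
    (≤-reflexive (≡-trans (nonesʳ-mid p v) (m+n≡0⇒m≡0 (tri₂ p (toList v)) (linear⇒tri≡0 lin))))

  slot₄ : ∀ {p} (v : Vec Carrier 4) → Ordered v → Unique (p ∷ toList v) → Linear (p ∷ toList v) →
          ∃ (Slot v p)
  slot₄ {p} v o u@(_ ∷ u′) lin = fromInserted (extendLinear {v = v} path₄-inserted u lin (here (ordered⇒path u′ o)))
    where
    fromInserted : Inserted (code (p ∷ v)) → ∃ (Slot v p)
    fromInserted (inserted a eq) = a , slot-intro λ i j i<j →
      ≡-trans (sym (codeAt-codeBy {f = mid} (p ∷ v) z<s (s<s i<j))) (eq i j i<j)

  linear-⊆ : ∀ {ps qs} → (∀ {s} → s ∈ ps → s ∈ qs) → Linear qs → Linear ps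
  linear-⊆ ⊆ lin p∈ q∈ r∈ = lin (⊆ p∈) (⊆ q∈) (⊆ r∈)

  module _ {m} (v : Vec Carrier (3 + m)) {p q}
           (o : Ordered (q ∷ v)) (u : Unique (p ∷ q ∷ toList v)) (lin : Linear (p ∷ q ∷ toList v)) where
    private
      at : Fin (3 + m) → Carrier
      at = lookup v

      at-≢ : ∀ {i j} → i ≢ j → at i ≢ at j
      at-≢ i≢j = i≢j ∘ unique⇒injective v (AllPairs.tail (AllPairs.tail u)) _ _

      q≢at : ∀ i → q ≢ at i
      q≢at i = All.lookup (AllPairs.head (AllPairs.tail u)) (lookup∈toList v i)

      p≢at : ∀ i → p ≢ at i
      p≢at i = All.lookup (All.tail (AllPairs.head u)) (lookup∈toList v i)

      qv : ∀ i j → i Fin.< j → β q (at i) (at j)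
      qv i j i<j = o zero (suc i) (suc j) z<s (s<s i<j)

      pq : ∀ i → Middle p q (at i)
      pq i = middle (lin (here refl) (there (here refl)) (there (there (lookup∈toList v i))))

    slot-∷-last : ∀ {a} → toℕ a ≡ 3 + m → Slot v p a → Slot (q ∷ v) p (suc a)
    slot-∷-last {a} a≡ s = record
      { before = λ { zero (suc j) _ _ → P2 _ _ _ (between j)
                   ; (suc i) (suc j) i<j j<a → s .before i j (s<s⁻¹ i<j) (s<s⁻¹ j<a) }
      ; across = λ { i (suc j) _ a≤j → contradiction (≤-trans (≤-reflexive (sym a≡)) (s≤s⁻¹ a≤j)) (<⇒≱ (Fin.toℕ<n j)) }
      ; after  = λ { (suc i) (suc j) a≤i i<j → s .after i j (s≤s⁻¹ a≤i) (s<s⁻¹ i<j) }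
      }
      where
      vp : ∀ i j → i Fin.< j → β (at i) (at j) p
      vp i j i<j = s .before i j i<j (≤-trans (Fin.toℕ<n j) (≤-reflexive (sym a≡)))
      -- The second point of `v` has points of `v` on both sides: the next one refutes that `p` is
      -- in the middle, the previous one that `q` is.
      between-1 : β p (at 1F) q
      between-1 with pq 1F
      ... | mid₃ b = b
      ... | mid₁ b = contradiction (P4 _ _ _ _ (qv 1F 2F (s<s z<s)) b .proj₂)
        λ b′ → β-antisym (at-≢ λ ()) (vp 1F 2F (s<s z<s)) (P2 _ _ _ b′)
      ... | mid₂ b = contradiction (P4 _ _ _ _ (P2 _ _ _ b) (P2 _ _ _ (qv 0F 1F z<s)) .proj₁)
        (β-antisym (at-≢ λ ()) (vp 0F 1F z<s))
      between : ∀ j → β p (at j) q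
      between zero          = P2 _ _ _ (P4 _ _ _ _ (P2 _ _ _ between-1) (qv 0F 1F z<s) .proj₁)
      between (suc zero)    = between-1
      between (suc (suc j)) = P4 _ _ _ _ between-1 (P2 _ _ _ (vp 1F (suc (suc j)) (s<s z<s))) .proj₁

    slot-∷-inner : ∀ {a} → 0 < toℕ a → toℕ a < 3 + m → Slot v p a → Slot (q ∷ v) p (suc a)
    slot-∷-inner {a} 0<a a<n s = record
      { before = λ { zero (suc j) _ j<a → P2 _ _ _ (P4 _ _ _ _
                       (P2 _ _ _ (qv j last (≤-trans (s<s⁻¹ j<a) (≤-reflexive (sym last≡)))))
                       (P2 _ _ _ (s .across j last (s<s⁻¹ j<a) (≤-reflexive (sym last≡)))) .proj₂)
                   ; (suc i) (suc j) i<j j<a → s .before i j (s<s⁻¹ i<j) (s<s⁻¹ j<a) }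
      ; across = λ { zero (suc j) _ a≤j → P2 _ _ _ (P4 _ _ _ _
                       (P2 _ _ _ (qv 0F j (≤-trans 0<a (s≤s⁻¹ a≤j))))
                       (P2 _ _ _ (s .across 0F j 0<a (s≤s⁻¹ a≤j))) .proj₁)
                   ; (suc i) (suc j) i<a a≤j → s .across i j (s<s⁻¹ i<a) (s≤s⁻¹ a≤j) }
      ; after  = λ { (suc i) (suc j) a≤i i<j → s .after i j (s≤s⁻¹ a≤i) (s<s⁻¹ i<j) }
      }
      where
      -- The point of `v` just behind the place of `p`. It exists because the place is an inner one,
      -- and it fixes the order of `q`, `at j` and `p`.
      last : Fin (3 + m)
      last = Fin.fromℕ< a<n
      last≡ : toℕ last ≡ toℕ a
      last≡ = Fin.toℕ-fromℕ< a<n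

    slot-∷-first : Slot v p zero → ∃ (Slot (q ∷ v) p)
    slot-∷-first s with pq 0F
    -- In this case `p`, `q` and `at 1F` would be the leaves of a star with centre `at 0F`, hence a
    -- triangle.
    ... | mid₃ b = ⊥-elim (absurd (pq 1F))
      where
      pv : β p (at 0F) (at 1F)
      pv = s .after 0F 1F z≤n z<s
      absurd : ¬ Middle p q (at 1F)
      absurd (mid₁ b′) = β-antisym (p≢at 0F) pv (P4 _ _ _ _ b′ (P2 _ _ _ b) .proj₂)
      absurd (mid₂ b′) = β-antisym (q≢at 0F) (qv 0F 1F z<s) (P4 _ _ _ _ b′ b .proj₂)
      absurd (mid₃ b′) = β-antisym (at-≢ λ ()) (P4 _ _ _ _ b′ pv .proj₂) (P2 _ _ _ (qv 0F 1F z<s))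
    ... | mid₂ b = zero , record
      { before = λ _ _ _ ()
      ; across = λ _ _ ()
      ; after  = λ { zero (suc zero) _ _ → b
                   ; zero (suc (suc j)) _ _ → P4 _ _ _ _ (s .after 0F (suc j) z≤n z<s) b .proj₁
                   ; (suc i) (suc j) _ i<j → s .after i j z≤n (s<s⁻¹ i<j) }
      }
    ... | mid₁ b = suc zero , record
      { before = λ { i (suc j) _ (s≤s ()) }
      ; across = λ { zero (suc zero) _ _ → b
                   ; zero (suc (suc j)) _ _ → P4 _ _ _ _ (qv 0F (suc j) z<s) b .proj₁
                   ; (suc i) _ (s≤s ()) _ }
      ; after  = λ { (suc i) (suc j) _ i<j → s .after i j z≤n (s<s⁻¹ i<j) }
      }

    slot-∷ : ∀ {a} → Slot v p a → ∃ (Slot (q ∷ v) p)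
    slot-∷ {zero}  s = slot-∷-first s
    slot-∷ {suc a} s with toℕ (suc a) <? 3 + m
    ... | yes a<n = _ , slot-∷-inner z<s a<n s
    ... | no a≮n  = _ , slot-∷-last (≤-antisym (Fin.toℕ≤pred[n] (suc a)) (≮⇒≥ a≮n)) s

  slot : ∀ {m p} (v : Vec Carrier (4 + m)) → Ordered v → Unique (p ∷ toList v) → Linear (p ∷ toList v) →
         ∃ (Slot v p)
  slot {zero}          v       o u lin = slot₄ v o u lin
  slot {suc m} {p} (q ∷ v) o u lin = slot-∷ v o u lin
    (proj₂ (slot v (ordered-tail {q = q} {v} o) (drop₂ u) (linear-⊆ skip lin)))
    where
    skip : ∀ {s} → s ∈ p ∷ toList v → s ∈ p ∷ q ∷ toList v
    skip (here eq)  = here eq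
    skip (there s∈) = there (there s∈)

  linear-resp-↭ : ∀ {ps qs} → ps ↭ qs → Linear ps → Linear qs
  linear-resp-↭ π = linear-⊆ (∈-resp-↭ (↭-sym π))

  path₃ : ∀ {p q r} → Distinct p q r → β p q r → code (p ∷ q ∷ r ∷ []) ≡ path 3
  path₃ d b = cong (λ m → ((m ∷ []) ∷ [] ∷ []) ∷ ([] ∷ []) ∷ [] ∷ []) (β⇒mid≡m₂ d b)

  linear₃ : ∀ {ps} → Unique ps → Linear ps → length ps ≡ 3 → Arranged ps (_∈ path 3 ∷ [])
  linear₃ {p ∷ q ∷ r ∷ []} ((p≢q ∷ p≢r ∷ []) ∷ (q≢r ∷ []) ∷ _) lin refl
    with middle (lin (here refl) (there (here refl)) (there (there (here refl))))
  ... | mid₁ b = q ∷ p ∷ r ∷ [] , ↭-swap q p ↭-refl , here (path₃ (≢-sym p≢q , q≢r , p≢r) b)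
  ... | mid₂ b = p ∷ q ∷ r ∷ [] , ↭-refl , here (path₃ (p≢q , p≢r , q≢r) b)
  ... | mid₃ b = p ∷ r ∷ q ∷ [] , ↭-prep p (↭-swap r q ↭-refl) , here (path₃ (p≢r , p≢q , ≢-sym q≢r) b)

  extendArranged : ∀ {n p ps} {cs : List (Code n)} {cs′} → Extends cs 0 (OneOf cs′) →
                   Unique (p ∷ ps) → Linear (p ∷ ps) → Arranged ps (_∈ cs) → Arranged (p ∷ ps) (_∈ cs′)
  extendArranged {p = p} ext u lin (v , π , v∈) = fromOneOf u
    (p ∷ v , ↭-prep p π , extendLinear {v = v} ext (unique-resp-↭ (↭-prep p (↭-sym π)) u)
      (linear-resp-↭ (↭-prep p (↭-sym π)) lin) v∈)

  -- On four points the 4-cycle is carried along as a second possibility; the fifth point rules it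
  -- out.
  order₅ : ∀ {ps} → Unique ps → Linear ps → length ps ≡ 5 → Arranged ps (_∈ path 5 ∷ [])
  order₅ {p ∷ q ∷ ps} u@(_ ∷ u′@(_ ∷ u″)) lin len =
    extendArranged paths-extend₅ u lin (extendArranged paths-extend₄ u′ (linear-⊆ there lin)
      (linear₃ u″ (linear-⊆ (there ∘ there) lin) (suc-injective (suc-injective len))))

  order≥5 : ∀ m {ps} → Unique ps → Linear ps → length ps ≡ 5 + m →
            ∃ λ (v : Vec Carrier (5 + m)) → toList v ↭ ps × Ordered v
  order≥5 zero u lin len = fromPath (order₅ u lin len)
    where
    fromPath : ∀ {ps} → Arranged ps (_∈ path 5 ∷ []) → ∃ λ (v : Vec Carrier 5) → toList v ↭ ps × Ordered v
    fromPath (v , π , here eq) = v , π , path⇒ordered eq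
  order≥5 (suc m) {p ∷ ps} u@(_ ∷ u′) lin len =
    insert (order≥5 m u′ (linear-⊆ there lin) (suc-injective len))
    where
    insert : (∃ λ (v : Vec Carrier (5 + m)) → toList v ↭ ps × Ordered v) →
             ∃ λ (v : Vec Carrier (6 + m)) → toList v ↭ p ∷ ps × Ordered v
    insert (v , π , o) =
      let a , s = slot v o (unique-resp-↭ (↭-prep p (↭-sym π)) u) (linear-resp-↭ (↭-prep p (↭-sym π)) lin)
      in insertAt v a p , ↭-trans (insertAt-↭ v a p) (↭-prep p π) , ordered-insertAt v a o s

-- Two points beside an ordering

-- Indices 0 and 1 stand for the two inserted points, the others for the ordering. `codeBy` reads
-- increasing triples only, so the last clause is a default. Structures and graphs with the same
-- data are compared through this common code.
shapeMid : ∀ {m} → Fin (suc m) → Fin (suc m) → (Fin m → Mid) → (i j k : Fin (2 + m)) → Mid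
shapeMid a b f zero          (suc zero)    (suc (suc k)) = f k
shapeMid a b f zero          (suc (suc j)) (suc (suc k)) = slotMid a j k
shapeMid a b f (suc zero)    (suc (suc j)) (suc (suc k)) = slotMid b j k
shapeMid a b f (suc (suc i)) (suc (suc j)) (suc (suc k)) = m₂
shapeMid a b f _             _             _             = none

shapeCode : ∀ {m} → Fin (suc m) → Fin (suc m) → (Fin m → Mid) → Code (2 + m)
shapeCode a b f = codeBy (shapeMid a b f) (allFin _)

-- Two points are collinear with the inserted pair: the neighbours of the common place, at indices
-- `a` - 1 and `a`.
rMid : ∀ {m} → Fin (suc m) → Fin m → Mid
rMid a j = if does (suc (toℕ j) ≟ toℕ a) then m₃ else if does (toℕ j ≟ toℕ a) then m₃ else none

-- The values at the two ends reflect the heavy edge of `S⁴`: the shortest path from one inserted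
-- point to the far end of the ordering runs through the other inserted point.
sMid : ∀ {m} → Fin m → Mid
sMid {m} j = if does (toℕ j ≟ 0) then m₁ else if does (suc (toℕ j) ≟ m) then m₂ else none

last : ∀ {m} → Fin (suc m)
last = Fin.fromℕ _

module Shapes (B : BetweennessStructure) where
  open Orders B public

  record Shape {m} (v : Vec Carrier m) (q r : Carrier) (a b : Fin (suc m)) (f : Fin m → Mid) : Set where
    field
      ordered : Ordered v
      slot-q  : Slot v q a
      slot-r  : Slot v r b
      mids    : ∀ j → IsMid q r (lookup v j) (f j)

  shape-code : ∀ {m} {v : Vec Carrier m} {q r a b f} → Unique (q ∷ r ∷ toList v) →
               Shape v q r a b f → code (q ∷ r ∷ v) ≡ shapeCode a b f
  shape-code {m} {v} {q} {r} {a} {b} {f} u s = codeBy-cong (q ∷ r ∷ v) (allFin (2 + m)) λ i j k i<j j<k →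
    ≡-trans (mid≡ (distinct {v = q ∷ r ∷ v} u (Fin.<⇒≢ i<j) (Fin.<⇒≢ (Fin.<-trans i<j j<k)) (Fin.<⇒≢ j<k))
              (isShapeMid i j k i<j j<k))
      (sym (cong₃ (lookup∘tabulate id i) (lookup∘tabulate id j) (lookup∘tabulate id k)))
    where
    open Shape s
    cong₃ : ∀ {i j k i′ j′ k′} → i ≡ i′ → j ≡ j′ → k ≡ k′ → shapeMid a b f i j k ≡ shapeMid a b f i′ j′ k′
    cong₃ refl refl refl = refl
    isShapeMid : ∀ i j k → i Fin.< j → j Fin.< k →
                 IsMid (lookup (q ∷ r ∷ v) i) (lookup (q ∷ r ∷ v) j) (lookup (q ∷ r ∷ v) k) (shapeMid a b f i j k)
    isShapeMid zero (suc zero) (suc (suc k)) _ _ = mids k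
    isShapeMid zero (suc (suc j)) (suc (suc k)) _ (s≤s (s≤s j<k)) = slot-mid slot-q j k j<k
    isShapeMid (suc zero) (suc (suc j)) (suc (suc k)) _ (s≤s (s≤s j<k)) = slot-mid slot-r j k j<k
    isShapeMid (suc (suc i)) (suc (suc j)) (suc (suc k)) (s≤s (s≤s i<j)) (s≤s (s≤s j<k)) =
      is₂ (ordered i j k i<j j<k)
    isShapeMid zero (suc zero) (suc zero) _ (s≤s ())
    isShapeMid (suc zero) (suc zero) _ (s≤s ()) _
    isShapeMid _ (suc (suc j)) (suc zero) _ (s≤s ())

  two-collinear : ∀ {m q r} (v : Vec Carrier m) → tri₁ q r (toList v) + 2 ≤ m →
                  ∃ λ i → ∃ λ j → i Fin.< j × Collinear q r (lookup v i) × Collinear q r (lookup v j)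
  two-collinear {q = q} {r} (s ∷ v) le with collinear? q r s
  ... | no _ = let i , j , i<j , ci , cj = two-collinear v (s≤s⁻¹ le) in suc i , suc j , s<s i<j , ci , cj
  ... | yes c = let j , cj = one v (s≤s⁻¹ (≤-trans (≤-reflexive (sym (+-suc _ 1))) le)) in
    zero , suc j , z<s , c , cj
    where
    one : ∀ {m} (v : Vec Carrier m) → tri₁ q r (toList v) + 1 ≤ m → ∃ λ i → Collinear q r (lookup v i)
    one (s ∷ v) le with collinear? q r s
    ... | yes c = zero , c
    ... | no _ = let i , c = one v (s≤s⁻¹ le) in suc i , c

  a-triangle : ∀ {m q r} (v : Vec Carrier m) → 0 < tri₁ q r (toList v) → ∃ λ k → ¬ Collinear q r (lookup v k)
  a-triangle {q = q} {r} (s ∷ v) 0< with collinear? q r s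
  ... | no ¬c = zero , ¬c
  ... | yes _ = let k , ¬c = a-triangle v 0< in suc k , ¬c

  -- The number of triangles enters the analysis through these witnesses alone: two points of `v`
  -- collinear with `q` and `r`, and one that is not. A configuration is refuted by showing that it
  -- makes all points collinear with `q` and `r`.
  module Analysis {m} {v : Vec Carrier m} {q r : Carrier} (u : Unique (toList v)) (o : Ordered v)
    {i j k : Fin m} (i<j : i Fin.< j) (ci : Collinear q r (lookup v i)) (cj : Collinear q r (lookup v j))
    (¬ck : ¬ Collinear q r (lookup v k)) where

    private
      at : Fin m → Carrier
      at = lookup v

      at-≢ : ∀ {i j} → i Fin.< j → at i ≢ at j
      at-≢ i<j = Fin.<⇒≢ i<j ∘ unique⇒injective v u _ _

    module SameSlot {a} (sq : Slot v q a) (sr : Slot v r a) where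
      private
        module q = Slot sq
        module r = Slot sr

      -- r and q occupy the same slot, so this applies with r and q exchanged too.
      all-collinear : ∀ {p s} → Slot v p a → Slot v s a → ∀ l → β (at l) p s → ∀ l′ → Collinear p s (at l′)
      all-collinear sp ss l b l′ with <-cmp (toℕ l′) (toℕ l) | toℕ l <? toℕ a | toℕ l′ <? toℕ a
      ... | tri≈ _ eq _ | _ | _ rewrite Fin.toℕ-injective eq = col₁ (P2 _ _ _ b)
      ... | tri< l′<l _ _ | yes l<a | _ =
        col₁ (P4 _ _ _ _ (P2 _ _ _ (Slot.before ss l′ l l′<l l<a)) (P2 _ _ _ b) .proj₁)
      ... | tri< l′<l _ _ | no l≮a | yes l′<a =
        col₂ (P4 _ _ _ _ (P2 _ _ _ (Slot.across ss l′ l l′<a (≮⇒≥ l≮a))) b .proj₂)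
      ... | tri< l′<l _ _ | no l≮a | no l′≮a =
        col₁ (P2 _ _ _ (P4 _ _ _ _ b (P2 _ _ _ (Slot.after sp l′ l (≮⇒≥ l′≮a) l′<l)) .proj₂))
      ... | tri> _ _ l<l′ | yes l<a | yes l′<a =
        col₁ (P2 _ _ _ (P4 _ _ _ _ b (Slot.before sp l l′ l<l′ l′<a) .proj₂))
      ... | tri> _ _ l<l′ | yes l<a | no l′≮a =
        col₂ (P4 _ _ _ _ (Slot.across ss l l′ l<a (≮⇒≥ l′≮a)) b .proj₂)
      ... | tri> _ _ l<l′ | no l≮a | _ =
        col₁ (P4 _ _ _ _ (Slot.after ss l l′ (≮⇒≥ l≮a) l<l′) (P2 _ _ _ b) .proj₁)

      between : ∀ {l} → Collinear q r (at l) → β q (at l) r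
      between {l} c with middle c
      ... | mid₃ b = b
      ... | mid₁ b = contradiction (all-collinear sq sr l (P2 _ _ _ b) k) ¬ck
      ... | mid₂ b = contradiction (collinear-swap₁₂ (all-collinear sr sq l (P2 _ _ _ b) k)) ¬ck

      -- If the next point `at l⁺` still came before the place, it would lie between `at l` and `q`,
      -- and P4 would put `at l` between `at l⁺` and `r`, against the slot of `r`.
      nearest-before : ∀ {l} → β q (at l) r → toℕ l < toℕ a → suc (toℕ l) ≡ toℕ a
      nearest-before {l} b l<a with suc (toℕ l) ≟ toℕ a
      ... | yes eq = eq
      ... | no neq = contradiction (P4 _ _ _ _ b (P2 _ _ _ (q.before l l⁺ l<l⁺ l⁺<a)) .proj₂)
                       (β-antisym (at-≢ l<l⁺) (r.before l l⁺ l<l⁺ l⁺<a))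
        where
        1+l<a : suc (toℕ l) < toℕ a
        1+l<a = ≤∧≢⇒< l<a neq
        1+l<m : suc (toℕ l) < m
        1+l<m = ≤-trans 1+l<a (Fin.toℕ≤pred[n] a)
        l⁺ : Fin m
        l⁺ = Fin.fromℕ< 1+l<m
        l⁺≡ : toℕ l⁺ ≡ suc (toℕ l)
        l⁺≡ = Fin.toℕ-fromℕ< 1+l<m
        l<l⁺ : l Fin.< l⁺
        l<l⁺ = ≤-reflexive (sym l⁺≡)
        l⁺<a : toℕ l⁺ < toℕ a
        l⁺<a = subst (_< toℕ a) (sym l⁺≡) 1+l<a

      nearest-after : ∀ {l} → β q (at l) r → toℕ a ≤ toℕ l → toℕ l ≡ toℕ a
      nearest-after {l} b a≤l with toℕ l ≟ toℕ a
      ... | yes eq = eq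
      ... | no neq = contradiction (P4 _ _ _ _ b (q.after l⁻ l a≤l⁻ l⁻<l) .proj₂)
                       (β-antisym (≢-sym (at-≢ l⁻<l)) (P2 _ _ _ (r.after l⁻ l a≤l⁻ l⁻<l)))
        where
        a<l : toℕ a < toℕ l
        a<l = ≤∧≢⇒< a≤l (neq ∘ sym)
        a<m : toℕ a < m
        a<m = <-trans a<l (Fin.toℕ<n l)
        l⁻ : Fin m
        l⁻ = Fin.fromℕ< a<m
        l⁻≡ : toℕ l⁻ ≡ toℕ a
        l⁻≡ = Fin.toℕ-fromℕ< a<m
        l⁻<l : l⁻ Fin.< l
        l⁻<l = subst (_< toℕ l) (sym l⁻≡) a<l
        a≤l⁻ : toℕ a ≤ toℕ l⁻
        a≤l⁻ = ≤-reflexive (sym l⁻≡)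

      nearest : ∀ {l} → Collinear q r (at l) → suc (toℕ l) ≡ toℕ a ⊎ toℕ l ≡ toℕ a
      nearest {l} c with toℕ l <? toℕ a
      ... | yes l<a = inj₁ (nearest-before (between c) l<a)
      ... | no l≮a  = inj₂ (nearest-after (between c) (≮⇒≥ l≮a))

      neighbours : suc (toℕ i) ≡ toℕ a × toℕ j ≡ toℕ a
      neighbours with nearest ci | nearest cj
      ... | inj₁ p | inj₂ q  = p , q
      ... | inj₁ p | inj₁ q  = contradiction (suc-injective (≡-trans p (sym q))) (<⇒≢ i<j)
      ... | inj₂ p | inj₂ q  = contradiction (≡-trans p (sym q)) (<⇒≢ i<j)
      ... | inj₂ p | inj₁ q  = contradiction (≡-trans q (sym p)) (>⇒≢ (m<n⇒m<1+n i<j))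

      rShape : Shape v q r a a (rMid a)
      rShape = record { ordered = o ; slot-q = sq ; slot-r = sr ; mids = mids }
        where
        mids : ∀ l → IsMid q r (at l) (rMid a l)
        mids l with suc (toℕ l) ≟ toℕ a | toℕ l ≟ toℕ a
        ... | yes eq | _ rewrite dec-true (suc (toℕ l) ≟ toℕ a) eq = is₃ (subst (λ l → β q (at l) r)
          (Fin.toℕ-injective (suc-injective (≡-trans (proj₁ neighbours) (sym eq)))) (between ci))
        ... | no neq | yes eq rewrite dec-false (suc (toℕ l) ≟ toℕ a) neq | dec-true (toℕ l ≟ toℕ a) eq =
          is₃ (subst (λ l → β q (at l) r) (Fin.toℕ-injective (≡-trans (proj₂ neighbours) (sym eq))) (between cj))
        ... | no neq | no neq′ rewrite dec-false (suc (toℕ l) ≟ toℕ a) neq | dec-false (toℕ l ≟ toℕ a) neq′ =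
          isₙ λ c → case (nearest c)
          where
          case : ¬ (suc (toℕ l) ≡ toℕ a ⊎ toℕ l ≡ toℕ a)
          case (inj₁ eq) = neq eq
          case (inj₂ eq) = neq′ eq

    module DifferentSlots {a b} (a<b : toℕ a < toℕ b) (sq : Slot v q a) (sr : Slot v r b) where
      private
        module q = Slot sq
        module r = Slot sr

        a<m : toℕ a < m
        a<m = ≤-trans a<b (Fin.toℕ≤pred[n] b)
        -- The first point after `q`; it lies between the two places, so it compares both inserted
        -- points with any point outside.
        c : Fin m
        c = Fin.fromℕ< a<m
        c≡ : toℕ c ≡ toℕ a
        c≡ = Fin.toℕ-fromℕ< a<m
        a≤c : toℕ a ≤ toℕ c
        a≤c = ≤-reflexive (sym c≡)
        c<b : toℕ c < toℕ b
        c<b = subst (_< toℕ b) (sym c≡) a<b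

      outer-left : ∀ {l} → toℕ l < toℕ a → β (at l) q r
      outer-left {l} l<a = P4 _ _ _ _ (r.before l c (≤-trans l<a a≤c) c<b) (q.across l c l<a a≤c) .proj₁

      outer-right : ∀ {l} → toℕ b ≤ toℕ l → β q r (at l)
      outer-right {l} b≤l = P2 _ _ _ (P4 _ _ _ _
        (P2 _ _ _ (q.after c l a≤c (<-≤-trans c<b b≤l))) (P2 _ _ _ (r.across c l c<b b≤l)) .proj₁)

      -- A point `at z′` before both places would be an origin from which `q`, `at l` and `r` are
      -- seen in this order for every `l` between the places. Points outside the places are
      -- collinear with `q` and `r` anyway, so no triangle would be left. `b≡m` is the mirror image.
      a≡0 : toℕ a ≡ 0
      a≡0 with toℕ a ≟ 0
      ... | yes eq = eq
      ... | no neq = contradiction (allCollinear k) ¬ck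
        where
        0<a : 0 < toℕ a
        0<a = n≢0⇒n>0 neq
        z′ : Fin m
        z′ = Fin.fromℕ< (<-trans 0<a a<m)
        z<a : toℕ z′ < toℕ a
        z<a = subst (_< toℕ a) (sym (Fin.toℕ-fromℕ< (<-trans 0<a a<m))) 0<a
        allCollinear : ∀ l → Collinear q r (at l)
        allCollinear l with toℕ l <? toℕ a | toℕ l <? toℕ b
        ... | yes l<a | _ = col₁ (P2 _ _ _ (outer-left l<a))
        ... | no l≮a | yes l<b = col₃ (P4 _ _ _ _
          (r.before z′ l (<-≤-trans z<a (≮⇒≥ l≮a)) l<b) (q.across z′ l z<a (≮⇒≥ l≮a)) .proj₂)
        ... | no _ | no l≮b = col₂ (outer-right (≮⇒≥ l≮b))

      b≡m : toℕ b ≡ m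
      b≡m with toℕ b ≟ m
      ... | yes eq = eq
      ... | no neq = contradiction (allCollinear k) ¬ck
        where
        b<m : toℕ b < m
        b<m = ≤∧≢⇒< (Fin.toℕ≤pred[n] b) neq
        e : Fin m
        e = Fin.fromℕ< b<m
        b≤e : toℕ b ≤ toℕ e
        b≤e = ≤-reflexive (sym (Fin.toℕ-fromℕ< b<m))
        allCollinear : ∀ l → Collinear q r (at l)
        allCollinear l with toℕ l <? toℕ a | toℕ l <? toℕ b
        ... | yes l<a | _ = col₁ (P2 _ _ _ (outer-left l<a))
        ... | no l≮a | yes l<b = col₃ (P2 _ _ _ (P4 _ _ _ _
          (P2 _ _ _ (q.after l e (≮⇒≥ l≮a) (<-≤-trans l<b b≤e))) (P2 _ _ _ (r.across l e l<b b≤e)) .proj₂))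
        ... | no _ | no l≮b = col₂ (outer-right (≮⇒≥ l≮b))

      private
        q-first : ∀ l l′ → l Fin.< l′ → β q (at l) (at l′)
        q-first l l′ = q.after l l′ (subst (_≤ toℕ l) (sym a≡0) z≤n)

        r-last : ∀ l l′ → l Fin.< l′ → β (at l) (at l′) r
        r-last l l′ l<l′ = r.before l l′ l<l′ (subst (toℕ l′ <_) (sym b≡m) (Fin.toℕ<n l′))

      -- As `q` precedes and `r` follows all of `v`, a single point between them would draw all the
      -- others in between by P4.
      not-between : ∀ {l} → ¬ β q (at l) r
      not-between {l} bt = ¬ck (allCollinear k)
        where
        allCollinear : ∀ l′ → Collinear q r (at l′)
        allCollinear l′ with <-cmp (toℕ l′) (toℕ l)
        ... | tri≈ _ eq _ rewrite Fin.toℕ-injective eq = col₃ bt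
        ... | tri< l′<l _ _ = col₃ (P4 _ _ _ _ bt (q-first l′ l l′<l) .proj₁)
        ... | tri> _ _ l<l′ = col₃ (P2 _ _ _ (P4 _ _ _ _ (P2 _ _ _ bt) (P2 _ _ _ (r-last l l′ l<l′)) .proj₁))

      q-middle : ∀ {l} → β r q (at l) → toℕ l ≡ 0
      q-middle {l} b with toℕ l ≟ 0
      ... | yes eq = eq
      ... | no neq = contradiction (P4 _ _ _ _ (P2 _ _ _ b) (P2 _ _ _ (q-first l₀ l l₀<l)) .proj₁)
                       (β-antisym (at-≢ l₀<l) (r-last l₀ l l₀<l))
        where
        0<m : 0 < m
        0<m = <-trans (n≢0⇒n>0 neq) (Fin.toℕ<n l)
        l₀ : Fin m
        l₀ = Fin.fromℕ< 0<m
        l₀<l : l₀ Fin.< l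
        l₀<l = subst (_< toℕ l) (sym (Fin.toℕ-fromℕ< 0<m)) (n≢0⇒n>0 neq)

      r-middle : ∀ {l} → β q r (at l) → suc (toℕ l) ≡ m
      r-middle {l} b with suc (toℕ l) ≟ m
      ... | yes eq = eq
      ... | no neq = contradiction (P2 _ _ _ (q-first l l⁺ l<l⁺))
                       (β-antisym (at-≢ l<l⁺) (P4 _ _ _ _ (P2 _ _ _ b) (r-last l l⁺ l<l⁺) .proj₁))
        where
        1+l<m : suc (toℕ l) < m
        1+l<m = ≤∧≢⇒< (Fin.toℕ<n l) neq
        l⁺ : Fin m
        l⁺ = Fin.fromℕ< 1+l<m
        l<l⁺ : l Fin.< l⁺
        l<l⁺ = ≤-reflexive (sym (Fin.toℕ-fromℕ< 1+l<m))

      ends : ∀ {l} → Collinear q r (at l) → (β r q (at l) × toℕ l ≡ 0) ⊎ (β q r (at l) × suc (toℕ l) ≡ m)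
      ends c with middle c
      ... | mid₁ b = inj₁ (b , q-middle b)
      ... | mid₂ b = inj₂ (b , r-middle b)
      ... | mid₃ b = contradiction b not-between

      two-ends : (β r q (at i) × toℕ i ≡ 0) × (β q r (at j) × suc (toℕ j) ≡ m)
      two-ends with ends ci | ends cj
      ... | inj₁ p | inj₂ p′ = p , p′
      ... | _ | inj₁ (_ , j≡0) = contradiction (subst (toℕ i <_) j≡0 i<j) n≮0
      ... | inj₂ (_ , 1+i≡m) | _ = contradiction (≤-trans (≤-reflexive (cong suc (sym 1+i≡m))) (s≤s i<j))
                                     (≤⇒≯ (Fin.toℕ<n j))

      sShape : Shape v q r a b sMid
      sShape = record { ordered = o ; slot-q = sq ; slot-r = sr ; mids = mids }
        where
        mids : ∀ l → IsMid q r (at l) (sMid l)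
        mids l with toℕ l ≟ 0 | suc (toℕ l) ≟ m
        ... | yes eq | _ rewrite dec-true (toℕ l ≟ 0) eq = is₁ (subst (λ l → β r q (at l))
          (Fin.toℕ-injective (≡-trans (proj₂ (proj₁ two-ends)) (sym eq))) (proj₁ (proj₁ two-ends)))
        ... | no neq | yes eq rewrite dec-false (toℕ l ≟ 0) neq | dec-true (suc (toℕ l) ≟ m) eq =
          is₂ (subst (λ l → β q r (at l))
            (Fin.toℕ-injective (suc-injective (≡-trans (proj₂ (proj₂ two-ends)) (sym eq)))) (proj₁ (proj₂ two-ends)))
        ... | no neq | no neq′ rewrite dec-false (toℕ l ≟ 0) neq | dec-false (suc (toℕ l) ≟ m) neq′ =
          isₙ λ c → case (ends c)
          where
          case : ¬ ((β r q (at l) × toℕ l ≡ 0) ⊎ (β q r (at l) × suc (toℕ l) ≡ m))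
          case (inj₁ (_ , eq)) = neq eq
          case (inj₂ (_ , eq)) = neq′ eq

  -- Reversal takes place `a` to place `m` - `a`, which brings a common place in the second half
  -- into the range of indices of `R⁴`.
  reversed : ∀ {m} → Vec Carrier m → Vec Carrier m
  reversed v = tabulate (lookup v ∘ Fin.opposite)

  lookup-reversed : ∀ {m} (v : Vec Carrier m) i → lookup (reversed v) i ≡ lookup v (Fin.opposite i)
  lookup-reversed v = lookup∘tabulate (lookup v ∘ Fin.opposite)

  reversed-↭ : ∀ {m} (v : Vec Carrier m) → Unique (toList v) → toList (reversed v) ↭ toList v
  reversed-↭ {m} v u rewrite toList-tabulate (lookup v ∘ Fin.opposite) =
    ∼bag⇒↭ (unique∧set⇒bag (Unique.tabulate⁺ injective) u (mk⇔ to from))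
    where
    involutive = Fin.opposite-involutive
    injective : ∀ {i j} → lookup v (Fin.opposite i) ≡ lookup v (Fin.opposite j) → i ≡ j
    injective {i} {j} eq = ≡-trans (sym (involutive i))
      (≡-trans (cong Fin.opposite (unique⇒injective v u _ _ eq)) (involutive j))
    to : ∀ {p} → p ∈ List.tabulate (lookup v ∘ Fin.opposite) → p ∈ toList v
    to p∈ with i , refl ← ∈-tabulate⁻ p∈ = lookup∈toList v (Fin.opposite i)
    from : ∀ {p} → p ∈ toList v → p ∈ List.tabulate (lookup v ∘ Fin.opposite)
    from p∈ with i , refl ← ∈⇒lookup {v = v} p∈ =
      subst (λ j → lookup v j ∈ List.tabulate (lookup v ∘ Fin.opposite)) (involutive i)
        (∈-tabulate⁺ {f = lookup v ∘ Fin.opposite} (Fin.opposite i))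

  opposite-< : ∀ {n} {i j : Fin n} → i Fin.< j → Fin.opposite j Fin.< Fin.opposite i
  opposite-< {n} {i} {j} i<j = subst₂ _<_ (sym (Fin.opposite-prop j)) (sym (Fin.opposite-prop i))
    (∸-monoʳ-< (s<s i<j) (Fin.toℕ<n j))

  ordered-reversed : ∀ {m} {v : Vec Carrier m} → Ordered v → Ordered (reversed v)
  ordered-reversed {v = v} o i j k i<j j<k = subst₃ (lookup-reversed v i) (lookup-reversed v j) (lookup-reversed v k)
    (P2 _ _ _ (o (Fin.opposite k) (Fin.opposite j) (Fin.opposite i) (opposite-< j<k) (opposite-< i<j)))
    where
    subst₃ : ∀ {p q r p′ q′ r′} → p ≡ p′ → q ≡ q′ → r ≡ r′ → β p′ q′ r′ → β p q r
    subst₃ refl refl refl b = b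

  slot-reversed : ∀ {m} {v : Vec Carrier m} {p a} → Slot v p a → Slot (reversed v) p (Fin.opposite a)
  slot-reversed {m} {v} {p} {a} s = record
    { before = λ i j i<j j<a → subst₂ (λ q r → β q r p) (sym (lookup-reversed v i)) (sym (lookup-reversed v j))
        (P2 _ _ _ (Slot.after s (Fin.opposite j) (Fin.opposite i) (flip-< j<a) (opposite-< i<j)))
    ; across = λ i j i<a a≤j → subst₂ (λ q r → β q p r) (sym (lookup-reversed v i)) (sym (lookup-reversed v j))
        (P2 _ _ _ (Slot.across s (Fin.opposite j) (Fin.opposite i) (flip-≤ a≤j) (flip-< i<a)))
    ; after = λ i j a≤i i<j → subst₂ (λ q r → β p q r) (sym (lookup-reversed v i)) (sym (lookup-reversed v j))
        (P2 _ _ _ (Slot.before s (Fin.opposite j) (Fin.opposite i) (opposite-< i<j) (flip-≤ a≤i)))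
    }
    where
    flip-< : ∀ {i} → toℕ i < toℕ (Fin.opposite a) → toℕ a ≤ toℕ (Fin.opposite i)
    flip-< {i} i<a = begin
      toℕ a                   ≡⟨ m∸[m∸n]≡n (Fin.toℕ≤pred[n] a) ⟨
      m ∸ (m ∸ toℕ a)         ≡⟨ cong (m ∸_) (Fin.opposite-prop a) ⟨
      m ∸ toℕ (Fin.opposite a) ≤⟨ ∸-monoʳ-≤ m i<a ⟩
      m ∸ suc (toℕ i)         ≡⟨ Fin.opposite-prop i ⟨
      toℕ (Fin.opposite i)    ∎
      where open ≤-Reasoning
    flip-≤ : ∀ {i} → toℕ (Fin.opposite a) ≤ toℕ i → toℕ (Fin.opposite i) < toℕ a
    flip-≤ {i} a≤i = begin-strict
      toℕ (Fin.opposite i)    ≡⟨ Fin.opposite-prop i ⟩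
      m ∸ suc (toℕ i)         <⟨ ∸-monoʳ-< (s<s ≤-refl) (Fin.toℕ<n i) ⟩
      m ∸ toℕ i               ≤⟨ ∸-monoʳ-≤ m a≤i ⟩
      m ∸ toℕ (Fin.opposite a) ≡⟨ cong (m ∸_) (Fin.opposite-prop a) ⟩
      m ∸ (m ∸ toℕ a)         ≡⟨ m∸[m∸n]≡n (Fin.toℕ≤pred[n] a) ⟩
      toℕ a                   ∎
      where open ≤-Reasoning

  pairs-reversed : ∀ {m} {v : Vec Carrier m} {q r i j} → i Fin.< j →
                   Collinear q r (lookup v i) → Collinear q r (lookup v j) →
                   ∃ λ i′ → ∃ λ j′ → i′ Fin.< j′ ×
                     Collinear q r (lookup (reversed v) i′) × Collinear q r (lookup (reversed v) j′)
  pairs-reversed {v = v} {i = i} {j} i<j ci cj =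
    Fin.opposite j , Fin.opposite i , opposite-< i<j , transport j cj , transport i ci
    where
    transport : ∀ l → Collinear _ _ (lookup v l) → Collinear _ _ (lookup (reversed v) (Fin.opposite l))
    transport l = subst (Collinear _ _) (sym (≡-trans (lookup-reversed v (Fin.opposite l))
      (cong (lookup v) (Fin.opposite-involutive l))))

  data Outcome {m} (v : Vec Carrier m) (q r : Carrier) : Set where
    isR : ∀ a → 1 ≤ toℕ a → toℕ a ≤ ⌊ m /2⌋ → Shape v q r a a (rMid a) → Outcome v q r
    isS : Shape v q r zero last sMid → Outcome v q r

  orientedR : ∀ {m} {v : Vec Carrier m} {q r i j k} → Unique (toList v) → Ordered v → i Fin.< j →
    Collinear q r (lookup v i) → Collinear q r (lookup v j) → ¬ Collinear q r (lookup v k) →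
    ∀ {a} → toℕ a ≤ ⌊ m /2⌋ → Slot v q a → Slot v r a → Outcome v q r
  orientedR u o i<j ci cj ¬ck {a} a≤ sq sr = isR a
    (≤-trans (s≤s z≤n) (≤-reflexive (proj₁ neighbours))) a≤ rShape
    where
    open Analysis u o i<j ci cj ¬ck
    open SameSlot sq sr

  differentOutcome : ∀ {m} {v : Vec Carrier m} {q r i j k} → Unique (toList v) → Ordered v → i Fin.< j →
    Collinear q r (lookup v i) → Collinear q r (lookup v j) → ¬ Collinear q r (lookup v k) →
    ∀ {a b} → toℕ a < toℕ b → Slot v q a → Slot v r b → Outcome v q r
  differentOutcome {m} {v} {q} {r} u o i<j ci cj ¬ck {a} {b} a<b sq sr =
    isS (subst₂ (λ a b → Shape v q r a b sMid) (Fin.toℕ-injective a≡0)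
      (Fin.toℕ-injective (≡-trans b≡m (sym (Fin.toℕ-fromℕ m)))) sShape)
    where
    open Analysis u o i<j ci cj ¬ck
    open DifferentSlots a<b sq sr

  opposite-≤-half : ∀ {m} {a : Fin (suc m)} → ¬ (toℕ a ≤ ⌊ m /2⌋) → toℕ (Fin.opposite a) ≤ ⌊ m /2⌋
  opposite-≤-half {m} {a} a≰ = begin
    toℕ (Fin.opposite a)        ≡⟨ Fin.opposite-prop a ⟩
    m ∸ toℕ a                   ≤⟨ ∸-monoʳ-≤ m (≤-trans (⌊n/2⌋-mono (n≤1+n (suc m))) (≰⇒> a≰)) ⟩
    m ∸ ⌈ m /2⌉                 ≡⟨ cong (_∸ ⌈ m /2⌉) (⌊n/2⌋+⌈n/2⌉≡n m) ⟨
    ⌊ m /2⌋ + ⌈ m /2⌉ ∸ ⌈ m /2⌉ ≡⟨ m+n∸n≡m ⌊ m /2⌋ ⌈ m /2⌉ ⟩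
    ⌊ m /2⌋                     ∎
    where open ≤-Reasoning

  Classifiable : ℕ → List Carrier → Set
  Classifiable m ps = ∃ λ (v : Vec Carrier m) → ∃ λ q → ∃ λ r → q ∷ r ∷ toList v ↭ ps × Outcome v q r

  analyse : ∀ {m} (v : Vec Carrier m) {q r} → Unique (q ∷ r ∷ toList v) → Ordered v →
            ∀ {a b} → Slot v q a → Slot v r b →
            0 < tri₁ q r (toList v) → tri₁ q r (toList v) + 2 ≤ m → Classifiable m (q ∷ r ∷ toList v)
  analyse {m} v {q} {r} (_ ∷ _ ∷ u) o {a} {b} sq sr 0< ≤m
    with i , j , i<j , ci , cj ← two-collinear v ≤m
       | k , ¬ck ← a-triangle v 0<
    with <-cmp (toℕ a) (toℕ b)
  ... | tri< a<b _ _ = v , q , r , ↭-refl , differentOutcome u o i<j ci cj ¬ck a<b sq sr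
  ... | tri> _ _ b<a = v , r , q , ↭-swap r q ↭-refl ,
    differentOutcome u o i<j (collinear-swap₁₂ ci) (collinear-swap₁₂ cj) (¬ck ∘ collinear-swap₁₂) b<a sr sq
  ... | tri≈ _ a≡b _ with refl ← Fin.toℕ-injective a≡b with toℕ a ≤? ⌊ m /2⌋
  ...   | yes a≤ = v , q , r , ↭-refl , orientedR u o i<j ci cj ¬ck a≤ sq sr
  ...   | no a≰ with i′ , j′ , i′<j′ , ci′ , cj′ ← pairs-reversed {v = v} i<j ci cj =
    reversed v , q , r , ↭-prep q (↭-prep r (reversed-↭ v u)) ,
    orientedR {k = Fin.opposite k} (unique-resp-↭ (↭-sym (reversed-↭ v u)) u) (ordered-reversed {v = v} o) i′<j′ ci′ cj′
      (¬ck ∘ subst (Collinear q r) (≡-trans (lookup-reversed v (Fin.opposite k))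
        (cong (lookup v) (Fin.opposite-involutive k))))
      (opposite-≤-half a≰) (slot-reversed {v = v} sq) (slot-reversed {v = v} sr)

-- The metrics of R⁴ and S⁴

module _ (G : WeightedGraph) where
  open WeightedGraph G

  -- For a fixed target `d` is a potential: along an edge it drops by at most the weight, so no walk
  -- is shorter than `d`, and the given walks attain it.
  dist-characterisation : (d : Vertex → Vertex → ℕ) → (∀ v → d v v ≡ 0) →
    (∀ u v w → weight u v ≢ 0 → d u w ≤ weight u v + d v w) → (∀ u v → Walk weight u v (d u v)) →
    ∀ u v → dist G u v ≡ d u v
  dist-characterisation d d-refl d-step d-walk u v =
    ≤-antisym (dist-minimal G (d-walk u v)) (bound (dist-walk G u v))
    where
    bound : ∀ {u v k} → Walk weight u v k → d u v ≤ k
    bound nil                    = ≤-reflexive (d-refl _)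
    bound (step {u} {v} {w} e p) = ≤-trans (d-step u v w e) (+-monoʳ-≤ (weight u v) (bound p))

unitStep : ∀ {V : Set} {weight : V → V → ℕ} {u v w k} →
           weight u v ≡ 1 → Walk weight v w k → Walk weight u w (suc k)
unitStep {weight = weight} {k = k} eq p =
  subst (λ e → Walk weight _ _ (e + k)) eq (step (λ e → 1+n≢0 (≡-trans (sym eq) e)) p)

-- R⁴ and S⁴ are metrically a line, except for the distance of y and z.
lineDist : ∀ {m} → (Point m → ℕ) → ℕ → Point m → Point m → ℕ
lineDist pos D y z = D
lineDist pos D z y = D
lineDist pos D u v = ∣ pos u - pos v ∣

-- Positions have no gaps and consecutive ones are joined by unit edges, so the distances on the
-- line are attained by walks; at most `y` and `z` share a position. The last three fields are the
-- triangle inequalities in which the exceptional distance `D` occurs.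
record Line {m} (arc : Point m → Point m → ℕ) (pos : Point m → ℕ) (D : ℕ) : Set where
  d = lineDist pos D
  weight = symmetrize arc
  field
    arc-≤       : ∀ u v → arc u v ≢ 0 → d u v ≤ arc u v
    consecutive : ∀ u v → pos v ≡ suc (pos u) → weight u v ≡ 1
    occupied    : ∀ v k → k < pos v → ∃ λ u → pos u ≡ k
    coincident  : ∀ u v → pos u ≡ pos v → u ≡ v ⊎ (u ≡ y × v ≡ z) ⊎ (u ≡ z × v ≡ y)
    walk-yz     : Walk weight y z D
    triangle-x  : ∀ a → D ≤ ∣ pos y - pos (x a) ∣ + ∣ pos (x a) - pos z ∣
    triangle-z  : ∀ a → ∣ pos y - pos (x a) ∣ ≤ D + ∣ pos z - pos (x a) ∣
    triangle-y  : ∀ a → ∣ pos z - pos (x a) ∣ ≤ D + ∣ pos y - pos (x a) ∣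

  d-refl : ∀ v → d v v ≡ 0
  d-refl (x a) = ∣n-n∣≡0 (pos (x a))
  d-refl y     = ∣n-n∣≡0 (pos y)
  d-refl z     = ∣n-n∣≡0 (pos z)

  d-sym : ∀ u v → d u v ≡ d v u
  d-sym (x a) (x b) = ∣-∣-comm (pos (x a)) (pos (x b))
  d-sym (x a) y     = ∣-∣-comm (pos (x a)) (pos y)
  d-sym (x a) z     = ∣-∣-comm (pos (x a)) (pos z)
  d-sym y     (x b) = ∣-∣-comm (pos y) (pos (x b))
  d-sym y     y     = refl
  d-sym y     z     = refl
  d-sym z     (x b) = ∣-∣-comm (pos z) (pos (x b))
  d-sym z     y     = refl
  d-sym z     z     = refl

  private
    Δ : ∀ u v w → ∣ pos u - pos w ∣ ≤ ∣ pos u - pos v ∣ + ∣ pos v - pos w ∣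
    Δ u v w = ∣-∣-triangle (pos u) (pos v) (pos w)

    0+ : ∀ v k → k ≤ ∣ pos v - pos v ∣ + k
    0+ v k = m≤n+m k ∣ pos v - pos v ∣

    +0 : ∀ v k → k ≤ k + ∣ pos v - pos v ∣
    +0 v k = m≤m+n k ∣ pos v - pos v ∣

  d-triangle : ∀ u v w → d u w ≤ d u v + d v w
  d-triangle (x a) (x b) w     = Δ (x a) (x b) w
  d-triangle (x a) y     (x c) = Δ (x a) y (x c)
  d-triangle (x a) y     y     = Δ (x a) y y
  d-triangle (x a) y     z     = begin
    ∣ pos (x a) - pos z ∣      ≡⟨ ∣-∣-comm (pos (x a)) (pos z) ⟩
    ∣ pos z - pos (x a) ∣      ≤⟨ triangle-y a ⟩
    D + ∣ pos y - pos (x a) ∣  ≡⟨ +-comm D _ ⟩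
    ∣ pos y - pos (x a) ∣ + D  ≡⟨ cong (_+ D) (∣-∣-comm (pos y) (pos (x a))) ⟩
    ∣ pos (x a) - pos y ∣ + D  ∎
    where open ≤-Reasoning
  d-triangle (x a) z     (x c) = Δ (x a) z (x c)
  d-triangle (x a) z     z     = Δ (x a) z z
  d-triangle (x a) z     y     = begin
    ∣ pos (x a) - pos y ∣      ≡⟨ ∣-∣-comm (pos (x a)) (pos y) ⟩
    ∣ pos y - pos (x a) ∣      ≤⟨ triangle-z a ⟩
    D + ∣ pos z - pos (x a) ∣  ≡⟨ +-comm D _ ⟩
    ∣ pos z - pos (x a) ∣ + D  ≡⟨ cong (_+ D) (∣-∣-comm (pos z) (pos (x a))) ⟩
    ∣ pos (x a) - pos z ∣ + D  ∎
    where open ≤-Reasoning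
  d-triangle y     (x b) (x c) = Δ y (x b) (x c)
  d-triangle y     (x b) y     = Δ y (x b) y
  d-triangle y     (x b) z     = triangle-x b
  d-triangle y     y     (x c) = Δ y y (x c)
  d-triangle y     y     y     = Δ y y y
  d-triangle y     y     z     = 0+ y D
  d-triangle y     z     (x c) = triangle-z c
  d-triangle y     z     y     = subst (_≤ D + D) (sym (∣n-n∣≡0 (pos y))) z≤n
  d-triangle y     z     z     = +0 z D
  d-triangle z     (x b) (x c) = Δ z (x b) (x c)
  d-triangle z     (x b) z     = Δ z (x b) z
  d-triangle z     (x b) y     = begin
    D                                                ≤⟨ triangle-x b ⟩
    ∣ pos y - pos (x b) ∣ + ∣ pos (x b) - pos z ∣    ≡⟨ +-comm ∣ pos y - pos (x b) ∣ _ ⟩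
    ∣ pos (x b) - pos z ∣ + ∣ pos y - pos (x b) ∣    ≡⟨ cong₂ _+_ (∣-∣-comm (pos (x b)) (pos z)) (∣-∣-comm (pos y) (pos (x b))) ⟩
    ∣ pos z - pos (x b) ∣ + ∣ pos (x b) - pos y ∣    ∎
    where open ≤-Reasoning
  d-triangle z     z     (x c) = Δ z z (x c)
  d-triangle z     z     z     = Δ z z z
  d-triangle z     z     y     = 0+ z D
  d-triangle z     y     (x c) = triangle-y c
  d-triangle z     y     z     = subst (_≤ D + D) (sym (∣n-n∣≡0 (pos z))) z≤n
  d-triangle z     y     y     = +0 y D

  d-step : ∀ u v w → weight u v ≢ 0 → d u w ≤ weight u v + d v w
  d-step u v w e = ≤-trans (d-triangle u v w) (+-monoˡ-≤ (d v w) d≤)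
    where
    d≤ : d u v ≤ weight u v
    d≤ with arc u v ≟ 0
    ... | no ne = ≤-trans (arc-≤ u v ne) (m≤m⊔n (arc u v) (arc v u))
    ... | yes eq = ≤-trans (≤-reflexive (d-sym u v)) (≤-trans (arc-≤ v u λ eq′ → e (cong₂ _⊔_ eq eq′))
                     (m≤n⊔m (arc u v) (arc v u)))

  walkUp : ∀ k u v → pos v ≡ suc k + pos u → Walk weight u v (suc k)
  walkUp zero    u v eq = unitStep (consecutive u v eq) nil
  walkUp (suc k) u v eq =
    let w , w≡ = occupied v (suc (pos u)) (subst (suc (pos u) <_) (sym eq) (s≤s (s≤s (m≤n+m (pos u) k))))
    in unitStep (consecutive u w w≡) (walkUp k w v (≡-trans eq (≡-trans (sym (+-suc (suc k) (pos u))) (cong (suc k +_) (sym w≡)))))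

  walk-< : ∀ u v → pos u < pos v → Walk weight u v ∣ pos u - pos v ∣
  walk-< u v lt = subst (Walk weight u v) length≡ (walkUp (pos v ∸ suc (pos u)) u v pos≡)
    where
    pos≡ : pos v ≡ suc (pos v ∸ suc (pos u)) + pos u
    pos≡ = ≡-trans (sym (m∸n+n≡m lt)) (+-suc _ (pos u))
    length≡ : suc (pos v ∸ suc (pos u)) ≡ ∣ pos u - pos v ∣
    length≡ = ≡-trans (sym (+-∸-assoc 1 lt)) (sym (m≤n⇒∣m-n∣≡n∸m (<⇒≤ lt)))

  walk-line : ∀ u v → pos u ≢ pos v → Walk weight u v ∣ pos u - pos v ∣
  walk-line u v ne with <-cmp (pos u) (pos v)
  ... | tri< lt _ _ = walk-< u v lt
  ... | tri≈ _ eq _ = contradiction eq ne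
  ... | tri> _ _ gt = subst (Walk weight u v) (∣-∣-comm (pos v) (pos u))
    (reverseʷ (symmetrize-sym arc) (walk-< v u gt))

  walk-zero : ∀ u → Walk weight u u ∣ pos u - pos u ∣
  walk-zero u = subst (Walk weight u u) (sym (∣n-n∣≡0 (pos u))) nil

  x≢ : ∀ a v → x a ≢ v → pos (x a) ≢ pos v
  x≢ a v ne eq with coincident (x a) v eq
  ... | inj₁ eq′ = ne eq′
  ... | inj₂ (inj₁ ())
  ... | inj₂ (inj₂ ())

  d-walk : ∀ u v → Walk weight u v (d u v)
  d-walk (x a) (x b) with a Fin.≟ b
  ... | yes refl = walk-zero (x a)
  ... | no a≢b   = walk-line (x a) (x b) (x≢ a (x b) λ { refl → a≢b refl })
  d-walk (x a) y     = walk-line (x a) y (x≢ a y λ ())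
  d-walk (x a) z     = walk-line (x a) z (x≢ a z λ ())
  d-walk y     (x b) = walk-line y (x b) (x≢ b y (λ ()) ∘ sym)
  d-walk y     y     = walk-zero y
  d-walk y     z     = walk-yz
  d-walk z     (x b) = walk-line z (x b) (x≢ b z (λ ()) ∘ sym)
  d-walk z     y     = reverseʷ (symmetrize-sym arc) walk-yz
  d-walk z     z     = walk-zero z

𝟙-witness : ∀ {P : Set} (P? : Dec P) → 𝟙 P? ≢ 0 → P
𝟙-witness (yes p) _ = p
𝟙-witness (no _)  n = contradiction refl n

𝟙≡1 : ∀ {P : Set} (P? : Dec P) → P → 𝟙 P? ≡ 1
𝟙≡1 (yes _) _ = refl
𝟙≡1 (no ¬p) p = contradiction p ¬p

𝟙≤1 : ∀ {P : Set} (P? : Dec P) → 𝟙 P? ≤ 1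
𝟙≤1 (yes _) = ≤-refl
𝟙≤1 (no _)  = z≤n

∣n-1+n∣≡1 : ∀ n → ∣ n - suc n ∣ ≡ 1
∣n-1+n∣≡1 zero    = refl
∣n-1+n∣≡1 (suc n) = ∣n-1+n∣≡1 n

∣1+n-n∣≡1 : ∀ n → ∣ suc n - n ∣ ≡ 1
∣1+n-n∣≡1 n = ≡-trans (∣-∣-comm (suc n) n) (∣n-1+n∣≡1 n)

≤-𝟙 : ∀ {P : Set} {k} (P? : Dec P) → 𝟙 P? ≢ 0 → k ≡ 1 → k ≤ 𝟙 P?
≤-𝟙 P? n refl = ≤-reflexive (sym (𝟙≡1 P? (𝟙-witness P? n)))

module R {m} (i : ℕ) (1≤i : 1 ≤ i) (i<m : i < m) where

  -- The path vertices with subscripts `i` and `i` + 1 get positions `i` - 1 and `i` + 1, and `y`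
  -- and `z` share the gap between them. As `toℕ` is one less than the subscript, the later vertices
  -- shift and the earlier ones do not.
  pos : Point m → ℕ
  pos (x a) with toℕ a <? i
  ... | yes _ = toℕ a
  ... | no _  = suc (toℕ a)
  pos y = i
  pos z = i

  pos-< : ∀ {a} → toℕ a < i → pos (x a) ≡ toℕ a
  pos-< {a} a<i with toℕ a <? i
  ... | yes _  = refl
  ... | no a≮i = contradiction a<i a≮i

  pos-≥ : ∀ {a} → i ≤ toℕ a → pos (x a) ≡ suc (toℕ a)
  pos-≥ {a} i≤a with toℕ a <? i
  ... | yes a<i = contradiction a<i (≤⇒≯ i≤a)
  ... | no _    = refl

  arc : Point m → Point m → ℕ
  arc = R⁴-arcs (2 + m) i

  d : Point m → Point m → ℕ
  d = lineDist pos 2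

  d-consecutive : ∀ {p q} → q ≡ suc p → ∣ p - q ∣ ≡ 1
  d-consecutive {p} refl = ∣n-1+n∣≡1 p

  d-consecutive′ : ∀ {p q} → p ≡ suc q → ∣ p - q ∣ ≡ 1
  d-consecutive′ {q = q} refl = ∣1+n-n∣≡1 q

  pos-next : ∀ {a b} → sub b ≡ suc (sub a) → sub a ≢ i → pos (x b) ≡ suc (pos (x a))
  pos-next {a} {b} eq ne with <-cmp (suc (toℕ a)) i
  ... | tri< a<i _ _ = ≡-trans (pos-< (subst (_< i) (sym (suc-injective eq)) a<i))
    (≡-trans (suc-injective eq) (cong suc (sym (pos-< (≤-trans (n≤1+n _) a<i)))))
  ... | tri≈ _ eq′ _ = contradiction eq′ ne
  ... | tri> _ _ i≤a = ≡-trans (pos-≥ (≤-trans (<⇒≤ i≤a) (≤-reflexive (sym (suc-injective eq)))))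
    (≡-trans eq (cong suc (sym (pos-≥ (s≤s⁻¹ i≤a)))))

  pos-left : ∀ {a} → sub a ≡ i → i ≡ suc (pos (x a))
  pos-left eq = ≡-trans (sym eq) (cong suc (sym (pos-< (≤-reflexive eq))))

  pos-right : ∀ {a} → sub a ≡ suc i → pos (x a) ≡ suc i
  pos-right eq = ≡-trans (pos-≥ (≤-reflexive (sym (suc-injective eq)))) eq

  near : ∀ {a} → sub a ≡ i ⊎ sub a ≡ suc i → ∣ i - pos (x a) ∣ ≡ 1
  near (inj₁ eq) = d-consecutive′ (pos-left eq)
  near (inj₂ eq) = d-consecutive (pos-right eq)

  arc-≤ : ∀ u v → arc u v ≢ 0 → d u v ≤ arc u v
  arc-≤ (x a) (x b) n = let eq , ne = 𝟙-witness _ n in ≤-𝟙 _ n (d-consecutive (pos-next eq ne))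
  arc-≤ (x a) y     n = contradiction refl n
  arc-≤ (x a) z     n = contradiction refl n
  arc-≤ y     (x b) n = ≤-𝟙 _ n (near (𝟙-witness _ n))
  arc-≤ z     (x b) n = ≤-𝟙 _ n (near (𝟙-witness _ n))
  arc-≤ y     y     n = contradiction refl n
  arc-≤ y     z     n = contradiction refl n
  arc-≤ z     y     n = contradiction refl n
  arc-≤ z     z     n = contradiction refl n

  pos-cancel : ∀ {a b} → pos (x b) ≡ suc (pos (x a)) → sub b ≡ suc (sub a) × sub a ≢ i
  pos-cancel {a} {b} eq with toℕ a <? i | toℕ b <? i
  ... | yes a<i | yes b<i = cong suc eq , λ eq′ → <⇒≢ b<i (≡-trans eq eq′)
  ... | yes a<i | no b≮i  = contradiction (subst (_< i) (sym (suc-injective eq)) a<i) b≮i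
  ... | no a≮i  | yes b<i = contradiction (<-trans (≤-reflexive (sym (≡-trans eq refl))) (≤-trans b<i ≤-refl))
    (λ a<i → a≮i (≤-trans (n≤1+n _) a<i))
  ... | no a≮i  | no b≮i  = eq , λ eq′ → a≮i (≤-reflexive eq′)

  pos-cancel-left : ∀ {a} → i ≡ suc (pos (x a)) → sub a ≡ i
  pos-cancel-left {a} eq with toℕ a <? i
  ... | yes _  = sym eq
  ... | no a≮i = contradiction (≤-trans (n≤1+n _) (≤-reflexive (sym eq))) a≮i

  pos-cancel-right : ∀ {a} → pos (x a) ≡ suc i → sub a ≡ suc i
  pos-cancel-right {a} eq with toℕ a <? i
  ... | yes a<i = contradiction (subst (_< i) eq a<i) (<⇒≯ (n<1+n i))
  ... | no _    = eq

  consecutive : ∀ u v → pos v ≡ suc (pos u) → symmetrize arc u v ≡ 1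
  consecutive (x a) (x b) eq =
    ≡-trans (m≥n⇒m⊔n≡m (≤-trans (𝟙≤1 (xx? b a)) (≤-reflexive (sym xx≡1)))) xx≡1
    where
    xx? : ∀ a b → Dec (sub b ≡ suc (sub a) × sub a ≢ i)
    xx? a b = sub b ≟ suc (sub a) ×-dec ¬? (sub a ≟ i)
    xx≡1 : arc (x a) (x b) ≡ 1
    xx≡1 = 𝟙≡1 (xx? a b) (pos-cancel eq)
  consecutive (x a) y     eq = 𝟙≡1 _ (inj₁ (pos-cancel-left eq))
  consecutive (x a) z     eq = 𝟙≡1 _ (inj₁ (pos-cancel-left eq))
  consecutive y     (x b) eq = ≡-trans (⊔-identityʳ _) (𝟙≡1 _ (inj₂ (pos-cancel-right eq)))
  consecutive z     (x b) eq = ≡-trans (⊔-identityʳ _) (𝟙≡1 _ (inj₂ (pos-cancel-right eq)))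
  consecutive y     y     eq = contradiction (sym eq) 1+n≢n
  consecutive y     z     eq = contradiction (sym eq) 1+n≢n
  consecutive z     y     eq = contradiction (sym eq) 1+n≢n
  consecutive z     z     eq = contradiction (sym eq) 1+n≢n

  pos≤m : ∀ v → pos v ≤ m
  pos≤m (x a) with toℕ a <? i
  ... | yes _ = <⇒≤ (Fin.toℕ<n a)
  ... | no _  = Fin.toℕ<n a
  pos≤m y = <⇒≤ i<m
  pos≤m z = <⇒≤ i<m

  occupied : ∀ v k → k < pos v → ∃ λ u → pos u ≡ k
  occupied v k k<v with <-cmp k i
  ... | tri< k<i _ _ = x (Fin.fromℕ< k<m) , ≡-trans (pos-< (subst (_< i) (sym eq) k<i)) eq
    where
    k<m = <-trans k<i i<m
    eq = Fin.toℕ-fromℕ< k<m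
  ... | tri≈ _ refl _ = y , refl
  occupied v (suc k) k<v | tri> _ _ i<k = x (Fin.fromℕ< k<m) ,
    ≡-trans (pos-≥ (subst (i ≤_) (sym eq) (s≤s⁻¹ i<k))) (cong suc eq)
    where
    k<m = ≤-trans (<⇒≤ k<v) (pos≤m v)
    eq = Fin.toℕ-fromℕ< k<m

  pos-x≢i : ∀ a → pos (x a) ≢ i
  pos-x≢i a eq with toℕ a <? i
  ... | yes a<i = <⇒≢ a<i eq
  ... | no a≮i  = a≮i (≤-reflexive eq)

  coincident : ∀ u v → pos u ≡ pos v → u ≡ v ⊎ (u ≡ y × v ≡ z) ⊎ (u ≡ z × v ≡ y)
  coincident (x a) (x b) eq with toℕ a <? i | toℕ b <? i
  ... | yes _   | yes _   = inj₁ (cong x (Fin.toℕ-injective eq))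
  ... | yes a<i | no b≮i  = contradiction (≤-trans (≤-reflexive (sym eq)) (<⇒≤ a<i)) b≮i
  ... | no a≮i  | yes b<i = contradiction (≤-trans (≤-reflexive eq) (<⇒≤ b<i)) a≮i
  ... | no _    | no _    = inj₁ (cong x (Fin.toℕ-injective (suc-injective eq)))
  coincident (x a) y     eq = contradiction eq (pos-x≢i a)
  coincident (x a) z     eq = contradiction eq (pos-x≢i a)
  coincident y     (x b) eq = contradiction (sym eq) (pos-x≢i b)
  coincident z     (x b) eq = contradiction (sym eq) (pos-x≢i b)
  coincident y     y     _  = inj₁ refl
  coincident y     z     _  = inj₂ (inj₁ (refl , refl))
  coincident z     y     _  = inj₂ (inj₂ (refl , refl))
  coincident z     z     _  = inj₁ refl

  xᵢ : Fin m
  xᵢ = Fin.fromℕ< (≤-<-trans pred[n]≤n i<m)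

  sub-xᵢ : sub xᵢ ≡ i
  sub-xᵢ = ≡-trans (cong suc (Fin.toℕ-fromℕ< (≤-<-trans pred[n]≤n i<m))) (suc-pred i {{>-nonZero 1≤i}})

  line : Line arc pos 2
  line = record
    { arc-≤       = arc-≤
    ; consecutive = consecutive
    ; occupied    = occupied
    ; coincident  = coincident
    ; walk-yz     = unitStep {weight = symmetrize arc} {v = x xᵢ}
                      (≡-trans (symmetrize-sym arc y (x xᵢ)) (consecutive (x xᵢ) y (pos-left sub-xᵢ)))
                      (unitStep {v = z} (consecutive (x xᵢ) z (pos-left sub-xᵢ)) nil)
    ; triangle-x  = λ a → +-mono-≤ (n≢0⇒n>0 (pos-x≢i a ∘ sym ∘ ∣m-n∣≡0⇒m≡n))
                                   (n≢0⇒n>0 (pos-x≢i a ∘ ∣m-n∣≡0⇒m≡n))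
    ; triangle-z  = λ a → m≤n+m _ 2
    ; triangle-y  = λ a → m≤n+m _ 2
    }

module S {m} (2≤m : 2 ≤ m) where

  -- Here n is `m` + 3. The heavy edge has weight `m`, two less than the distance along the path
  -- between its ends, so it is a shortcut.
  pos : Point (suc m) → ℕ
  pos (x a) = suc (toℕ a)
  pos y = 0
  pos z = 2 + m

  arc : Point (suc m) → Point (suc m) → ℕ
  arc = S⁴-arcs (3 + m)

  d : Point (suc m) → Point (suc m) → ℕ
  d = lineDist pos m

  arc-≤ : ∀ u v → arc u v ≢ 0 → d u v ≤ arc u v
  arc-≤ (x a) (x b) n = ≤-𝟙 _ n (≡-trans (cong ∣ suc (toℕ a) -_∣ (𝟙-witness _ n)) (∣n-1+n∣≡1 (suc (toℕ a))))
  arc-≤ (x a) y     n = contradiction refl n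
  arc-≤ (x a) z     n = contradiction refl n
  arc-≤ y     (x b) n = ≤-𝟙 _ n (𝟙-witness _ n)
  arc-≤ z     (x b) n = ≤-𝟙 _ n (≡-trans (cong ∣ 2 + m -_∣ (𝟙-witness _ n)) (∣1+n-n∣≡1 (suc m)))
  arc-≤ y     y     n = contradiction refl n
  arc-≤ y     z     n = ≤-refl
  arc-≤ z     y     n = contradiction refl n
  arc-≤ z     z     n = contradiction refl n

  consecutive : ∀ u v → pos v ≡ suc (pos u) → symmetrize arc u v ≡ 1
  consecutive (x a) (x b) eq =
    ≡-trans (m≥n⇒m⊔n≡m (≤-trans (𝟙≤1 (sub a ≟ suc (sub b))) (≤-reflexive (sym xx≡1)))) xx≡1
    where
    xx≡1 : arc (x a) (x b) ≡ 1
    xx≡1 = 𝟙≡1 (sub b ≟ suc (sub a)) eq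
  consecutive (x a) z     eq = 𝟙≡1 (sub a ≟ suc m) (sym (suc-injective eq))
  consecutive y     (x b) eq = ≡-trans (⊔-identityʳ _) (𝟙≡1 (sub b ≟ 1) eq)
  consecutive z     (x b) eq = contradiction (subst (_< suc m) (suc-injective eq) (Fin.toℕ<n b)) (<⇒≯ (n<1+n (suc m)))
  consecutive z     z     eq = contradiction (sym eq) 1+n≢n

  pos≤ : ∀ v → pos v ≤ 2 + m
  pos≤ (x a) = ≤-trans (Fin.toℕ<n a) (n≤1+n _)
  pos≤ y     = z≤n
  pos≤ z     = ≤-refl

  occupied : ∀ v k → k < pos v → ∃ λ u → pos u ≡ k
  occupied v zero    _   = y , refl
  occupied v (suc k) k<v = x (Fin.fromℕ< k<m) , cong suc (Fin.toℕ-fromℕ< k<m)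
    where
    k<m : k < suc m
    k<m = s≤s⁻¹ (≤-trans k<v (pos≤ v))

  coincident : ∀ u v → pos u ≡ pos v → u ≡ v ⊎ (u ≡ y × v ≡ z) ⊎ (u ≡ z × v ≡ y)
  coincident (x a) (x b) eq = inj₁ (cong x (Fin.toℕ-injective (suc-injective eq)))
  coincident (x a) z     eq = contradiction (suc-injective eq) (<⇒≢ (Fin.toℕ<n a))
  coincident z     (x b) eq = contradiction (sym (suc-injective eq)) (<⇒≢ (Fin.toℕ<n b))
  coincident y     y     _  = inj₁ refl
  coincident z     z     _  = inj₁ refl

  weight-yz : symmetrize arc y z ≡ m
  weight-yz = ⊔-identityʳ m

  line : Line arc pos m
  line = record
    { arc-≤       = arc-≤
    ; consecutive = consecutive
    ; occupied    = occupied
    ; coincident  = coincident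
    ; walk-yz     = subst (Walk (symmetrize arc) y z) weight-yz
                      (edgeʷ λ eq → n≮0 (≤-trans 2≤m (≤-reflexive (≡-trans (sym weight-yz) eq))))
    ; triangle-x  = λ a → ≤-trans (m≤n+m m 2) (∣-∣-triangle 0 (suc (toℕ a)) (2 + m))
    ; triangle-z  = λ a → ≤-trans (Fin.toℕ<n a) (≤-trans (≤-reflexive (+-comm 1 m)) (+-monoʳ-≤ m
                      (n≢0⇒n>0 λ eq → <⇒≢ (Fin.toℕ<n a) (suc-injective (sym (∣m-n∣≡0⇒m≡n {2 + m} eq))))))
    ; triangle-y  = λ a → ≤-trans (∣m-n∣≤m⊔n (suc m) (toℕ a)) (≤-trans
                      (≤-reflexive (m≥n⇒m⊔n≡m (<⇒≤ (Fin.toℕ<n a))))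
                      (≤-trans (≤-reflexive (+-comm 1 m)) (+-monoʳ-≤ m (s≤s z≤n))))
    }

-- The shapes and triangles of R⁴ and S⁴

module ShapeCount (B : BetweennessStructure) where
  open Shapes B public

  ordered⇒linear : ∀ {n} {v : Vec Carrier n} → Ordered v → Linear (toList v)
  ordered⇒linear {v = v} o p∈ q∈ r∈
    with i , refl ← ∈⇒lookup {v = v} p∈
       | j , refl ← ∈⇒lookup {v = v} q∈
       | k , refl ← ∈⇒lookup {v = v} r∈
    with Fin.<-cmp i j | Fin.<-cmp j k | Fin.<-cmp i k
  ... | tri≈ _ refl _ | _ | _ = collinear-refl₁₂
  ... | _ | tri≈ _ refl _ | _ = collinear-refl₂₃
  ... | _ | _ | tri≈ _ refl _ = collinear-refl₁₃
  ... | tri< i<j _ _ | tri< j<k _ _ | _            = col₂ (o i j k i<j j<k)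
  ... | tri< i<j _ _ | tri> _ _ k<j | tri< i<k _ _ = col₃ (o i k j i<k k<j)
  ... | tri< i<j _ _ | tri> _ _ k<j | tri> _ _ k<i = col₁ (P2 _ _ _ (o k i j k<i i<j))
  ... | tri> _ _ j<i | tri< j<k _ _ | tri< i<k _ _ = col₁ (o j i k j<i i<k)
  ... | tri> _ _ j<i | tri< j<k _ _ | tri> _ _ k<i = col₃ (P2 _ _ _ (o j k i j<k k<i))
  ... | tri> _ _ j<i | tri> _ _ k<j | _            = col₂ (P2 _ _ _ (o k j i k<j j<i))

  slot⇒linear : ∀ {n} {v : Vec Carrier n} {p a} → Ordered v → Slot v p a → Linear (p ∷ toList v)
  slot⇒linear {v = v} {p} {a} o s = linear-resp-↭ (insertAt-↭ v a p)
    (ordered⇒linear {v = insertAt v a p} (ordered-insertAt v a o s))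

  t≤1 : ∀ p q r → t p q r ≤ 1
  t≤1 p q r = 𝟙≤1 (¬? (collinear? p q r))

  tri₁≤ : ∀ {n q r} (v : Vec Carrier n) → tri₁ q r (toList v) ≤ n
  tri₁≤ []              = z≤n
  tri₁≤ {q = q} {r} (s ∷ v) = +-mono-≤ (t≤1 q r s) (tri₁≤ v)

  tri₁+1≤ : ∀ {n q r} (v : Vec Carrier n) {i} → Collinear q r (lookup v i) → tri₁ q r (toList v) + 1 ≤ n
  tri₁+1≤ {q = q} {r} (s ∷ v) {zero} c rewrite t≡0 c =
    ≤-trans (≤-reflexive (+-comm _ 1)) (s≤s (tri₁≤ v))
  tri₁+1≤ {q = q} {r} (s ∷ v) {suc i} c = ≤-trans (≤-reflexive (+-assoc (t q r s) _ 1))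
    (+-mono-≤ (t≤1 q r s) (tri₁+1≤ v c))

  tri₁+2≤ : ∀ {n q r} (v : Vec Carrier n) {i j} → i Fin.< j → Collinear q r (lookup v i) →
            Collinear q r (lookup v j) → tri₁ q r (toList v) + 2 ≤ n
  tri₁+2≤ {q = q} {r} (s ∷ v) {zero} {suc j} _ ci cj rewrite t≡0 ci =
    ≤-trans (≤-reflexive (+-suc _ 1)) (s≤s (tri₁+1≤ v cj))
  tri₁+2≤ {q = q} {r} (s ∷ v) {suc i} {suc j} i<j ci cj = ≤-trans (≤-reflexive (+-assoc (t q r s) _ 2))
    (+-mono-≤ (t≤1 q r s) (tri₁+2≤ v (s<s⁻¹ i<j) ci cj))

  tri₁-positive : ∀ {n q r} (v : Vec Carrier n) {k} → ¬ Collinear q r (lookup v k) → 0 < tri₁ q r (toList v)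
  tri₁-positive {q = q} {r} (s ∷ v) {zero}  ¬c rewrite t≡1 ¬c = z<s
  tri₁-positive {q = q} {r} (s ∷ v) {suc k} ¬c = ≤-trans (tri₁-positive v ¬c) (m≤n+m _ (t q r s))

  shape-tri : ∀ {n} {v : Vec Carrier n} {q r a b f} → Shape v q r a b f → ∀ {i j k} → i Fin.< j →
              Collinear q r (lookup v i) → Collinear q r (lookup v j) → ¬ Collinear q r (lookup v k) →
              0 < tri (q ∷ r ∷ toList v) × tri (q ∷ r ∷ toList v) + 2 ≤ n
  shape-tri {v = v} s i<j ci cj ¬ck rewrite tri-linear (slot⇒linear {v = v} (Shape.ordered s) (Shape.slot-q s))
    (slot⇒linear {v = v} (Shape.ordered s) (Shape.slot-r s)) =
    tri₁-positive v ¬ck , tri₁+2≤ v i<j ci cj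

∣-∣-additive : ∀ {p q r} → p ≤ q → q ≤ r → ∣ p - r ∣ ≡ ∣ p - q ∣ + ∣ q - r ∣
∣-∣-additive {p} {q} {r} p≤q q≤r = begin
  ∣ p - r ∣              ≡⟨ m≤n⇒∣m-n∣≡n∸m (≤-trans p≤q q≤r) ⟩
  r ∸ p                  ≡⟨ cong (_∸ p) (m+[n∸m]≡n q≤r) ⟨
  q + (r ∸ q) ∸ p        ≡⟨ +-∸-comm (r ∸ q) p≤q ⟩
  (q ∸ p) + (r ∸ q)      ≡⟨ cong₂ _+_ (m≤n⇒∣m-n∣≡n∸m p≤q) (m≤n⇒∣m-n∣≡n∸m q≤r) ⟨
  ∣ p - q ∣ + ∣ q - r ∣  ∎
  where open ≡-Reasoning

-- The proofs of looplessness and connectedness are parameters; instantiated with those of a listed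
-- graph, they make `graph` equal to it by definition.
module LineGraph {m} {arc : Point m → Point m → ℕ} {pos D} (L : Line arc pos D)
                 (l : ∀ v → symmetrize arc v v ≡ 0) (c : Connected (symmetrize arc)) where
  open Line L

  graph : WeightedGraph
  graph = record
    { Vertex    = Point m
    ; finite    = pointFinite m
    ; nonEmpty  = _
    ; weight    = symmetrize arc
    ; symmetric = symmetrize-sym arc
    ; loopless  = l
    ; connected = c
    }

  open ShapeCount (induced graph) public

  dist≡ : ∀ u v → dist graph u v ≡ d u v
  dist≡ = dist-characterisation graph d d-refl d-step d-walk

  β-intro : ∀ {u v w} → d u w ≡ d u v + d v w → β u v w
  β-intro {u} {v} {w} eq = ≡-trans (dist≡ u w) (≡-trans eq (sym (cong₂ _+_ (dist≡ u v) (dist≡ v w))))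

  β-elim : ∀ {u v w} → β u v w → d u w ≡ d u v + d v w
  β-elim {u} {v} {w} b = ≡-trans (sym (dist≡ u w)) (≡-trans b (cong₂ _+_ (dist≡ u v) (dist≡ v w)))

  xs : Vec (Point m) m
  xs = tabulate x

  module _ (mono : ∀ {a b} → a Fin.< b → pos (x a) ≤ pos (x b)) where

    xs-ordered : Ordered xs
    xs-ordered i j k i<j j<k
      rewrite lookup∘tabulate {A = Point m} x i | lookup∘tabulate {A = Point m} x j | lookup∘tabulate {A = Point m} x k =
      β-intro (∣-∣-additive (mono i<j) (mono j<k))

    xs-slot : ∀ s a → (∀ b → d (x b) s ≡ ∣ pos (x b) - pos s ∣) → (∀ b → d s (x b) ≡ ∣ pos s - pos (x b) ∣) →
              (∀ b → toℕ b < toℕ a → pos (x b) ≤ pos s) → (∀ b → toℕ a ≤ toℕ b → pos s ≤ pos (x b)) →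
              Slot xs s a
    xs-slot s a xs≡ sx≡ below above = record { before = before ; across = across ; after = after }
      where
      before : ∀ i j → i Fin.< j → toℕ j < toℕ a → β (lookup xs i) (lookup xs j) s
      before i j i<j j<a rewrite lookup∘tabulate {A = Point m} x i | lookup∘tabulate {A = Point m} x j =
        β-intro (≡-trans (xs≡ i) (≡-trans (∣-∣-additive (mono i<j) (below j j<a)) (cong (d (x i) (x j) +_) (sym (xs≡ j)))))
      across : ∀ i j → toℕ i < toℕ a → toℕ a ≤ toℕ j → β (lookup xs i) s (lookup xs j)
      across i j i<a a≤j rewrite lookup∘tabulate {A = Point m} x i | lookup∘tabulate {A = Point m} x j =
        β-intro (≡-trans (∣-∣-additive (below i i<a) (above j a≤j)) (cong₂ _+_ (sym (xs≡ i)) (sym (sx≡ j))))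
      after : ∀ i j → toℕ a ≤ toℕ i → i Fin.< j → β s (lookup xs i) (lookup xs j)
      after i j a≤i i<j rewrite lookup∘tabulate {A = Point m} x i | lookup∘tabulate {A = Point m} x j =
        β-intro (≡-trans (sx≡ j) (≡-trans (∣-∣-additive (above i a≤i) (mono i<j)) (cong (_+ d (x i) (x j)) (sym (sx≡ i)))))

module RShape {m} (i : ℕ) (1≤i : 1 ≤ i) (i<m : i < m)
              (l : ∀ v → symmetrize (R⁴-arcs (2 + m) i) v v ≡ 0) (c : Connected (symmetrize (R⁴-arcs (2 + m) i))) where
  open R i 1≤i i<m
  open LineGraph line l c public

  mono : ∀ {a b} → a Fin.< b → pos (x a) ≤ pos (x b)
  mono {a} {b} a<b with toℕ a <? i | toℕ b <? i
  ... | yes _  | yes _   = <⇒≤ a<b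
  ... | yes _  | no _    = ≤-trans (<⇒≤ a<b) (n≤1+n _)
  ... | no a≮i | yes b<i = contradiction (<-trans a<b b<i) a≮i
  ... | no _   | no _    = s≤s (<⇒≤ a<b)

  place : Fin (suc m)
  place = Fin.fromℕ< (m<n⇒m<1+n i<m)

  place≡ : toℕ place ≡ i
  place≡ = Fin.toℕ-fromℕ< (m<n⇒m<1+n i<m)

  below : ∀ b → toℕ b < toℕ place → pos (x b) ≤ i
  below b b<a = ≤-trans (≤-reflexive (pos-< (subst (toℕ b <_) place≡ b<a))) (<⇒≤ (subst (toℕ b <_) place≡ b<a))

  above : ∀ b → toℕ place ≤ toℕ b → i ≤ pos (x b)
  above b a≤b = ≤-trans (≤-trans (subst (_≤ toℕ b) place≡ a≤b) (n≤1+n _))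
    (≤-reflexive (sym (pos-≥ (subst (_≤ toℕ b) place≡ a≤b))))

  near-middle : ∀ {b} → sub b ≡ i ⊎ sub b ≡ suc i → β y (x b) z
  near-middle {b} h = β-intro {y} {x b} {z} (sym (cong₂ _+_ (near h) (≡-trans (∣-∣-comm (pos (x b)) i) (near h))))

  -- `y` and `z` are equally far from `x b`, so neither lies between `x b` and the other. A point
  -- between them would halve their distance 2 and thus be next to position `i`.
  far-triangle : ∀ {b} → sub b ≢ i → sub b ≢ suc i → ¬ Collinear y z (x b)
  far-triangle {b} ≢i ≢1+i col with middle col
  ... | mid₁ e = m≢1+n+m _ (β-elim {z} {y} {x b} e)
  ... | mid₂ e = m≢1+n+m _ (β-elim {y} {z} {x b} e)
  ... | mid₃ e = not-1 (half (≡-trans (β-elim {y} {x b} {z} e)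
                   (cong (∣ i - pos (x b) ∣ +_) (∣-∣-comm (pos (x b)) i))))
    where
    half : ∀ {k} → 2 ≡ k + k → k ≡ 1
    half {suc zero}    _  = refl
    half {suc (suc k)} eq = contradiction (≡-trans (suc-injective (suc-injective eq)) (+-suc k (suc k))) λ ()
    split : ∀ p q → ∣ p - q ∣ ≡ 1 → p ≡ suc q ⊎ q ≡ suc p
    split zero    (suc zero) refl = inj₂ refl
    split (suc zero) zero    refl = inj₁ refl
    split (suc p) (suc q)    eq   with split p q eq
    ... | inj₁ e = inj₁ (cong suc e)
    ... | inj₂ e = inj₂ (cong suc e)
    not-1 : ∣ i - pos (x b) ∣ ≢ 1
    not-1 eq with split i (pos (x b)) eq
    ... | inj₁ e = ≢i (pos-cancel-left e)
    ... | inj₂ e = ≢1+i (pos-cancel-right e)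

  shape : Shape xs y z place place (rMid place)
  shape = record
    { ordered = xs-ordered mono
    ; slot-q  = xs-slot mono y place (λ _ → refl) (λ _ → refl) below above
    ; slot-r  = xs-slot mono z place (λ _ → refl) (λ _ → refl) below above
    ; mids    = mids
    }
    where
    mids : ∀ j → IsMid y z (lookup xs j) (rMid place j)
    mids j rewrite lookup∘tabulate {A = Point m} x j with suc (toℕ j) ≟ toℕ place | toℕ j ≟ toℕ place
    ... | yes eq | _ rewrite dec-true (suc (toℕ j) ≟ toℕ place) eq = is₃ (near-middle (inj₁ (≡-trans eq place≡)))
    ... | no neq | yes eq rewrite dec-false (suc (toℕ j) ≟ toℕ place) neq | dec-true (toℕ j ≟ toℕ place) eq =
      is₃ (near-middle (inj₂ (cong suc (≡-trans eq place≡))))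
    ... | no neq | no neq′ rewrite dec-false (suc (toℕ j) ≟ toℕ place) neq | dec-false (toℕ j ≟ toℕ place) neq′ =
      isₙ (far-triangle (λ eq → neq (≡-trans eq (sym place≡))) (λ eq → neq′ (≡-trans (suc-injective eq) (sym place≡))))

  col-x : ∀ b → Collinear y z (x b) → Collinear y z (lookup xs b)
  col-x b = subst (Collinear y z) (sym (lookup∘tabulate {A = Point m} x b))

  x-col : ∀ b → Collinear y z (lookup xs b) → Collinear y z (x b)
  x-col b = subst (Collinear y z) (lookup∘tabulate {A = Point m} x b)

  far-vertex : 3 ≤ m → ∃ λ (b : Fin m) → sub b ≢ i × sub b ≢ suc i
  far-vertex (s≤s (s≤s (s≤s _))) with i ≟ 1
  ... | yes refl = 2F , (λ ()) , λ ()
  ... | no i≢1   = 0F , i≢1 ∘ sym , λ eq → n≮0 (≤-trans 1≤i (≤-reflexive (sym (suc-injective eq))))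

  triangles : 3 ≤ m → 0 < tri (y ∷ z ∷ toList xs) × tri (y ∷ z ∷ toList xs) + 2 ≤ m
  triangles 3≤m = shape-tri shape {k = proj₁ far} xᵢ<x
    (col-x xᵢ (col₃ (near-middle (inj₁ sub-xᵢ))))
    (col-x xᵢ₊₁ (col₃ (near-middle (inj₂ (cong suc (Fin.toℕ-fromℕ< i<m))))))
    (far-triangle (proj₁ (proj₂ far)) (proj₂ (proj₂ far)) ∘ x-col (proj₁ far))
    where
    far = far-vertex 3≤m
    xᵢ₊₁ : Fin m
    xᵢ₊₁ = Fin.fromℕ< i<m
    xᵢ<x : xᵢ Fin.< xᵢ₊₁
    xᵢ<x = ≤-reflexive (≡-trans sub-xᵢ (sym (Fin.toℕ-fromℕ< i<m)))

module SShape {m} (2≤m : 2 ≤ m)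
              (l : ∀ v → symmetrize (S⁴-arcs (3 + m)) v v ≡ 0) (c : Connected (symmetrize (S⁴-arcs (3 + m)))) where
  open S 2≤m
  open LineGraph line l c public

  mono : ∀ {a b : Fin (suc m)} → a Fin.< b → pos (x a) ≤ pos (x b)
  mono a<b = s≤s (<⇒≤ a<b)

  first-middle : β z y (x 0F)
  first-middle = β-intro {z} {y} {x 0F} (≡-trans refl (+-comm 1 m))

  last-middle : ∀ {b} → suc (toℕ b) ≡ suc m → β y z (x b)
  last-middle {b} eq = β-intro {y} {z} {x b} (≡-trans eq (≡-trans (+-comm 1 m)
    (cong (m +_) (sym (≡-trans (cong ∣ 2 + m -_∣ eq) (∣1+n-n∣≡1 (suc m)))))))

  self-cancel : ∀ p {q} → p ≡ p + q + q → q ≡ 0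
  self-cancel p {q} eq = m+n≡0⇒m≡0 q (sym (+-cancelˡ-≡ p 0 (q + q)
    (≡-trans (+-identityʳ p) (≡-trans eq (+-assoc p q q)))))

  -- With `m` = `j` + `e`, the distances are `j` + 1 from `y`, `e` + 1 from `z` and `j` + `e`
  -- between `y` and `z`. If one is the sum of the other two, then `j` or `e` vanishes, or `m`
  -- equals `m` + 2.
  inner-triangle : ∀ {b} → toℕ b ≢ 0 → suc (toℕ b) ≢ suc m → ¬ Collinear y z (x b)
  inner-triangle {b} b≢0 b≢m col = absurd (middle col)
    where
    open ≡-Reasoning
    j e : ℕ
    j = toℕ b
    e = m ∸ j
    m≡ : j + e ≡ m
    m≡ = m+[n∸m]≡n (s≤s⁻¹ (Fin.toℕ<n b))
    dist-z : ∣ suc m - j ∣ ≡ suc e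
    dist-z = begin
      ∣ suc m - j ∣        ≡⟨ cong (λ n → ∣ n - j ∣) (≡-trans (cong suc (sym m≡)) (sym (+-suc j e))) ⟩
      ∣ j + suc e - j ∣    ≡⟨ ∣-∣-comm (j + suc e) j ⟩
      ∣ j - (j + suc e) ∣  ≡⟨ ∣m-m+n∣≡n j (suc e) ⟩
      suc e                ∎
    absurd : ¬ Middle y z (x b)
    absurd (mid₁ h) = b≢0 (self-cancel e (suc-injective (begin
      suc e             ≡⟨ dist-z ⟨
      ∣ suc m - j ∣     ≡⟨ β-elim {z} {y} {x b} h ⟩
      m + suc j         ≡⟨ cong (_+ suc j) (≡-trans (sym m≡) (+-comm j e)) ⟩
      e + j + suc j     ≡⟨ +-suc (e + j) j ⟩
      suc (e + j + j)   ∎)))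
    absurd (mid₂ h) = b≢m (cong suc (≡-trans (sym (+-identityʳ j)) (≡-trans (cong (j +_) (sym e≡0)) m≡)))
      where
      e≡0 : e ≡ 0
      e≡0 = self-cancel j (suc-injective (begin
        suc j                ≡⟨ β-elim {y} {z} {x b} h ⟩
        m + ∣ suc m - j ∣    ≡⟨ cong₂ _+_ (sym m≡) dist-z ⟩
        j + e + suc e        ≡⟨ +-suc (j + e) e ⟩
        suc (j + e + e)      ∎))
    absurd (mid₃ h) = m≢1+n+m m {1} (begin
      m                          ≡⟨ β-elim {y} {x b} {z} h ⟩
      suc j + ∣ j - suc m ∣      ≡⟨ cong (suc j +_) (≡-trans (∣-∣-comm j (suc m)) dist-z) ⟩
      suc j + suc e              ≡⟨ cong suc (+-suc j e) ⟩
      suc (suc (j + e))          ≡⟨ cong (2 +_) m≡ ⟩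
      suc (1 + m)                ∎)

  shape : Shape xs y z zero (Fin.fromℕ (suc m)) sMid
  shape = record
    { ordered = xs-ordered mono
    ; slot-q  = xs-slot mono y zero (λ _ → refl) (λ _ → refl) (λ _ ()) (λ _ _ → z≤n)
    ; slot-r  = xs-slot mono z (Fin.fromℕ (suc m)) (λ _ → refl) (λ _ → refl)
        (λ b _ → pos≤ (x b))
        (λ b a≤b → contradiction (≤-trans (≤-reflexive (sym (Fin.toℕ-fromℕ (suc m)))) a≤b) (<⇒≱ (Fin.toℕ<n b)))
    ; mids    = mids
    }
    where
    mids : ∀ j → IsMid y z (lookup xs j) (sMid j)
    mids j rewrite lookup∘tabulate {A = Point (suc m)} x j with toℕ j ≟ 0 | suc (toℕ j) ≟ suc m
    ... | yes eq | _ rewrite Fin.toℕ-injective {i = j} {j = 0F} eq = is₁ first-middle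
    ... | no neq | yes eq rewrite dec-false (toℕ j ≟ 0) neq | dec-true (suc (toℕ j) ≟ suc m) eq = is₂ (last-middle eq)
    ... | no neq | no neq′ rewrite dec-false (toℕ j ≟ 0) neq | dec-false (suc (toℕ j) ≟ suc m) neq′ =
      isₙ (inner-triangle neq neq′)

  triangles : 0 < tri (y ∷ z ∷ toList xs) × tri (y ∷ z ∷ toList xs) + 2 ≤ suc m
  triangles = shape-tri shape {k = inner} 0<last (at 0F (col₁ first-middle))
    (at (Fin.fromℕ m) (col₂ (last-middle (cong suc (Fin.toℕ-fromℕ m)))))
    (inner-triangle inner≢0 inner≢m ∘ subst (Collinear y z) (lookup∘tabulate {A = Point (suc m)} x inner))
    where
    at : ∀ b → Collinear y z (x b) → Collinear y z (lookup xs b)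
    at b = subst (Collinear y z) (sym (lookup∘tabulate {A = Point (suc m)} x b))
    0<last : 0 < toℕ (Fin.fromℕ m)
    0<last = subst (0 <_) (sym (Fin.toℕ-fromℕ m)) (≤-trans (s≤s z≤n) 2≤m)
    1<1+m : 1 < suc m
    1<1+m = m<n⇒m<1+n 2≤m
    inner : Fin (suc m)
    inner = Fin.fromℕ< 1<1+m
    inner≡ : toℕ inner ≡ 1
    inner≡ = Fin.toℕ-fromℕ< 1<1+m
    inner≢0 : toℕ inner ≢ 0
    inner≢0 eq = 1+n≢0 (≡-trans (sym inner≡) eq)
    inner≢m : suc (toℕ inner) ≢ suc m
    inner≢m eq = <⇒≢ 2≤m (≡-trans (sym inner≡) (suc-injective eq))

-- The codes of the small listed graphs

vertices : ∀ B → Vec (BetweennessStructure.Carrier B) (order B)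
vertices B = tabulate (Finite.element (BetweennessStructure.finite B))

vertices-complete : ∀ B → Counting.Complete B (vertices B)
vertices-complete B = ↭-reflexive (toList-tabulate _)

graphCode : ∀ G → Code (order (induced G))
graphCode G = Betweenness.code (induced G) (vertices (induced G))

-- By `refl` the shortest distances and the resulting middles are evaluated, which ties the explicit
-- codes to the graphs.
K₃-code : graphCode K₃ ≡ k₃
K₃-code = refl

K₁₃-code : graphCode K₁₃ ≡ k₁₃
K₁₃-code = refl

C₄-1122-code : graphCode C₄-1122 ≡ c₄-1122
C₄-1122-code = refl

K₂₃-code : graphCode K₂₃ ≡ k₂₃
K₂₃-code = refl

K₃₃-code : graphCode K₃₃ ≡ k₃₃
K₃₃-code = refl

K₃₃-e-code : graphCode K₃₃-e ≡ k₃₃-e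
K₃₃-e-code = refl

K₃₃-2e-code : graphCode K₃₃-2e ≡ k₃₃-2e
K₃₃-2e-code = refl

C₆-code : graphCode C₆ ≡ c₆
C₆-code = refl

5≤5 : 5 ≤ 5
5≤5 = m≤m+n 5 0

5≤6 : 5 ≤ 6
5≤6 = m≤m+n 5 1

1∈I⁴5 : 1 ∈I⁴ 5
1∈I⁴5 = ≤-refl , ≤-refl

1∈I⁴6 : 1 ∈I⁴ 6
1∈I⁴6 = ≤-refl , m≤m+n 1 1

2∈I⁴6 : 2 ∈I⁴ 6
2∈I⁴6 = m≤m+n 1 1 , ≤-refl

R₅₁-code : graphCode (R⁴ 5 1 5≤5 1∈I⁴5) ≡ r₅₁
R₅₁-code = refl

R₆₁-code : graphCode (R⁴ 6 1 5≤6 1∈I⁴6) ≡ r₆₁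
R₆₁-code = refl

R₆₂-code : graphCode (R⁴ 6 2 5≤6 2∈I⁴6) ≡ r₆₂
R₆₂-code = refl

S₅-code : graphCode (S⁴ 5 5≤5) ≡ s₅
S₅-code = refl

S₆-code : graphCode (S⁴ 6 5≤6) ≡ s₆
S₆-code = refl

-- The classification

module Minimal (B : BetweennessStructure) where
  open TrianglePairs B
  open Shapes B using (Classifiable; slot; order≥5; analyse; linear-resp-↭)

  tri≥minimum : ∀ n {ps} → Unique ps → length ps ≡ n → 0 < tri ps → 1 ⊔ (n ∸ 4) ≤ tri ps
  -- Up to five points the bound reduces to 1.
  tri≥minimum 0 u len 0< = 0<
  tri≥minimum 1 u len 0< = 0<
  tri≥minimum 2 u len 0< = 0<
  tri≥minimum 3 u len 0< = 0<
  tri≥minimum 4 u len 0< = 0<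
  tri≥minimum 5 u len 0< = 0<
  tri≥minimum 6 {ps} u len 0< with tri ps ≤? 2
  ... | no ≰2  = <⇒≤ (≰⇒> ≰2)
  ... | yes ≤2 = fromArranged (classified₆ u len 0< ≤2)
    where
    fromArranged : Arranged ps (_∈ codes₆) → 2 ≤ tri ps
    fromArranged (v , π , v∈) = ≤-reflexive (≡-trans (sym (All.lookup codes₆-nones v∈))
      (≡-trans (nones-code v) (tri-↭ π)))
  tri≥minimum (suc (suc (suc (suc (suc (suc (suc d))))))) {ps} u len 0< with tri ps ≤? 3 + d
  ... | no ≰  = <⇒≤ (≰⇒> ≰)
  ... | yes ≤ = ≤-reflexive (sym (proj₁ (hasPair d u len 0< ≤)))

  classifiable : ∀ d {ps} → Unique ps → length ps ≡ 7 + d → 0 < tri ps → tri ps ≤ 3 + d →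
                 Classifiable (5 + d) ps
  classifiable d {ps} u len 0< ≤3+d = fromPair (hasPair d u len 0< ≤3+d)
    where
    fromPair : tri ps ≡ 3 + d × (∃ λ q → ∃ λ r → Pair ps q r) → Classifiable (5 + d) ps
    fromPair (tri≡ , q , r , pair)
      with rs , π ← pair-remove pair
      with lq , lr ← pair-linear u pair π
      with uqr@(_ ∷ _ ∷ urs) ← unique-resp-↭ π u
      with v , ρ , o ← order≥5 d urs (λ p∈ q∈ r∈ → lq (there p∈) (there q∈) (there r∈))
             (suc-injective (suc-injective (≡-trans (sym (↭-length π)) len)))
      = restore (analyse v uv o (proj₂ sq) (proj₂ sr)
          (subst (0 <_) (sym tri₁≡) z<s)
          (≤-reflexive (≡-trans (cong (_+ 2) tri₁≡) (+-comm (3 + d) 2))))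
      where
      σ : q ∷ r ∷ toList v ↭ ps
      σ = ↭-trans (↭-prep q (↭-prep r ρ)) (↭-sym π)
      uv : Unique (q ∷ r ∷ toList v)
      uv = unique-resp-↭ (↭-sym σ) u
      lqv : Linear (q ∷ toList v)
      lqv = linear-resp-↭ (↭-prep q (↭-sym ρ)) lq
      lrv : Linear (r ∷ toList v)
      lrv = linear-resp-↭ (↭-prep r (↭-sym ρ)) lr
      -- All triangles contain `q` and `r`, so 3 + `d` of the 5 + `d` points of `v` are their third
      -- corners, and exactly two points are left that are collinear with `q` and `r`.
      tri₁≡ : tri₁ q r (toList v) ≡ 3 + d
      tri₁≡ = ≡-trans (sym (tri-linear lqv lrv)) (≡-trans (tri-↭ σ) tri≡)
      sq = slot v o (Betweenness.drop₂ B uv) lqv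
      sr = slot v o (unique-tail uv) lrv
        where
        unique-tail : ∀ {p : Carrier} {l} → Unique (p ∷ l) → Unique l
        unique-tail (_ ∷ u) = u
      restore : Classifiable (5 + d) (q ∷ r ∷ toList v) → Classifiable (5 + d) ps
      restore (w , q′ , r′ , τ , out) = w , q′ , r′ , ↭-trans τ σ , out

coSize≡tri-vertices : ∀ B → coSize B ≡ Triangles.tri B (toList (vertices B))
coSize≡tri-vertices B = ≡-trans (Counting.coSize≡tri B) (sym (Triangles.tri-↭ B (vertices-complete B)))

coSize-graphCode : ∀ G {c m} → graphCode G ≡ c → nones c ≡ m → coSize (induced G) ≡ m
coSize-graphCode G refl refl =
  ≡-trans (coSize≡tri-vertices (induced G)) (sym (Triangles.nones-code (induced G) (vertices (induced G))))

coSize≥minimum : ∀ B {n} → order B ≡ n → 0 < coSize B → 1 ⊔ (n ∸ 4) ≤ coSize B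
coSize≥minimum B {n} refl 0< = subst (1 ⊔ (n ∸ 4) ≤_) (sym coSize≡)
  (Minimal.tri≥minimum B n C.elements-unique (length-tabulate _) (subst (0 <_) coSize≡ 0<))
  where
  module C = Counting B
  coSize≡ = C.coSize≡tri

-- The triangles of the graph are estimated from above only; that there is one at all makes the
-- general minimum available as the lower estimate, and the two agree.
squeezed : ∀ B {m ps} → toList (vertices B) ≡ ps → order B ≡ 2 + m →
           0 < Triangles.tri B ps × Triangles.tri B ps + 2 ≤ m → coSize B ≡ 1 ⊔ (m ∸ 2)
squeezed B {m} refl order≡ (0< , ≤m) rewrite sym (coSize≡tri-vertices B) = ≤-antisym
  (≤-trans (m+n≤o⇒m≤o∸n (coSize B) ≤m) (m≤n⊔m 1 (m ∸ 2)))
  (coSize≥minimum B order≡ 0<)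

vertices-unique : ∀ B → Unique (toList (vertices B))
vertices-unique B = Counting.complete-unique B {v = vertices B} (vertices-complete B)

module _ {m i} (3≤m : 3 ≤ m) (i∈I : i ∈I⁴ (2 + m)) where
  private
    bound : ∀ {m} → 3 ≤ m → i ≤ ⌈ m ∸ 1 /2⌉ → i < m
    bound (s≤s {n = k} _) i≤ = s≤s (≤-trans i≤ (⌈n/2⌉≤n k))
    i<m : i < m
    i<m = bound 3≤m (proj₂ i∈I)
    G = R⁴ (2 + m) i (s≤s (s≤s 3≤m)) i∈I
    module G = RShape i (proj₁ i∈I) i<m (WeightedGraph.loopless G) (WeightedGraph.connected G)

  R-graph : WeightedGraph
  R-graph = G.graph

  R⁴≡R-graph : G ≡ R-graph
  R⁴≡R-graph = refl

  R-coSize : coSize (induced R-graph) ≡ 1 ⊔ (m ∸ 2)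
  R-coSize = squeezed (induced R-graph) {ps = y ∷ z ∷ toList (tabulate x)} refl refl (G.triangles 3≤m)

  R-code : ∀ {a} → toℕ a ≡ i → graphCode R-graph ≡ shapeCode a a (rMid a)
  R-code eq = ≡-trans (G.shape-code (vertices-unique (induced R-graph)) G.shape)
    (cong (λ a → shapeCode a a (rMid a)) (Fin.toℕ-injective (≡-trans G.place≡ (sym eq))))

module _ {m} (2≤m : 2 ≤ m) where
  private
    G = S⁴ (3 + m) (s≤s (s≤s (s≤s 2≤m)))
    module G = SShape 2≤m (WeightedGraph.loopless G) (WeightedGraph.connected G)

  S-graph : WeightedGraph
  S-graph = G.graph

  S⁴≡S-graph : G ≡ S-graph
  S⁴≡S-graph = refl

  S-coSize : coSize (induced S-graph) ≡ 1 ⊔ (suc m ∸ 2)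
  S-coSize = squeezed (induced S-graph) {ps = y ∷ z ∷ toList (tabulate x)} refl refl G.triangles

  S-code : graphCode S-graph ≡ shapeCode zero last sMid
  S-code = G.shape-code (vertices-unique (induced S-graph)) G.shape

Listed-coSize : ∀ {G} → Listed G → coSize (induced G) ≡ 1 ⊔ (order (induced G) ∸ 4)
Listed-coSize (isR⁴ (suc (suc m)) i (s≤s (s≤s 3≤m)) i∈I) =
  subst (λ G → coSize (induced G) ≡ 1 ⊔ (order (induced G) ∸ 4)) (sym (R⁴≡R-graph 3≤m i∈I)) (R-coSize 3≤m i∈I)
Listed-coSize (isS⁴ (suc (suc (suc m))) (s≤s (s≤s (s≤s 2≤m)))) =
  subst (λ G → coSize (induced G) ≡ 1 ⊔ (order (induced G) ∸ 4)) (sym (S⁴≡S-graph 2≤m)) (S-coSize 2≤m)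
Listed-coSize isK₃      = coSize-graphCode K₃ K₃-code refl
Listed-coSize isK₁₃     = coSize-graphCode K₁₃ K₁₃-code refl
Listed-coSize isC₄-1122 = coSize-graphCode C₄-1122 C₄-1122-code refl
Listed-coSize isK₂₃     = coSize-graphCode K₂₃ K₂₃-code refl
Listed-coSize isK₃₃     = coSize-graphCode K₃₃ K₃₃-code refl
Listed-coSize isK₃₃-e   = coSize-graphCode K₃₃-e K₃₃-e-code refl
Listed-coSize isK₃₃-2e  = coSize-graphCode K₃₃-2e K₃₃-2e-code refl
Listed-coSize isC₆      = coSize-graphCode C₆ C₆-code refl

module _ (B : BetweennessStructure) where
  open Shapes B
  open Counting B using (elements; elements-unique; Complete)

  Recognised : Set₁
  Recognised = ∃ λ G → Listed G × B ≅ induced G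

  fromGraphCode : ∀ {G c} → Listed G → graphCode G ≡ c → (v : Vec Carrier (order (induced G))) →
                  Complete v → code v ≡ c → Recognised
  fromGraphCode {G} listed refl v π eq =
    G , listed , same-code⇒≅ B (induced G) v (vertices (induced G)) π (vertices-complete (induced G)) eq

  fromR : ∀ {m} → 5 ≤ m → ∀ {q r a} {v : Vec Carrier m} → Complete (q ∷ r ∷ v) → 1 ≤ toℕ a → toℕ a ≤ ⌊ m /2⌋ →
          Shape v q r a a (rMid a) → Recognised
  fromR {suc m} 5≤m {q} {r} {a} {v} π 1≤a a≤ s =
    fromGraphCode (subst Listed (R⁴≡R-graph 3≤m i∈I) (isR⁴ (3 + m) (toℕ a) (s≤s (s≤s 3≤m)) i∈I))
      (R-code 3≤m i∈I refl) (q ∷ r ∷ v) π (shape-code (Counting.complete-unique B {v = q ∷ r ∷ v} π) s)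
    where
    3≤m : 3 ≤ suc m
    3≤m = ≤-trans (m≤m+n 3 2) 5≤m
    -- The bounds coincide, as `⌈ m /2⌉` unfolds to `⌊ suc m /2⌋`.
    i∈I : toℕ a ∈I⁴ (3 + m)
    i∈I = 1≤a , a≤

  fromS : ∀ {m} → 5 ≤ m → ∀ {q r} {v : Vec Carrier m} → Complete (q ∷ r ∷ v) →
          Shape v q r zero last sMid → Recognised
  fromS {suc m} 5≤m {q} {r} {v} π s =
    fromGraphCode (subst Listed (S⁴≡S-graph 2≤m) (isS⁴ (3 + m) (s≤s (s≤s (s≤s 2≤m)))))
      (S-code 2≤m) (q ∷ r ∷ v) π (shape-code (Counting.complete-unique B {v = q ∷ r ∷ v} π) s)
    where
    2≤m : 2 ≤ m
    2≤m = ≤-trans (m≤m+n 2 2) (s≤s⁻¹ 5≤m)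

  recognise₃ : Arranged elements (_∈ codes₃) → Recognised
  recognise₃ (v , π , here eq) = fromGraphCode isK₃ K₃-code v π eq

  recognise₄ : Arranged elements (_∈ codes₄) → Recognised
  recognise₄ (v , π , here eq)         = fromGraphCode isK₁₃ K₁₃-code v π eq
  recognise₄ (v , π , there (here eq)) = fromGraphCode isC₄-1122 C₄-1122-code v π eq

  recognise₅ : Arranged elements (_∈ codes₅) → Recognised
  recognise₅ (v , π , here eq)                 = fromGraphCode isK₂₃ K₂₃-code v π eq
  recognise₅ (v , π , there (here eq))         = fromGraphCode (isR⁴ 5 1 5≤5 1∈I⁴5) R₅₁-code v π eq
  recognise₅ (v , π , there (there (here eq))) = fromGraphCode (isS⁴ 5 5≤5) S₅-code v π eq

  recognise₆ : Arranged elements (_∈ codes₆) → Recognised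
  recognise₆ (v , π , here eq)                                                 = fromGraphCode isK₃₃ K₃₃-code v π eq
  recognise₆ (v , π , there (here eq))                                         = fromGraphCode isK₃₃-e K₃₃-e-code v π eq
  recognise₆ (v , π , there (there (here eq)))                                 = fromGraphCode isK₃₃-2e K₃₃-2e-code v π eq
  recognise₆ (v , π , there (there (there (here eq))))                         = fromGraphCode isC₆ C₆-code v π eq
  recognise₆ (v , π , there (there (there (there (here eq)))))                 = fromGraphCode (isR⁴ 6 1 5≤6 1∈I⁴6) R₆₁-code v π eq
  recognise₆ (v , π , there (there (there (there (there (here eq))))))         = fromGraphCode (isR⁴ 6 2 5≤6 2∈I⁴6) R₆₂-code v π eq
  recognise₆ (v , π , there (there (there (there (there (there (here eq))))))) = fromGraphCode (isS⁴ 6 5≤6) S₆-code v π eq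

  recognise : ∀ n → order B ≡ n → 3 ≤ n → 0 < tri elements → tri elements ≤ 1 ⊔ (n ∸ 4) → Recognised
  recognise 1 _ (s≤s ()) _ _
  recognise 2 _ (s≤s (s≤s ())) _ _
  recognise 3 eq _ 0< ≤min = recognise₃ (classified₃ elements-unique (≡-trans (length-tabulate _) eq) 0< ≤min)
  recognise 4 eq _ 0< ≤min = recognise₄ (classified₄ elements-unique (≡-trans (length-tabulate _) eq) 0< ≤min)
  recognise 5 eq _ 0< ≤min = recognise₅ (classified₅ elements-unique (≡-trans (length-tabulate _) eq) 0< ≤min)
  recognise 6 eq _ 0< ≤min = recognise₆ (classified₆ elements-unique (≡-trans (length-tabulate _) eq) 0< ≤min)
  recognise (suc (suc (suc (suc (suc (suc (suc d))))))) eq _ 0< ≤min =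
    fromClassifiable (Minimal.classifiable B d elements-unique (≡-trans (length-tabulate _) eq) 0< ≤min)
    where
    fromClassifiable : Classifiable (5 + d) elements → Recognised
    fromClassifiable (v , q , r , π , isR a 1≤a a≤ s) = fromR (m≤m+n 5 d) {v = v} π 1≤a a≤ s
    fromClassifiable (v , q , r , π , isS s)          = fromS (m≤m+n 5 d) {v = v} π s

τ-minimum : ∀ n → 3 ≤ n → τ⟨ n , 0 ⟩≡ (1 ⊔ (n ∸ 4))
τ-minimum n 3≤n = (m≤m⊔n 1 (n ∸ 4) , attained n 3≤n) ,
  λ m′ 0<m′ (B , order≡ , coSize≡) → subst (1 ⊔ (n ∸ 4) ≤_) coSize≡
    (coSize≥minimum B order≡ (subst (0 <_) (sym coSize≡) 0<m′))
  where
  listed⇒attained : ∀ {G} → Listed G → B⟨ order (induced G) , 1 ⊔ (order (induced G) ∸ 4) ⟩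
  listed⇒attained {G} listed = induced G , refl , Listed-coSize listed
  attained : ∀ n → 3 ≤ n → B⟨ n , 1 ⊔ (n ∸ 4) ⟩
  attained 1 (s≤s ())
  attained 2 (s≤s (s≤s ()))
  attained 3 _ = listed⇒attained isK₃
  attained 4 _ = listed⇒attained isK₁₃
  attained (suc (suc (suc (suc (suc k))))) _ = listed⇒attained (isS⁴ (5 + k) (m≤m+n 5 k))

quasilinear⇔listed : (B : BetweennessStructure) → 3 ≤ order B →
                     Quasilinear B ⇔ (∃[ G ] Listed G × B ≅ induced G)
quasilinear⇔listed B 3≤n = mk⇔
  (λ ((0< , _) , least) → recognise B (order B) refl 3≤n (subst (0 <_) coSize≡ 0<)
    (subst (_≤ 1 ⊔ (order B ∸ 4)) coSize≡
      (least _ (m≤m⊔n 1 (order B ∸ 4)) (proj₂ (proj₁ (τ-minimum (order B) 3≤n))))))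
  (λ (G , listed , iso) → subst (τ⟨ order B , 0 ⟩≡_)
    (sym (≡-trans (≅⇒coSize≡ iso) (≡-trans (Listed-coSize listed)
      (cong (λ n → 1 ⊔ (n ∸ 4)) (sym (≅⇒order≡ iso))))))
    (τ-minimum (order B) 3≤n))
  where coSize≡ = Counting.coSize≡tri B

theorem1 :
    ((n : ℕ) → 3 ≤ n → τ⟨ n , 0 ⟩≡ (1 ⊔ (n ∸ 4))) ×
    ((B : BetweennessStructure) → 3 ≤ order B →
      Quasilinear B ⇔ (∃[ G ] Listed G × B ≅ induced G))
theorem1 = τ-minimum , quasilinear⇔listed
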